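{- Let $k=p^r$ where $p$ is prime, $r\in\mathbb{N}$, and $k>2$. Suppose $G$ is a connected $n$-vertex simple graph with $m$ edges, and $T$ is a spanning tree of $G$. Then the following statements hold. (i) Let $q=\lfloor k/2\rfloor$. Let $G'$ be the multigraph obtained from $G$ by adding $q-1$ parallel edges to each edge $e\in E(G)-E(T)$ (so each such edge has multiplicity $q$ in $G'$). If $\chi_{DP}(G')\le k$ and $m\le n\bigl(1+(k-2)/q\bigr)-1+1/q$, then $$P_{DP}(G,k)\ge k^{(n(q+k-2)-qm+1-q)/(k-1)}.$$ (ii) If $\chi_{DP}(G)\le k$ and $m\le 2n-\frac{k-3}{k-2}$, then $$P_{DP}(G,k)\ge k^{((2n-m)(k-2)-(k-3))/(k-1)}.$$
   Context: All multigraphs are finite and loopless. For a multigraph $G$ and vertices $u,v$, $e_G(u,v)$ is the number of edges joining $u$ and $v$; the underlying simple graph of $G$ has an edge $uv$ exactly when $e_G(u,v)\ge1$. For a finite set $A$, $S_A$ is the symmetric group on $A$. For nonempty $S\subseteq S_A$, an $S$-labeling of $G$ is a pair $(D,\sigma)$ where $D$ is an orientation of the underlying simple graph of $G$ and $\sigma$ assigns to each arc $(u,v)$ of $D$ an $e_G(u,v)$-tuple of elements of $S$ (a single element of $S$ when $G$ is simple). A proper $S$-coloring of $(D,\sigma)$ is a map $\kappa:V(G)\to A$ such that for every arc $(u,v)\in E(D)$ and every coordinate $\pi$ of $\sigma(u,v)$, $\pi(\kappa(u))\ne\kappa(v)$; it is a proper $S$-$k$-coloring if $|\kappa(V(G))|\le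 k$. $P_S(G,k)$ is the minimum, over all $S$-labelings $(D,\sigma)$ of $G$, of the number of proper $S$-$k$-colorings of $(D,\sigma)$. With $|A|=k$, the DP color function is $P_{DP}(G,k)=P_{S_A}(G,k)$. $G$ is DP-$k$-colorable if every $S_A$-labeling of $G$ with $|A|=k$ has a proper $S_A$-$k$-coloring, and the DP-chromatic number $\chi_{DP}(G)$ is the least such $k$. -}

module Defs where

open import Data.Nat using (ℕ; zero; suc; _+_; _*_; _∸_; _≤_; _<_; _≟_; _<ᵇ_)
open import Data.Nat.DivMod using (_/_)
open import Data.Bool using (Bool; true; false; T; if_then_else_)
open import Data.Fin using (Fin; zero; suc; inject₁; fromℕ; toℕ)
open import Data.Fin.Properties using (all?; _≟_)
open import Data.Fin.Permutation using (Permutation; _⟨$⟩ʳ_)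
open import Data.List using (List; []; _∷_; map; concatMap; filter; length; allFin)
open import Data.Nat.ListAction using (sum)
open import Data.Product using (Σ; ∃; _×_; _,_)
open import Data.Sum using (_⊎_)
open import Function.Definitions using (Injective)
open import Relation.Nullary using (¬_; Dec; does)
open import Relation.Nullary.Decidable using (T?; ¬?; _→-dec_)
open import Relation.Binary.PropositionalEquality using (_≡_; refl; cong; sym)

record Multigraph (n : ℕ) : Set where
  field
    mult     : Fin n → Fin n → ℕ
    symm     : ∀ u v → mult u v ≡ mult v u
    loopless : ∀ v → mult v v ≡ 0
open Multigraph public

IsSimple : ∀ {n} → Multigraph n → Set
IsSimple {n} G = ∀ (u v : Fin n) → mult G u v ≤ 1

Adj : ∀ {n} → Multigraph n → Fin n → Fin n → Set
Adj G u v = 1 ≤ mult G u v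

data Walk {n : ℕ} (G : Multigraph n) : Fin n → Fin n → Set where
  here : ∀ {u} → Walk G u u
  step : ∀ {u v w} → Adj G u v → Walk G v w → Walk G u w

Connected : ∀ {n} → Multigraph n → Set
Connected {n} G = ∀ (u v : Fin n) → Walk G u v

HasCycle : ∀ {n} → Multigraph n → Set
HasCycle {n} G =
  Σ ℕ λ j → Σ (Fin (suc (suc (suc j))) → Fin n) λ c →
    Injective _≡_ _≡_ c ×
    (∀ (i : Fin (suc (suc j))) → Adj G (c (inject₁ i)) (c (suc i))) ×
    Adj G (c (fromℕ (suc (suc j)))) (c zero)

IsTree : ∀ {n} → Multigraph n → Set
IsTree T = IsSimple T × Connected T × ¬ HasCycle T

IsSpanningTree : ∀ {n} → Multigraph n → Multigraph n → Set
IsSpanningTree {n} G T = IsTree T × (∀ (u v : Fin n) → mult T u v ≤ mult G u v)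

edgeCount : ∀ {n} → Multigraph n → ℕ
edgeCount {n} G =
  sum (concatMap (λ u → map (λ v → if toℕ u <ᵇ toℕ v then mult G u v else 0)
                            (allFin n))
                 (allFin n))

multiplyOff : ∀ {n} → ℕ → (G T : Multigraph n) → Multigraph n
multiplyOff {n} q G T = record { mult = m ; symm = s ; loopless = l }
  where
  m : Fin n → Fin n → ℕ
  m u v = if does (mult T u v Data.Nat.≟ 0) then q * mult G u v else mult G u v
  s : ∀ u v → m u v ≡ m v u
  s u v rewrite symm T u v | symm G u v = refl
  l : ∀ v → m v v ≡ 0
  l v rewrite loopless T v | loopless G v = Data.Nat.Properties.*-zeroʳ q
    where import Data.Nat.Properties

-- S_A-labelings with A = Fin k (S_A = all permutations of Fin k)

record Labeling {n : ℕ} (G : Multigraph n) (k : ℕ) : Set where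
  field
    orient   : Fin n → Fin n → Bool
    orientE  : ∀ u v → 1 ≤ mult G u v →
                 (orient u v ≡ true × orient v u ≡ false) ⊎
                 (orient u v ≡ false × orient v u ≡ true)
    orientN  : ∀ u v → mult G u v ≡ 0 → orient u v ≡ false
    σ        : (u v : Fin n) → Fin (mult G u v) → Permutation k k
open Labeling public

Proper : ∀ {n k} {G : Multigraph n} → Labeling G k → (Fin n → Fin k) → Set
Proper {n} {k} {G} L κ =
  ∀ (u v : Fin n) → T (orient L u v) →
    ∀ (i : Fin (mult G u v)) → ¬ ((σ L u v i ⟨$⟩ʳ κ u) ≡ κ v)

proper? : ∀ {n k} {G : Multigraph n} (L : Labeling G k) (κ : Fin n → Fin k) →
          Dec (Proper L κ)
proper? {n} {k} {G} L κ =
  all? λ u → all? λ v → T? (orient L u v) →-dec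
    all? λ i → ¬? ((σ L u v i ⟨$⟩ʳ κ u) Data.Fin.Properties.≟ κ v)

allMaps : (n k : ℕ) → List (Fin n → Fin k)
allMaps zero    k = (λ ()) ∷ []
allMaps (suc n) k =
  concatMap (λ c → map (λ f → λ { zero → c ; (suc i) → f i }) (allMaps n k))
            (allFin k)

-- number of proper S_A-k-colorings of L (|A| = k, so |κ(V)| ≤ k is automatic)
numColorings : ∀ {n k} {G : Multigraph n} → Labeling G k → ℕ
numColorings {n} {k} L = length (filter (proper? L) (allMaps n k))

IsPDP : ∀ {n} → Multigraph n → ℕ → ℕ → Set
IsPDP G k P =
  (Σ (Labeling G k) λ L → numColorings L ≡ P) ×
  (∀ (L : Labeling G k) → P ≤ numColorings L)

DPColorable : ∀ {n} → Multigraph n → ℕ → Set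
DPColorable {n} G k = ∀ (L : Labeling G k) → ∃ λ (κ : Fin n → Fin k) → Proper L κ

-- χ_DP(G) ≤ k  (the least DP-colorable j is ≤ k iff some j ≤ k works)
χDP≤ : ∀ {n} → Multigraph n → ℕ → Set
χDP≤ G k = ∃ λ j → j ≤ k × DPColorable G j

{-# OPTIONS --safe #-}
module Submission where

-- Identify the colours with the field F of k = p^r elements. Renaming colours at each vertex along T turns every
-- constraint on a tree edge uv into x_u ≠ x_v, a linear condition. A constraint on another edge says that (x_u , x_v)
-- avoids the graph of a permutation of F. In (ii) that permutation is interpolated by a polynomial of degree k − 2.
-- In (i) its graph is covered by ⌊k/2⌋ lines: pair up the points, starting for odd k from three collinear points, which
-- exist because otherwise the secants of slope 1 would define a fixed-point-free involution on k points. The product of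
-- the edge polynomials is nonzero only at proper colourings, and DP-colourability (of the labeling itself in (ii), of
-- the labeling of G′ by the lines in (i)) gives one nonzero value, so Alon–Füredi bounds the number of nonzero values.

open import Algebra.Bundles using (CommutativeRing; RawRing)
import Algebra.Morphism.RingMonomorphism as RingMonomorphism
open import Algebra.Morphism.Structures using (module RingMorphisms)
import Algebra.Properties.CommutativeMonoid.Sum as MonoidSum
import Algebra.Properties.Semiring.Exp as Exp
open import Algebra.Solver.Ring.AlmostCommutativeRing using (fromCommutativeRing; _-Raw-AlmostCommutative⟶_)
open import Algebra.Structures using (IsCommutativeRing)
open import Data.Empty using (⊥-elim)
open import Data.Fin as Fin using (Fin; toℕ; fromℕ<; finToFun; funToFin; fromℕ; inject₁; punchOut)
open import Data.Fin.Permutation as Perm using (Permutation; _⟨$⟩ʳ_; _⟨$⟩ˡ_)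
import Data.Fin.Properties as Fin
open import Data.Integer as ℤ using (ℤ; +_; -[1+_]; _⊖_)
import Data.Integer.DivMod as ℤ
import Data.Integer.Divisibility.Signed as ℤ∣
import Data.Integer.Properties as ℤ
open import Data.List as List using (List; []; _∷_; _++_; map; concatMap; filter; length; allFin)
open import Data.List.Membership.Propositional using (_∈_; _∉_; lose)
import Data.List.Membership.Propositional.Properties as Mem
import Data.List.Properties as List
open import Data.List.Relation.Unary.All as All using (All; []; _∷_)
open import Data.List.Relation.Unary.Any using (here; there)
open import Data.List.Relation.Unary.Unique.Propositional using (Unique; []; _∷_)
import Data.List.Relation.Unary.Unique.Propositional.Properties as Unique
open import Data.Maybe using (Maybe; just; nothing)
open import Data.Nat as ℕ using (ℕ; zero; suc; _<_; _≤_; z≤n; s≤s; _<?_; _∸_; _!)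
import Data.Nat.Combinatorics as C
import Data.Nat.Combinatorics.Specification as C
import Data.Nat.DivMod as ℕ
import Data.Nat.Divisibility as ℕ∣
open import Data.Nat.ListAction using (sum)
open import Data.Nat.Primality using (Prime; euclidsLemma; prime⇒nonTrivial)
import Data.Nat.Properties as ℕ
open import Data.Product using (Σ; _×_; _,_; ∃; proj₁; proj₂; ∃₂)
open import Data.Sum using (_⊎_; inj₁; inj₂)
open import Data.Unit using (⊤; tt)
import Data.Vec.Functional as VecF
open import Defs using (allMaps)
open import Function using (_∘_; id)
open import Level using (0ℓ)
open import Relation.Binary.Bundles using (Setoid)
open import Relation.Binary.PropositionalEquality as ≡ using (_≡_; _≢_; _≗_)
open import Relation.Nullary using (yes; no; Dec; ¬_)
open import Relation.Nullary.Decidable using (map′; ¬?; _×-dec_)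
open import Relation.Unary using (Decidable)

-- The exponents are a degree count. The n - 1 tree edges contribute degree 1 each, the other m - n
-- + 1 edges degree q in (i) and k - 2 in (ii). A polynomial of degree at most D that is nonzero
-- somewhere on the n-fold product of F is nonzero at no fewer than k^(n - D/(k - 1)) points; D = (n
-- - 1) + q(m - n + 1) yields the exponent of (i), and k - 2 in place of q that of (ii). Lines cost
-- degree q where interpolation costs k - 2, but they may cover points outside the graph of the
-- permutation, so their product can vanish at a proper colouring. A nonzero value must come from a
-- colouring avoiding all the lines, which is why (i) assumes colourability of the multigraph G′.
-- The field is built without irreducible polynomials: roots of X^k - X are adjoined formally to the
-- integers mod p, giving a finite ring that may have zero divisors; dividing out non-units one
-- after another leaves a field in which X^k - X still splits, and its k distinct roots form F.

CRing : Set₁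
CRing = CommutativeRing 0ℓ 0ℓ

-- Equational solving in a commutative ring, with integer coefficients

module IntegerCoefficients (R : CRing) where
  open CommutativeRing R hiding (zero)
  open import Algebra.Properties.Ring ring using (-0#≈0#; -‿involutive; -‿distribˡ-*; -‿distribʳ-*; -‿+-comm)
  open import Algebra.Properties.Semiring.Mult.TCOptimised semiring
    using (×-homo-+; ×1-homo-*; 1+×) renaming (_×_ to _⋆_)
  open import Relation.Binary.Reasoning.Setoid setoid

  -- Integers serve as solver coefficients because their equality is decidable, unlike that of an
  -- abstract ring. With the optimised multiple, `1 ⋆ 1#` is definitionally `1#`, so `con (+ 1)`
  -- denotes `1#` itself.
  fromℤ : ℤ → Carrier
  fromℤ (+ n)    = n ⋆ 1#
  fromℤ -[1+ n ] = - (suc n ⋆ 1#)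

  fromℤ-⊖ : ∀ m n → fromℤ (m ⊖ n) ≈ m ⋆ 1# - n ⋆ 1#
  fromℤ-⊖ m zero = sym (trans (+-congˡ -0#≈0#) (+-identityʳ _))
  fromℤ-⊖ zero (suc n) = sym (+-identityˡ _)
  fromℤ-⊖ (suc m) (suc n) = begin
    fromℤ (suc m ⊖ suc n)                    ≡⟨ ≡.cong fromℤ (ℤ.[1+m]⊖[1+n]≡m⊖n m n) ⟩
    fromℤ (m ⊖ n)                            ≈⟨ fromℤ-⊖ m n ⟩
    m ⋆ 1# - n ⋆ 1#                          ≈⟨ +-congʳ (+-identityʳ _) ⟨
    (m ⋆ 1# + 0#) - n ⋆ 1#                   ≈⟨ +-congʳ (+-congˡ (-‿inverseʳ 1#)) ⟨
    (m ⋆ 1# + (1# - 1#)) - n ⋆ 1#            ≈⟨ +-congʳ (+-assoc _ _ _) ⟨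
    ((m ⋆ 1# + 1#) - 1#) - n ⋆ 1#            ≈⟨ +-assoc _ _ _ ⟩
    (m ⋆ 1# + 1#) + (- 1# - n ⋆ 1#)          ≈⟨ +-cong (+-comm _ _) (-‿+-comm _ _) ⟩
    (1# + m ⋆ 1#) - (1# + n ⋆ 1#)            ≈⟨ +-cong (1+× m 1#) (-‿cong (1+× n 1#)) ⟨
    suc m ⋆ 1# - suc n ⋆ 1#                  ∎

  fromℤ-+ : ∀ i j → fromℤ (i ℤ.+ j) ≈ fromℤ i + fromℤ j
  fromℤ-+ (+ m)    (+ n)    = ×-homo-+ 1# m n
  fromℤ-+ (+ m)    -[1+ n ] = fromℤ-⊖ m (suc n)
  fromℤ-+ -[1+ m ] (+ n)    = trans (fromℤ-⊖ n (suc m)) (+-comm _ _)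
  fromℤ-+ -[1+ m ] -[1+ n ] = begin
    - (suc (suc (m ℕ.+ n)) ⋆ 1#)             ≡⟨ ≡.cong (λ k → - (k ⋆ 1#)) (≡.sym (ℕ.+-suc (suc m) n)) ⟩
    - ((suc m ℕ.+ suc n) ⋆ 1#)               ≈⟨ -‿cong (×-homo-+ 1# (suc m) (suc n)) ⟩
    - (suc m ⋆ 1# + suc n ⋆ 1#)              ≈⟨ -‿+-comm _ _ ⟨
    - (suc m ⋆ 1#) - (suc n ⋆ 1#)            ∎

  fromℤ-neg : ∀ i → fromℤ (ℤ.- i) ≈ - fromℤ i
  fromℤ-neg (+ zero)  = sym -0#≈0#
  fromℤ-neg (+ suc n) = refl
  fromℤ-neg -[1+ n ]  = sym (-‿involutive _)

  fromℤ-+*ˡ : ∀ m j → fromℤ (+ m ℤ.* j) ≈ fromℤ (+ m) * fromℤ j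
  fromℤ-+*ˡ m (+ n) = trans (reflexive (≡.cong fromℤ (≡.sym (ℤ.pos-* m n)))) (×1-homo-* m n)
  fromℤ-+*ˡ m -[1+ n ] = begin
    fromℤ (+ m ℤ.* -[1+ n ])        ≡⟨ ≡.cong fromℤ (ℤ.neg-distribʳ-* (+ m) (+ suc n)) ⟨
    fromℤ (ℤ.- (+ m ℤ.* + suc n))   ≈⟨ fromℤ-neg (+ m ℤ.* + suc n) ⟩
    - fromℤ (+ m ℤ.* + suc n)       ≈⟨ -‿cong (fromℤ-+*ˡ m (+ suc n)) ⟩
    - (m ⋆ 1# * (suc n ⋆ 1#))       ≈⟨ -‿distribʳ-* _ _ ⟩
    m ⋆ 1# * - (suc n ⋆ 1#)         ∎

  fromℤ-* : ∀ i j → fromℤ (i ℤ.* j) ≈ fromℤ i * fromℤ j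
  fromℤ-* (+ m)    j = fromℤ-+*ˡ m j
  fromℤ-* -[1+ m ] j = begin
    fromℤ (-[1+ m ] ℤ.* j)          ≡⟨ ≡.cong fromℤ (ℤ.neg-distribˡ-* (+ suc m) j) ⟨
    fromℤ (ℤ.- (+ suc m ℤ.* j))     ≈⟨ fromℤ-neg (+ suc m ℤ.* j) ⟩
    - fromℤ (+ suc m ℤ.* j)         ≈⟨ -‿cong (fromℤ-+*ˡ (suc m) j) ⟩
    - (suc m ⋆ 1# * fromℤ j)        ≈⟨ -‿distribˡ-* _ _ ⟩
    - (suc m ⋆ 1#) * fromℤ j        ∎

  ℤ-raw : RawRing 0ℓ 0ℓ
  ℤ-raw = record { Carrier = ℤ ; _≈_ = _≡_ ; _+_ = ℤ._+_ ; _*_ = ℤ._*_ ; -_ = ℤ.-_ ; 0# = + 0 ; 1# = + 1 }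

  homomorphism : ℤ-raw -Raw-AlmostCommutative⟶ fromCommutativeRing R
  homomorphism = record
    { ⟦_⟧ = fromℤ ; +-homo = fromℤ-+ ; *-homo = fromℤ-* ; -‿homo = fromℤ-neg
    ; 0-homo = refl ; 1-homo = refl }

  dec : ∀ i j → Maybe (fromℤ i ≈ fromℤ j)
  dec i j with i ℤ.≟ j
  ... | yes ≡.refl = just refl
  ... | no _       = nothing

  open import Algebra.Solver.Ring ℤ-raw (fromCommutativeRing R) homomorphism dec public
    using (solve; _:=_; _:+_; _:*_; _:-_; :-_; con)

-- Adjoining roots of monic polynomials

-- (d , g) stands for the monic polynomial X^d + Σ_{i<d} g i X^i; the values g i with i ≥ d are junk.
module Monic (R : CRing) where
  open CommutativeRing R hiding (zero)
  open IntegerCoefficients R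
  open import Relation.Binary.Reasoning.Setoid setoid

  eval : ℕ → (ℕ → Carrier) → Carrier → Carrier
  eval zero    g x = 1#
  eval (suc d) g x = g 0 + x * eval d (g ∘ suc) x

  deriv : ℕ → (ℕ → Carrier) → Carrier → Carrier
  deriv zero    g x = 0#
  deriv (suc d) g x = eval d (g ∘ suc) x + x * deriv d (g ∘ suc) x

  -- Synthetic division of the monic polynomial of degree `suc d` by X - a: the coefficients of the
  -- quotient are the partial results of Horner's scheme at a. The quotient is again monic, of
  -- degree `d`.
  quot : ℕ → (ℕ → Carrier) → Carrier → (ℕ → Carrier)
  quot zero    g a _       = 0#
  quot (suc d) g a zero    = eval (suc d) (g ∘ suc) a
  quot (suc d) g a (suc i) = quot d (g ∘ suc) a i

  eval-quot : ∀ d g a x → eval (suc d) g x ≈ eval (suc d) g a + (x - a) * eval d (quot d g a) x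
  eval-quot zero g a x =
    solve 3 (λ c a x → c :+ x :* con (+ 1) := c :+ a :* con (+ 1) :+ (x :- a) :* con (+ 1)) refl (g 0) a x
  eval-quot (suc d) g a x = begin
    g 0 + x * eval (suc d) (g ∘ suc) x       ≈⟨ +-congˡ (*-congˡ (eval-quot d (g ∘ suc) a x)) ⟩
    g 0 + x * (e + (x - a) * q)              ≈⟨ solve 5 (λ c a x e q → c :+ x :* (e :+ (x :- a) :* q)
                                                  := c :+ a :* e :+ (x :- a) :* (e :+ x :* q)) refl (g 0) a x e q ⟩
    g 0 + a * e + (x - a) * (e + x * q)      ∎
    where
    e = eval (suc d) (g ∘ suc) a
    q = eval d (quot d (g ∘ suc) a) x

  deriv-quot : ∀ d g a x →
    deriv (suc d) g x ≈ eval d (quot d g a) x + (x - a) * deriv d (quot d g a) x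
  deriv-quot zero g a x =
    solve 2 (λ a x → con (+ 1) :+ x :* con (+ 0) := con (+ 1) :+ (x :- a) :* con (+ 0)) refl a x
  deriv-quot (suc d) g a x = begin
    eval (suc d) (g ∘ suc) x + x * deriv (suc d) (g ∘ suc) x
      ≈⟨ +-cong (eval-quot d (g ∘ suc) a x) (*-congˡ (deriv-quot d (g ∘ suc) a x)) ⟩
    (e + (x - a) * q) + x * (q + (x - a) * q′)
      ≈⟨ solve 5 (λ a x e q q′ → (e :+ (x :- a) :* q) :+ x :* (q :+ (x :- a) :* q′)
           := (e :+ x :* q) :+ (x :- a) :* (q :+ x :* q′)) refl a x e q q′ ⟩
    (e + x * q) + (x - a) * (q + x * q′)     ∎
    where
    e = eval (suc d) (g ∘ suc) a
    q = eval d (quot d (g ∘ suc) a) x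
    q′ = deriv d (quot d (g ∘ suc) a) x

  eval-cong : ∀ d {g h x y} → (∀ i → g i ≈ h i) → x ≈ y → eval d g x ≈ eval d h y
  eval-cong zero    gh xy = refl
  eval-cong (suc d) gh xy = +-cong (gh 0) (*-cong xy (eval-cong d (gh ∘ suc) xy))

  deriv-cong : ∀ d {g h x y} → (∀ i → g i ≈ h i) → x ≈ y → deriv d g x ≈ deriv d h y
  deriv-cong zero    gh xy = refl
  deriv-cong (suc d) gh xy =
    +-cong (eval-cong d (gh ∘ suc) xy) (*-cong xy (deriv-cong d (gh ∘ suc) xy))

  quot-cong : ∀ d {g h} a → (∀ i → g i ≈ h i) → ∀ i → quot d g a i ≈ quot d h a i
  quot-cong zero    a gh i       = refl
  quot-cong (suc d) a gh zero    = eval-cong (suc d) (gh ∘ suc) refl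
  quot-cong (suc d) a gh (suc i) = quot-cong d a (gh ∘ suc) i

  Split : (d : ℕ) → (ℕ → Carrier) → Set
  Split zero    g = ⊤
  Split (suc d) g = Σ Carrier λ a → (eval (suc d) g a ≈ 0#) × Split d (quot d g a)

  split-cong : ∀ (d : ℕ) {g h} → (∀ i → g i ≈ h i) → Split d g → Split d h
  split-cong zero    gh s           = tt
  split-cong (suc d) gh (a , r , s) =
    a , trans (sym (eval-cong (suc d) gh refl)) r , split-cong d (quot-cong d a gh) s

_×⟨_⟩1≈0 : ℕ → CRing → Set
p ×⟨ R ⟩1≈0 = (p ×ᴿ 1#) ≈ 0#
  where
  open CommutativeRing R
  open import Algebra.Properties.Semiring.Mult semiring renaming (_×_ to _×ᴿ_)

-- The enumeration only has to reach every element and may repeat some, so it passes unchanged to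
-- any quotient ring. `size` is therefore an upper bound rather than the cardinality.
record FiniteRing (p : ℕ) : Set₁ where
  infix 4 _≟_
  field
    ring       : CRing
  open CommutativeRing ring hiding (ring) public
  field
    _≟_ : ∀ x y → Dec (x ≈ y)
    size       : ℕ
    enum       : Fin size → Carrier
    index      : Carrier → Fin size
    enum-index : ∀ x → enum (index x) ≈ x
    char       : p ×⟨ ring ⟩1≈0
    nontrivial : ¬ 1# ≈ 0#

record Hom (R S : CRing) : Set where
  private
    module R = CommutativeRing R
    module S = CommutativeRing S
  field
    fun   : R.Carrier → S.Carrier
    cong  : ∀ {x y} → x R.≈ y → fun x S.≈ fun y
    hom-+ : ∀ x y → fun (x R.+ y) S.≈ fun x S.+ fun y
    hom-* : ∀ x y → fun (x R.* y) S.≈ fun x S.* fun y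
    hom-neg : ∀ x → fun (R.- x) S.≈ S.- fun x
    hom-0 : fun R.0# S.≈ S.0#
    hom-1 : fun R.1# S.≈ S.1#

  private
    module MR = Monic R
    module MS = Monic S

  hom-eval : ∀ d g x → fun (MR.eval d g x) S.≈ MS.eval d (fun ∘ g) (fun x)
  hom-eval zero    g x = hom-1
  hom-eval (suc d) g x =
    S.trans (hom-+ _ _) (S.+-congˡ (S.trans (hom-* _ _) (S.*-congˡ (hom-eval d (g ∘ suc) x))))

  hom-quot : ∀ d g a i → fun (MR.quot d g a i) S.≈ MS.quot d (fun ∘ g) (fun a) i
  hom-quot zero    g a i       = hom-0
  hom-quot (suc d) g a zero    = hom-eval (suc d) (g ∘ suc) a
  hom-quot (suc d) g a (suc i) = hom-quot d (g ∘ suc) a i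

  hom-split : ∀ (d : ℕ) g → MR.Split d g → MS.Split d (fun ∘ g)
  hom-split zero    g s           = tt
  hom-split (suc d) g (a , r , s) =
    fun a , S.trans (S.sym (hom-eval (suc d) g a)) (S.trans (cong r) hom-0) ,
    MS.split-cong d (hom-quot d g a) (hom-split d _ s)

hom-char : ∀ {R S} → Hom R S → ∀ p → p ×⟨ R ⟩1≈0 → p ×⟨ S ⟩1≈0
hom-char {R} {S} φ p e = trans (sym (hom-×1 p)) (trans (cong e) hom-0)
  where
  open Hom φ
  open CommutativeRing S
  open import Algebra.Properties.Semiring.Mult (CommutativeRing.semiring R) renaming (_×_ to _×ᴿ_)
  open import Algebra.Properties.Semiring.Mult semiring renaming (_×_ to _×ˢ_)
  hom-×1 : ∀ n → fun (n ×ᴿ CommutativeRing.1# R) ≈ n ×ˢ 1#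
  hom-×1 zero    = hom-0
  hom-×1 (suc n) = trans (hom-+ _ _) (+-cong hom-1 (hom-×1 n))

idHom : ∀ {R} → Hom R R
idHom {R} = record { fun = λ x → x ; cong = λ e → e ; hom-+ = λ _ _ → refl ; hom-* = λ _ _ → refl
                   ; hom-neg = λ _ → refl ; hom-0 = refl ; hom-1 = refl }
  where
  open CommutativeRing R

_∘ʰ_ : ∀ {R S U} → Hom S U → Hom R S → Hom R U
_∘ʰ_ {U = U} ψ φ = record
  { fun = ψ.fun ∘ φ.fun
  ; cong = ψ.cong ∘ φ.cong
  ; hom-+ = λ x y → trans (ψ.cong (φ.hom-+ x y)) (ψ.hom-+ _ _)
  ; hom-* = λ x y → trans (ψ.cong (φ.hom-* x y)) (ψ.hom-* _ _)
  ; hom-neg = λ x → trans (ψ.cong (φ.hom-neg x)) (ψ.hom-neg _)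
  ; hom-0 = trans (ψ.cong φ.hom-0) ψ.hom-0
  ; hom-1 = trans (ψ.cong φ.hom-1) ψ.hom-1 }
  where
  module ψ = Hom ψ
  module φ = Hom φ
  open CommutativeRing U

-- R[X]/(g) for g monic of degree n = suc d: the element Σ_{i<n} v i X^i is the coefficient
-- sequence v, and M is multiplication by X.
module Companion (R : CRing) (d : ℕ) (g : ℕ → CommutativeRing.Carrier R) where
  open CommutativeRing R hiding (zero)
  open IntegerCoefficients R

  n : ℕ
  n = suc d

  Seq : Set
  Seq = ℕ → Carrier

  record _≋_ (v w : Seq) : Set where
    constructor mk
    field at : ∀ i → i < n → v i ≈ w i
  open _≋_
  infix 4 _≋_

  ≋-setoid : Setoid _ _
  ≋-setoid = record
    { Carrier = Seq ; _≈_ = _≋_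
    ; isEquivalence = record
      { refl = mk λ _ _ → refl
      ; sym = λ e → mk λ i l → sym (at e i l)
      ; trans = λ e f → mk λ i l → trans (at e i l) (at f i l) } }
  module ≋ = Setoid ≋-setoid
  open import Relation.Binary.Reasoning.Setoid ≋-setoid

  infixl 6 _⊕_
  infixr 7 _·_

  _⊕_ : Seq → Seq → Seq
  (v ⊕ w) i = v i + w i

  _·_ : Carrier → Seq → Seq
  (c · v) i = c * v i

  0ˢ : Seq
  0ˢ _ = 0#

  ⊕-cong : ∀ {v v′ w w′} → v ≋ v′ → w ≋ w′ → v ⊕ w ≋ v′ ⊕ w′
  ⊕-cong e f = mk λ i l → +-cong (at e i l) (at f i l)

  ·-cong : ∀ {a b v w} → a ≈ b → v ≋ w → a · v ≋ b · w
  ·-cong e f = mk λ i l → *-cong e (at f i l)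

  M : Seq → Seq
  M w zero    = - (w d * g 0)
  M w (suc i) = w i - w d * g (suc i)

  M-cong : ∀ {v w} → v ≋ w → M v ≋ M w
  M-cong {v} {w} e = mk λ where
    zero    l → -‿cong (*-congʳ (at e d (ℕ.n<1+n d)))
    (suc i) l → +-cong (at e i (ℕ.<-trans (ℕ.n<1+n i) l)) (-‿cong (*-congʳ (at e d (ℕ.n<1+n d))))

  M-⊕ : ∀ v w → M (v ⊕ w) ≋ M v ⊕ M w
  M-⊕ v w = mk λ where
    zero    _ → solve 3 (λ a b c → :- ((a :+ b) :* c) := :- (a :* c) :+ :- (b :* c)) refl (v d) (w d) (g 0)
    (suc i) _ → solve 5 (λ s t a b c → s :+ t :- (a :+ b) :* c := (s :- a :* c) :+ (t :- b :* c)) refl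
                  (v i) (w i) (v d) (w d) (g (suc i))

  M-· : ∀ c v → M (c · v) ≋ c · M v
  M-· c v = mk λ where
    zero    _ → solve 3 (λ c a b → :- ((c :* a) :* b) := c :* :- (a :* b)) refl c (v d) (g 0)
    (suc i) _ → solve 4 (λ c s a b → c :* s :- (c :* a) :* b := c :* (s :- a :* b)) refl
                  c (v i) (v d) (g (suc i))

  M-0 : M 0ˢ ≋ 0ˢ
  M-0 = mk λ where
    zero    _ → solve 1 (λ c → :- (con (+ 0) :* c) := con (+ 0)) refl (g 0)
    (suc i) _ → solve 1 (λ c → con (+ 0) :- con (+ 0) :* c := con (+ 0)) refl (g (suc i))

  -- act j v w = Σ_{i<j} v i · M^i w
  act : ℕ → Seq → Seq → Seq
  act zero    v w = 0ˢ
  act (suc j) v w = v 0 · w ⊕ M (act j (v ∘ suc) w)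

  act-cong : ∀ j {v v′ w w′} → (∀ i → i < j → v i ≈ v′ i) → w ≋ w′ → act j v w ≋ act j v′ w′
  act-cong zero    e f = ≋.refl
  act-cong (suc j) e f =
    ⊕-cong (·-cong (e 0 (s≤s z≤n)) f) (M-cong (act-cong j (λ i l → e (suc i) (s≤s l)) f))

  ⊕-interchange : ∀ a b c d → (a ⊕ b) ⊕ (c ⊕ d) ≋ (a ⊕ c) ⊕ (b ⊕ d)
  ⊕-interchange a b c d = mk λ i _ →
    solve 4 (λ a b c d → (a :+ b) :+ (c :+ d) := (a :+ c) :+ (b :+ d)) refl (a i) (b i) (c i) (d i)

  ·-⊕ : ∀ c v w → c · (v ⊕ w) ≋ c · v ⊕ c · w
  ·-⊕ c v w = mk λ i _ → distribˡ c (v i) (w i)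

  act-⊕ : ∀ j v w w′ → act j v (w ⊕ w′) ≋ act j v w ⊕ act j v w′
  act-⊕ zero    v w w′ = mk λ _ _ → sym (+-identityˡ 0#)
  act-⊕ (suc j) v w w′ = begin
    v 0 · (w ⊕ w′) ⊕ M (act j (v ∘ suc) (w ⊕ w′))
      ≈⟨ ⊕-cong (·-⊕ (v 0) w w′) (≋.trans (M-cong (act-⊕ j (v ∘ suc) w w′)) (M-⊕ _ _)) ⟩
    (v 0 · w ⊕ v 0 · w′) ⊕ (M (act j (v ∘ suc) w) ⊕ M (act j (v ∘ suc) w′))
      ≈⟨ ⊕-interchange _ _ _ _ ⟩
    act (suc j) v w ⊕ act (suc j) v w′ ∎

  act-· : ∀ j v c w → act j v (c · w) ≋ c · act j v w
  act-· zero    v c w = mk λ _ _ → sym (zeroʳ c)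
  act-· (suc j) v c w = begin
    v 0 · (c · w) ⊕ M (act j (v ∘ suc) (c · w))
      ≈⟨ ⊕-cong (mk λ i _ → solve 3 (λ a b c → a :* (b :* c) := b :* (a :* c)) refl (v 0) c (w i))
           (≋.trans (M-cong (act-· j (v ∘ suc) c w)) (M-· c _)) ⟩
    c · (v 0 · w) ⊕ c · M (act j (v ∘ suc) w)  ≈⟨ ·-⊕ c _ _ ⟨
    c · act (suc j) v w                        ∎

  act-M : ∀ j v w → act j v (M w) ≋ M (act j v w)
  act-M zero    v w = ≋.sym M-0
  act-M (suc j) v w = begin
    v 0 · M w ⊕ M (act j (v ∘ suc) (M w))
      ≈⟨ ⊕-cong (≋.sym (M-· (v 0) w)) (M-cong (act-M j (v ∘ suc) w)) ⟩
    M (v 0 · w) ⊕ M (M (act j (v ∘ suc) w))    ≈⟨ M-⊕ _ _ ⟨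
    M (act (suc j) v w)                        ∎

  act-0 : ∀ j v → act j v 0ˢ ≋ 0ˢ
  act-0 zero    v = ≋.refl
  act-0 (suc j) v = begin
    v 0 · 0ˢ ⊕ M (act j (v ∘ suc) 0ˢ)
      ≈⟨ ⊕-cong (mk λ _ _ → zeroʳ _) (≋.trans (M-cong (act-0 j (v ∘ suc))) M-0) ⟩
    0ˢ ⊕ 0ˢ   ≈⟨ mk (λ _ _ → +-identityˡ 0#) ⟩
    0ˢ        ∎

  -- Both actions are polynomials in the one operator `M`, so they commute. Commutativity and
  -- associativity of the product are read off from this.
  act-act : ∀ i j u v w → act i u (act j v w) ≋ act j v (act i u w)
  act-act zero    j u v w = ≋.sym (act-0 j v)
  act-act (suc i) j u v w = begin
    u 0 · act j v w ⊕ M (act i (u ∘ suc) (act j v w))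
      ≈⟨ ⊕-cong (≋.sym (act-· j v (u 0) w))
           (≋.trans (M-cong (act-act i j (u ∘ suc) v w)) (≋.sym (act-M j v _))) ⟩
    act j v (u 0 · w) ⊕ act j v (M (act i (u ∘ suc) w))  ≈⟨ act-⊕ j v _ _ ⟨
    act j v (act (suc i) u w)                            ∎

  δ : ℕ → Seq
  δ zero    zero    = 1#
  δ zero    (suc i) = 0#
  δ (suc j) zero    = 0#
  δ (suc j) (suc i) = δ j i

  δ-≢ : ∀ j i → ¬ i ≡.≡ j → δ j i ≈ 0#
  δ-≢ zero    zero    ne = ⊥-elim (ne ≡.refl)
  δ-≢ zero    (suc i) ne = refl
  δ-≢ (suc j) zero    ne = refl
  δ-≢ (suc j) (suc i) ne = δ-≢ j i (ne ∘ ≡.cong suc)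

  δ-≡ : ∀ j → δ j j ≈ 1#
  δ-≡ zero    = refl
  δ-≡ (suc j) = δ-≡ j

  e : Seq
  e = δ 0

  sub-zero : ∀ {a b} c → a ≈ 0# → b - a * c ≈ b
  sub-zero {a} {b} c z = trans (+-congˡ (-‿cong (*-congʳ z)))
    (solve 2 (λ b c → b :- con (+ 0) :* c := b) refl b c)

  -- `M` is a plain shift as long as the top coefficient, at index `d`, is zero. Fewer than n shifts
  -- of the unit never meet the reduction, so `act j v e` consists of the first j entries of v
  -- followed by zeros.
  act-e-≥ : ∀ j v i → j ≤ n → j ≤ i → i < n → act j v e i ≈ 0#
  act-e-< : ∀ j v i → j ≤ n → i < j → act j v e i ≈ v i

  act-e-≥ zero    v i       jn ji l = refl
  act-e-≥ (suc j) v (suc i) (s≤s jd) (s≤s ji) l = trans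
    (+-cong (zeroʳ _) (trans (sub-zero _ (act-e-≥ j (v ∘ suc) d (ℕ.m≤n⇒m≤1+n jd) jd (ℕ.n<1+n d)))
                             (act-e-≥ j (v ∘ suc) i (ℕ.m≤n⇒m≤1+n jd) ji (ℕ.<-trans (ℕ.n<1+n i) l))))
    (+-identityˡ 0#)
  act-e-< (suc j) v zero (s≤s jd) l = trans
    (+-congˡ (-‿cong (*-congʳ (act-e-≥ j (v ∘ suc) d (ℕ.m≤n⇒m≤1+n jd) jd (ℕ.n<1+n d)))))
    (solve 2 (λ a c → a :* con (+ 1) :- con (+ 0) :* c := a) refl (v 0) (g 0))
  act-e-< (suc j) v (suc i) (s≤s jd) (s≤s l) = trans
    (+-cong (zeroʳ _) (trans (sub-zero _ (act-e-≥ j (v ∘ suc) d (ℕ.m≤n⇒m≤1+n jd) jd (ℕ.n<1+n d)))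
                             (act-e-< j (v ∘ suc) i (ℕ.m≤n⇒m≤1+n jd) l)))
    (+-identityˡ _)

  _⊛_ : Seq → Seq → Seq
  v ⊛ w = act n v w
  infixl 7 _⊛_

  ⊛-cong : ∀ {v v′ w w′} → v ≋ v′ → w ≋ w′ → v ⊛ w ≋ v′ ⊛ w′
  ⊛-cong p q = act-cong n (at p) q

  ⊛-identityʳ : ∀ v → v ⊛ e ≋ v
  ⊛-identityʳ v = mk λ i l → act-e-< n v i ℕ.≤-refl l

  ⊛-comm : ∀ v w → v ⊛ w ≋ w ⊛ v
  ⊛-comm v w = begin
    v ⊛ w        ≈⟨ ⊛-cong {v} ≋.refl (⊛-identityʳ w) ⟨
    v ⊛ (w ⊛ e)  ≈⟨ act-act n n v w e ⟩
    w ⊛ (v ⊛ e)  ≈⟨ ⊛-cong {w} ≋.refl (⊛-identityʳ v) ⟩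
    w ⊛ v        ∎

  ⊛-assoc : ∀ u v w → (u ⊛ v) ⊛ w ≋ u ⊛ (v ⊛ w)
  ⊛-assoc u v w = begin
    (u ⊛ v) ⊛ w  ≈⟨ ⊛-comm (u ⊛ v) w ⟩
    w ⊛ (u ⊛ v)  ≈⟨ act-act n n w u v ⟩
    u ⊛ (w ⊛ v)  ≈⟨ ⊛-cong {u} ≋.refl (⊛-comm w v) ⟩
    u ⊛ (v ⊛ w)  ∎

  ⊛-distribˡ : ∀ u v w → u ⊛ (v ⊕ w) ≋ (u ⊛ v) ⊕ (u ⊛ w)
  ⊛-distribˡ u v w = act-⊕ n u v w

  quotientRing : CRing
  quotientRing = record
    { Carrier = Seq ; _≈_ = _≋_ ; _+_ = _⊕_ ; _*_ = _⊛_ ; -_ = λ v i → - v i ; 0# = 0ˢ ; 1# = e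
    ; isCommutativeRing = record
      { isRing = record
        { +-isAbelianGroup = record
          { isGroup = record
            { isMonoid = record
              { isSemigroup = record
                { isMagma = record { isEquivalence = ≋.isEquivalence ; ∙-cong = ⊕-cong }
                ; assoc = λ u v w → mk λ i _ → +-assoc (u i) (v i) (w i) }
              ; identity = (λ v → mk λ i _ → +-identityˡ (v i)) , (λ v → mk λ i _ → +-identityʳ (v i)) }
            ; inverse = (λ v → mk λ i _ → -‿inverseˡ (v i)) , (λ v → mk λ i _ → -‿inverseʳ (v i))
            ; ⁻¹-cong = λ p → mk λ i l → -‿cong (at p i l) }
          ; comm = λ v w → mk λ i _ → +-comm (v i) (w i) }
        ; *-cong = ⊛-cong
        ; *-assoc = ⊛-assoc
        ; *-identity = (λ v → ≋.trans (⊛-comm e v) (⊛-identityʳ v)) , ⊛-identityʳ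
        ; distrib = ⊛-distribˡ , (λ u v w → ≋.trans (⊛-comm (v ⊕ w) u)
            (≋.trans (⊛-distribˡ u v w) (⊕-cong (⊛-comm u v) (⊛-comm u w)))) }
      ; *-comm = ⊛-comm } }

  scalar-⊛ : ∀ c w → (c · e) ⊛ w ≋ c · w
  scalar-⊛ c w = begin
    (c · e) ⊛ w  ≈⟨ ⊛-comm (c · e) w ⟩
    w ⊛ (c · e)  ≈⟨ act-· n w c e ⟩
    c · (w ⊛ e)  ≈⟨ ·-cong refl (⊛-identityʳ w) ⟩
    c · w        ∎

  scalars : Hom R quotientRing
  scalars = record
    { fun = _· e
    ; cong = λ p → ·-cong p ≋.refl
    ; hom-+ = λ x y → mk λ i _ → distribʳ (e i) x y
    ; hom-* = λ x y → ≋.sym (≋.trans (scalar-⊛ x (y · e)) (mk λ i _ → sym (*-assoc x y (e i))))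
    ; hom-neg = λ x → mk λ i _ → solve 2 (λ x y → :- x :* y := :- (x :* y)) refl x (e i)
    ; hom-0 = mk λ i _ → zeroˡ (e i)
    ; hom-1 = mk λ i _ → *-identityˡ (e i) }

  root : Seq
  root = M e

  root-⊛ : ∀ w → root ⊛ w ≋ M w
  root-⊛ w = begin
    root ⊛ w  ≈⟨ ⊛-comm root w ⟩
    w ⊛ M e   ≈⟨ act-M n w e ⟩
    M (w ⊛ e) ≈⟨ M-cong (⊛-identityʳ w) ⟩
    M w       ∎

  power : ℕ → Seq
  power zero    = e
  power (suc j) = M (power j)

  open Monic quotientRing using (eval)

  eval-root : ∀ j h → eval j ((_· e) ∘ h) root ≋ act j h e ⊕ power j
  eval-root zero    h = mk λ i _ → sym (+-identityˡ (e i))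
  eval-root (suc j) h = begin
    h 0 · e ⊕ root ⊛ eval j ((_· e) ∘ h ∘ suc) root
      ≈⟨ ⊕-cong ≋.refl (≋.trans (root-⊛ _) (≋.trans (M-cong (eval-root j (h ∘ suc))) (M-⊕ _ _))) ⟩
    h 0 · e ⊕ (M (act j (h ∘ suc) e) ⊕ M (power j))
      ≈⟨ mk (λ i _ → sym (+-assoc _ _ _)) ⟩
    act (suc j) h e ⊕ power (suc j) ∎

  power-δ : ∀ j → j ≤ d → power j ≋ δ j
  power-δ zero    l = ≋.refl
  power-δ (suc j) l = ≋.trans (M-cong (power-δ j (ℕ.<⇒≤ l))) (mk λ where
    zero    _ → trans (-‿cong (*-congʳ (δ-≢ j d (ℕ.<⇒≢ l ∘ ≡.sym))))
                  (solve 1 (λ c → :- (con (+ 0) :* c) := con (+ 0)) refl (g 0))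
    (suc i) _ → sub-zero (g (suc i)) (δ-≢ j d (ℕ.<⇒≢ l ∘ ≡.sym)))

  -- X^d is the last power that needs no reduction; one more application of `M` turns it into -Σ g i
  -- X^i, which cancels the lower-order terms.
  eval-root-0 : eval n ((_· e) ∘ g) root ≋ 0ˢ
  eval-root-0 = begin
    eval n ((_· e) ∘ g) root  ≈⟨ eval-root n g ⟩
    act n g e ⊕ M (power d)   ≈⟨ ⊕-cong (⊛-identityʳ g) (M-cong (power-δ d ℕ.≤-refl)) ⟩
    g ⊕ M (δ d)               ≈⟨ (mk λ where
      zero    _ → trans (+-congˡ (-‿cong (*-congʳ (δ-≡ d))))
                    (solve 1 (λ c → c :- con (+ 1) :* c := con (+ 0)) refl (g 0))
      (suc i) l → trans (+-congˡ (+-cong (δ-≢ d i (ℕ.<⇒≢ (ℕ.s<s⁻¹ l))) (-‿cong (*-congʳ (δ-≡ d)))))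
                    (solve 1 (λ c → c :+ (con (+ 0) :- con (+ 1) :* c) := con (+ 0)) refl (g (suc i)))) ⟩
    0ˢ                        ∎

module _ {p} (R : FiniteRing p) (d : ℕ) (g : ℕ → FiniteRing.Carrier R) where
  private module R = FiniteRing R
  open Companion R.ring d g

  private
    extend : (Fin n → Fin R.size) → Seq
    extend f i with i <? n
    ... | yes l = R.enum (f (fromℕ< l))
    ... | no _  = R.0#

    extend-at : ∀ f v → (∀ j → R.enum (f j) R.≈ v (toℕ j)) → extend f ≋ v
    extend-at f v h = mk λ i l → lem i l
      where
      lem : ∀ i → i < n → extend f i R.≈ v i
      lem i l with i <? n
      ... | yes l′ = R.trans (h (fromℕ< l′)) (R.reflexive (≡.cong v (Fin.toℕ-fromℕ< l′)))
      ... | no ¬l  = ⊥-elim (¬l l)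

  adjoin : FiniteRing p
  adjoin = record
    { ring = quotientRing
    ; _≟_ = λ v w → map′ (λ (h : ∀ {i} → i < n → v i R.≈ w i) → mk λ i l → h l) (λ h l → _≋_.at h _ l)
                      (ℕ.allUpTo? (λ i → v i R.≟ w i) n)
    ; size = R.size ℕ.^ n
    ; enum = λ t → extend (finToFun t)
    ; index = λ v → funToFin {n} (λ i → R.index (v (toℕ i)))
    ; enum-index = λ v → extend-at (finToFun (funToFin {n} (λ i → R.index (v (toℕ i))))) v λ j → R.trans
        (R.reflexive (≡.cong R.enum (Fin.finToFun-funToFin {n} (λ i → R.index (v (toℕ i))) j)))
        (R.enum-index _)
    ; char = hom-char scalars p R.char
    ; nontrivial = λ h → R.nontrivial (_≋_.at h 0 (s≤s z≤n)) }

-- A formal root is adjoined at each stage, whether or not the polynomial is irreducible or already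
-- has a root. The result is only a finite nontrivial ring, so no factorisation has to be found.
splitting : ∀ d {p} (R : FiniteRing p) (g : ℕ → FiniteRing.Carrier R) →
  Σ (FiniteRing p) λ S → Σ (Hom (FiniteRing.ring R) (FiniteRing.ring S)) λ φ →
    Monic.Split (FiniteRing.ring S) d (Hom.fun φ ∘ g)
splitting zero    R g = R , idHom , tt
splitting (suc d) R g = S , ψ ∘ʰ scalars , fun ψ root , S.trans (S.sym (hom-eval ψ (suc d) (fun scalars ∘ g) root))
    (S.trans (cong ψ eval-root-0) (hom-0 ψ)) ,
    Monic.split-cong S.ring d (hom-quot ψ d (fun scalars ∘ g) root) split
  where
  open Companion (FiniteRing.ring R) d g using (scalars; root; eval-root-0; quotientRing)
  open Hom
  rec = splitting d (adjoin R d g) (Monic.quot quotientRing d (fun scalars ∘ g) root)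
  S = proj₁ rec
  module S = FiniteRing S
  ψ = proj₁ (proj₂ rec)
  split = proj₂ (proj₂ rec)

-- Principal quotients and residue fields of finite rings

module Quotient (R : CRing) (x : CommutativeRing.Carrier R) where
  open CommutativeRing R
  open IntegerCoefficients R

  infix 4 _~_
  record _~_ (a b : Carrier) : Set where
    constructor mk
    field
      multiplier : Carrier
      equation   : a ≈ b + multiplier * x

  ~-reflexive : ∀ {a b} → a ≈ b → a ~ b
  ~-reflexive {a} {b} e = mk 0# (trans e (solve 2 (λ b x → b := b :+ con (+ 0) :* x) refl b x))

  ~-sym : ∀ {a b} → a ~ b → b ~ a
  ~-sym {a} {b} (mk c e) = mk (- c) (trans
    (solve 3 (λ b c x → b := b :+ c :* x :+ :- c :* x) refl b c x) (+-congʳ (sym e)))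

  ~-trans : ∀ {a b c} → a ~ b → b ~ c → a ~ c
  ~-trans {a} {b} {c} (mk s e) (mk t f) = mk (s + t) (trans e (trans (+-congʳ f)
    (solve 4 (λ c s t x → c :+ t :* x :+ s :* x := c :+ (s :+ t) :* x) refl c s t x)))

  ~-+ : ∀ {a a′ b b′} → a ~ a′ → b ~ b′ → a + b ~ a′ + b′
  ~-+ {a} {a′} {b} {b′} (mk s e) (mk t f) = mk (s + t) (trans (+-cong e f)
    (solve 5 (λ a b s t x → (a :+ s :* x) :+ (b :+ t :* x) := (a :+ b) :+ (s :+ t) :* x) refl a′ b′ s t x))

  ~-* : ∀ {a a′ b b′} → a ~ a′ → b ~ b′ → a * b ~ a′ * b′
  ~-* {a} {a′} {b} {b′} (mk s e) (mk t f) = mk (s * b′ + a′ * t + s * t * x) (trans (*-cong e f)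
    (solve 5 (λ a b s t x → (a :+ s :* x) :* (b :+ t :* x)
      := a :* b :+ (s :* b :+ a :* t :+ s :* t :* x) :* x) refl a′ b′ s t x))

  ~-neg : ∀ {a b} → a ~ b → - a ~ - b
  ~-neg {a} {b} (mk s e) = mk (- s) (trans (-‿cong e)
    (solve 3 (λ b s x → :- (b :+ s :* x) := :- b :+ :- s :* x) refl b s x))

  quotient : CRing
  quotient = record
    { Carrier = Carrier ; _≈_ = _~_ ; _+_ = _+_ ; _*_ = _*_ ; -_ = -_ ; 0# = 0# ; 1# = 1#
    ; isCommutativeRing = record
      { isRing = record
        { +-isAbelianGroup = record
          { isGroup = record
            { isMonoid = record
              { isSemigroup = record
                { isMagma = record
                  { isEquivalence = record { refl = ~-reflexive refl ; sym = ~-sym ; trans = ~-trans }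
                  ; ∙-cong = ~-+ }
                ; assoc = λ a b c → ~-reflexive (+-assoc a b c) }
              ; identity = ~-reflexive ∘ +-identityˡ , ~-reflexive ∘ +-identityʳ }
            ; inverse = ~-reflexive ∘ -‿inverseˡ , ~-reflexive ∘ -‿inverseʳ
            ; ⁻¹-cong = ~-neg }
          ; comm = λ a b → ~-reflexive (+-comm a b) }
        ; *-cong = ~-*
        ; *-assoc = λ a b c → ~-reflexive (*-assoc a b c)
        ; *-identity = ~-reflexive ∘ *-identityˡ , ~-reflexive ∘ *-identityʳ
        ; distrib = (λ a b c → ~-reflexive (distribˡ a b c)) , (λ a b c → ~-reflexive (distribʳ a b c)) }
      ; *-comm = λ a b → ~-reflexive (*-comm a b) } }

  projection : Hom R quotient
  projection = record
    { fun = id ; cong = ~-reflexive ; hom-+ = λ _ _ → ~-reflexive refl ; hom-* = λ _ _ → ~-reflexive refl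
    ; hom-neg = λ _ → ~-reflexive refl ; hom-0 = ~-reflexive refl ; hom-1 = ~-reflexive refl }

module _ {p} (R : FiniteRing p) where
  open FiniteRing R

  exists? : ∀ {P : Carrier → Set} → (∀ {x y} → x ≈ y → P x → P y) → (∀ x → Dec (P x)) → Dec (∃ P)
  exists? resp P? = map′ (λ (i , q) → enum i , q) (λ (x , q) → index x , resp (sym (enum-index x)) q)
    (Fin.any? (P? ∘ enum))

  Invertible : Carrier → Set
  Invertible x = ∃ λ y → y * x ≈ 1#

  invertible? : ∀ x → Dec (Invertible x)
  invertible? x = exists? (λ e q → trans (*-congʳ (sym e)) q) (λ y → y * x ≟ 1#)

  finiteQuotient : ∀ x → ¬ Invertible x → FiniteRing p
  finiteQuotient x ¬inv = record
    { ring = quotient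
    ; _≟_ = λ a b → map′ (λ (c , e) → mk c e) (λ (mk c e) → c , e)
        (exists? (λ e q → trans q (+-congˡ (*-congʳ e))) (λ c → a ≟ b + c * x))
    ; size = size ; enum = enum ; index = index ; enum-index = ~-reflexive ∘ enum-index
    ; char = hom-char projection p char
    ; nontrivial = λ (mk c e) → ¬inv (c , sym (trans e (+-identityˡ _))) }
    where
    open Quotient ring x

  ZeroOrUnit : Carrier → Set
  ZeroOrUnit x = x ≈ 0# ⊎ Invertible x

zeroOrUnit-hom : ∀ {p} {R S : FiniteRing p} (φ : Hom (FiniteRing.ring R) (FiniteRing.ring S)) →
  ∀ {x} → ZeroOrUnit R x → ZeroOrUnit S (Hom.fun φ x)
zeroOrUnit-hom {S = S} φ (inj₁ z) = inj₁ (trans (cong z) hom-0)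
  where
  open Hom φ
  open FiniteRing S
zeroOrUnit-hom {S = S} φ (inj₂ (y , e)) = inj₂ (fun y , trans (sym (hom-* _ _)) (trans (cong e) hom-1))
  where
  open Hom φ
  open FiniteRing S

record SurjectiveHom {p} (R S : FiniteRing p) : Set where
  field
    hom : Hom (FiniteRing.ring R) (FiniteRing.ring S)
    preimage : FiniteRing.Carrier S → FiniteRing.Carrier R
    fun-preimage : ∀ y → FiniteRing._≈_ S (Hom.fun hom (preimage y)) y
open SurjectiveHom

-- A non-unit generates a proper ideal, so dividing by it keeps the ring nontrivial and sends it to
-- zero; being zero or a unit persists under later homomorphisms. Surjectivity is carried along so
-- that treating an enumeration of `R` treats every element of `S`, which is then a field.
killNonUnits : ∀ m {p} (R : FiniteRing p) (f : Fin m → FiniteRing.Carrier R) →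
  Σ (FiniteRing p) λ S → Σ (SurjectiveHom R S) λ φ → ∀ i → ZeroOrUnit S (Hom.fun (hom φ) (f i))
killNonUnits zero    R f =
  R , record { hom = idHom ; preimage = id ; fun-preimage = λ _ → FiniteRing.refl R } , λ ()
killNonUnits (suc m) {p} R f with invertible? R (f Fin.zero)
... | yes inv with killNonUnits m R (f ∘ Fin.suc)
...   | S , φ , h = S , φ , λ where
        Fin.zero    → zeroOrUnit-hom {R = R} {S} (hom φ) (inj₂ inv)
        (Fin.suc i) → h i
killNonUnits (suc m) {p} R f | no ¬inv with killNonUnits m (finiteQuotient R (f Fin.zero) ¬inv) (f ∘ Fin.suc)
...   | S , φ , h = S , record
          { hom = hom φ ∘ʰ projection
          ; preimage = preimage φ
          ; fun-preimage = fun-preimage φ }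
        , λ where
        Fin.zero    → zeroOrUnit-hom {R = finiteQuotient R (f Fin.zero) ¬inv} {S} (hom φ) (inj₁
          (mk (FiniteRing.1# R) (FiniteRing.sym R (FiniteRing.trans R
            (FiniteRing.+-identityˡ R _) (FiniteRing.*-identityˡ R _)))))
        (Fin.suc i) → h i
  where
  open Quotient (FiniteRing.ring R) (f Fin.zero)

residueField : ∀ {p} (R : FiniteRing p) →
  Σ (FiniteRing p) λ S → Hom (FiniteRing.ring R) (FiniteRing.ring S) × (∀ x → ZeroOrUnit S x)
residueField R with killNonUnits (FiniteRing.size R) R (FiniteRing.enum R)
... | S , φ , h = S , hom φ , λ x → resp (trans (cong (R.enum-index _)) (fun-preimage φ x))
                                     (h (R.index (preimage φ x)))
  where
  module R = FiniteRing R
  open FiniteRing S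
  open Hom (hom φ) using (cong)
  resp : ∀ {x y} → x ≈ y → ZeroOrUnit S x → ZeroOrUnit S y
  resp e (inj₁ z)       = inj₁ (trans (sym e) z)
  resp e (inj₂ (y , q)) = inj₂ (y , trans (*-congˡ (sym e)) q)

primeRing : ∀ p → 1 < p → FiniteRing p
primeRing p@(suc _) 1<p = record
  { ring = quotient
  ; _≟_ = λ a b → map′ to from (+ p ℤ∣.∣? a ℤ.- b)
  ; size = p
  ; enum = +_ ∘ toℕ
  ; index = λ a → fromℕ< (ℤ.n%ℕd<d a p)
  ; enum-index = λ a → ~-sym (mk (a ℤ./ℕ p) (≡.trans (ℤ.a≡a%ℕn+[a/ℕn]*n a p)
      (≡.cong (λ r → + r ℤ.+ a ℤ./ℕ p ℤ.* + p) (≡.sym (Fin.toℕ-fromℕ< (ℤ.n%ℕd<d a p))))))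
  ; char = mk ℤ.1ℤ (≡.trans (×1 p) (≡.sym (≡.trans (ℤ.+-identityˡ _) (ℤ.*-identityˡ _))))
  ; nontrivial = λ (mk c e) → ℕ.<⇒≢ 1<p (≡.sym (ℕ∣.∣1⇒≡1 (ℤ∣.∣⇒∣ᵤ
      (ℤ∣.divides c (≡.trans e (ℤ.+-identityˡ _)))))) }
  where
  open Quotient ℤ.+-*-commutativeRing (+ p)
  open import Algebra.Properties.Semiring.Mult (CommutativeRing.semiring quotient) renaming (_×_ to _×ᶻ_)
  open IntegerCoefficients ℤ.+-*-commutativeRing
  ×1 : ∀ n → n ×ᶻ ℤ.1ℤ ≡.≡ + n
  ×1 zero    = ≡.refl
  ×1 (suc n) = ≡.cong (ℤ._+_ ℤ.1ℤ) (×1 n)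
  to : ∀ {a b} → + p ℤ∣.∣ a ℤ.- b → a ~ b
  to {a} {b} (ℤ∣.divides c e) = mk c (≡.trans
    (solve 2 (λ a b → a := b :+ (a :- b)) ≡.refl a b) (≡.cong (ℤ._+_ b) e))
  from : ∀ {a b} → a ~ b → + p ℤ∣.∣ a ℤ.- b
  from {a} {b} (mk c e) = ℤ∣.divides c (≡.trans (≡.cong (ℤ._- b) e)
    (solve 3 (λ b c p → b :+ c :* p :- b := c :* p) ≡.refl b c (+ p)))

-- The field with p^r elements

prime∤! : ∀ {p} → Prime p → ∀ j → j < p → ¬ p ℕ∣.∣ j !
prime∤! {p} pr zero    l dv = ℕ.<⇒≢ (ℕ.nonTrivial⇒n>1 p {{prime⇒nonTrivial pr}}) (≡.sym (ℕ∣.∣1⇒≡1 dv))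
prime∤! {p} pr (suc j) l dv with euclidsLemma (suc j) (j !) pr dv
... | inj₁ d = ℕ.<⇒≱ l (ℕ∣.∣⇒≤ d)
... | inj₂ d = prime∤! pr j (ℕ.<-trans (ℕ.n<1+n j) l) d

C*!*!≡! : ∀ {n j} → j ≤ n → (n C.C j) ℕ.* (j ! ℕ.* (n ∸ j) !) ≡ n !
C*!*!≡! {n} {j} j≤n = ≡.trans (≡.cong (λ c → c ℕ.* (j ! ℕ.* (n ∸ j) !)) (C.nCk≡n!/k![n-k]! j≤n))
      (ℕ.m/n*n≡m (C.k![n∸k]!∣n! j≤n))
  where instance nz = ℕ._!*_!≢0 j (n ∸ j)

-- p divides p! but neither of the factorials j! and (p - j)! in its factorisation.
prime∣C : ∀ {p} → Prime p → ∀ j → 0 < j → j < p → p ℕ∣.∣ (p C.C j)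
prime∣C {suc p-1} pr j 0<j j<p
  with euclidsLemma (suc p-1 C.C j) _ pr
         (≡.subst (suc p-1 ℕ∣.∣_) (≡.sym (C*!*!≡! (ℕ.<⇒≤ j<p))) (ℕ∣.m∣m*n (p-1 !)))
... | inj₁ d = d
... | inj₂ d with euclidsLemma (j !) ((suc p-1 ∸ j) !) pr d
...   | inj₁ d′ = ⊥-elim (prime∤! pr j j<p d′)
...   | inj₂ d′ = ⊥-elim (prime∤! pr (suc p-1 ∸ j) (ℕ.∸-monoʳ-< 0<j (ℕ.<⇒≤ j<p)) d′)

module Frobenius (R : CRing) {p : ℕ} (pr : Prime p) (char : p ×⟨ R ⟩1≈0) where
  open CommutativeRing R hiding (zero)
  open import Algebra.Properties.Semiring.Mult semiring using (×-assoc-*; ×-assocˡ; ×-congʳ; ×-homo-1) renaming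
        (_×_ to _⋆_)
  open import Algebra.Properties.Semiring.Exp semiring using (_^_; ^-congˡ; ^-assocʳ)
  open import Algebra.Properties.Semiring.Sum semiring using
        (sum-init-last; sum-cong-≋; sum-replicate-zero) renaming (sum to ∑)
  open import Algebra.Properties.CommutativeSemiring.Binomial commutativeSemiring
    using (theorem; binomial; binomialTerm; binomialExpansion)
  open import Relation.Binary.Reasoning.Setoid setoid

  multiple-0 : ∀ {m} → p ℕ∣.∣ m → ∀ x → m ⋆ x ≈ 0#
  multiple-0 {m} (ℕ∣.divides q ≡.refl) x = begin
    (q ℕ.* p) ⋆ x          ≈⟨ ×-assocˡ x q p ⟨
    q ⋆ (p ⋆ x)            ≈⟨ ×-congʳ q (×-congʳ p (*-identityˡ x)) ⟨
    q ⋆ (p ⋆ (1# * x))     ≈⟨ ×-congʳ q (×-assoc-* p 1# x) ⟨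
    q ⋆ ((p ⋆ 1#) * x)     ≈⟨ ×-congʳ q (trans (*-congʳ char) (zeroˡ x)) ⟩
    q ⋆ 0#                 ≈⟨ go q ⟩
    0#                     ∎
    where
    go : ∀ q → q ⋆ 0# ≈ 0#
    go zero    = refl
    go (suc q) = trans (+-identityˡ _) (go q)

  frobenius : ∀ x y → (x + y) ^ p ≈ x ^ p + y ^ p
  frobenius x y = go p ≡.refl
    where
    go : ∀ q → q ≡ p → (x + y) ^ q ≈ x ^ q + y ^ q
    go zero    ≡.refl = ⊥-elim (ℕ.<⇒≱ (ℕ.nonTrivial⇒n>1 0 {{prime⇒nonTrivial pr}}) z≤n)
    go (suc m) ≡.refl = begin
      (x + y) ^ suc m
        ≈⟨ theorem (suc m) x y ⟩
      t Fin.zero + ∑ (t ∘ Fin.suc)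
        ≈⟨ +-congˡ (sum-init-last (t ∘ Fin.suc)) ⟩
      t Fin.zero + (∑ (t ∘ Fin.suc ∘ inject₁) + t (fromℕ (suc m)))
        ≈⟨ +-cong first (+-cong (trans (sum-cong-≋ middle) (sum-replicate-zero m)) last) ⟩
      y ^ suc m + (0# + x ^ suc m)
        ≈⟨ trans (+-congˡ (+-identityˡ _)) (+-comm _ _) ⟩
      x ^ suc m + y ^ suc m ∎
      where
      t = binomialTerm x y (suc m)
      first : t Fin.zero ≈ y ^ suc m
      first = trans (×-homo-1 _) (*-identityˡ _)
      middle : ∀ i → t (Fin.suc (inject₁ i)) ≈ 0#
      middle i = multiple-0 (prime∣C pr _ (s≤s z≤n)
        (s≤s (≡.subst (ℕ._< m) (≡.sym (Fin.toℕ-inject₁ i)) (Fin.toℕ<n i)))) _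
      last : t (fromℕ (suc m)) ≈ x ^ suc m
      last rewrite Fin.toℕ-fromℕ m | C.nCn≡1 (suc m) | ℕ.n∸n≡0 m =
        trans (×-homo-1 _) (*-identityʳ _)

  frobenius-power : ∀ r x y → (x + y) ^ (p ℕ.^ r) ≈ x ^ (p ℕ.^ r) + y ^ (p ℕ.^ r)
  frobenius-power zero    x y = trans (*-identityʳ _) (+-cong (sym (*-identityʳ x)) (sym (*-identityʳ y)))
  frobenius-power (suc r) x y = begin
    (x + y) ^ (p ℕ.* p ℕ.^ r)                     ≈⟨ ^-assocʳ (x + y) p (p ℕ.^ r) ⟨
    ((x + y) ^ p) ^ (p ℕ.^ r)                     ≈⟨ ^-congˡ (p ℕ.^ r) (frobenius x y) ⟩
    (x ^ p + y ^ p) ^ (p ℕ.^ r)                   ≈⟨ frobenius-power r _ _ ⟩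
    (x ^ p) ^ (p ℕ.^ r) + (y ^ p) ^ (p ℕ.^ r)     ≈⟨ +-cong (^-assocʳ x p _) (^-assocʳ y p _) ⟩
    x ^ (p ℕ.* p ℕ.^ r) + y ^ (p ℕ.* p ℕ.^ r)     ∎

-- Roots of split separable polynomials over a field

module Roots {p} (S : FiniteRing p) (zeroOrUnit : ∀ x → ZeroOrUnit S x) where
  open FiniteRing S hiding (zero)
  open IntegerCoefficients ring
  open Monic ring

  product-0 : ∀ {x y} → x * y ≈ 0# → x ≈ 0# ⊎ y ≈ 0#
  product-0 {x} {y} e with zeroOrUnit x
  ... | inj₁ z       = inj₁ z
  ... | inj₂ (u , q) = inj₂ (trans (sym (*-identityˡ y)) (trans (*-congʳ (sym q))
                         (trans (*-assoc u x y) (trans (*-congˡ e) (zeroʳ u)))))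

  x-y≈0⇒x≈y : ∀ {x y} → x - y ≈ 0# → x ≈ y
  x-y≈0⇒x≈y {x} {y} e = trans (solve 2 (λ x y → x := (x :- y) :+ y) refl x y) (trans (+-congʳ e) (+-identityˡ y))

  roots : ∀ d g → Split d g → Fin d → Carrier
  roots (suc d) g (a , _ , s) Fin.zero    = a
  roots (suc d) g (a , _ , s) (Fin.suc i) = roots d (quot d g a) s i

  roots-root : ∀ d g s i → eval d g (roots d g s i) ≈ 0#
  roots-root (suc d) g (a , r , s) Fin.zero    = r
  roots-root (suc d) g (a , r , s) (Fin.suc i) = trans (eval-quot d g a _)
    (trans (+-cong r (trans (*-congˡ (roots-root d (quot d g a) s i)) (zeroʳ _))) (+-identityˡ 0#))

  roots-complete : ∀ d g s x → eval d g x ≈ 0# → ∃ λ i → roots d g s i ≈ x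
  roots-complete zero    g s           x e = ⊥-elim (nontrivial e)
  roots-complete (suc d) g (a , r , s) x e
    with product-0 (trans (sym (trans (eval-quot d g a x) (trans (+-congʳ r) (+-identityˡ _)))) e)
  ... | inj₁ z = Fin.zero , sym (x-y≈0⇒x≈y z)
  ... | inj₂ z with roots-complete d (quot d g a) s x z
  ...   | i , q = Fin.suc i , q

  Separable : ∀ (d : ℕ) → (ℕ → Carrier) → Set
  Separable d g = ∀ x → eval d g x ≈ 0# → ¬ deriv d g x ≈ 0#

  separable-quot : ∀ d g a → eval (suc d) g a ≈ 0# → Separable (suc d) g → Separable d (quot d g a)
  separable-quot d g a r sep x e e′ = sep x
    (trans (eval-quot d g a x) (trans (+-cong r (trans (*-congˡ e) (zeroʳ _))) (+-identityˡ 0#)))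
    (trans (deriv-quot d g a x) (trans (+-cong e (trans (*-congˡ e′) (zeroʳ _))) (+-identityˡ 0#)))

  -- If `a` were also a root of the quotient it would be a double root, and the product rule
  -- `deriv-quot` would make the derivative vanish there.
  quot-root≉ : ∀ d g a → eval (suc d) g a ≈ 0# → Separable (suc d) g →
    ∀ x → eval d (quot d g a) x ≈ 0# → ¬ x ≈ a
  quot-root≉ d g a r sep x e q = sep a r (trans (deriv-cong (suc d) {g} {g} (λ _ → refl) (sym q))
    (trans (deriv-quot d g a x) (trans (+-cong e (trans (*-congʳ (trans (+-congʳ q) (-‿inverseʳ a))) (zeroˡ _)))
      (+-identityˡ 0#))))

  roots-injective : ∀ d g s → Separable d g → ∀ i j → roots d g s i ≈ roots d g s j → i ≡ j
  roots-injective (suc d) g (a , r , s) sep Fin.zero    Fin.zero    e = ≡.refl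
  roots-injective (suc d) g (a , r , s) sep Fin.zero    (Fin.suc j) e =
    ⊥-elim (quot-root≉ d g a r sep _ (roots-root d (quot d g a) s j) (sym e))
  roots-injective (suc d) g (a , r , s) sep (Fin.suc i) Fin.zero    e =
    ⊥-elim (quot-root≉ d g a r sep _ (roots-root d (quot d g a) s i) e)
  roots-injective (suc d) g (a , r , s) sep (Fin.suc i) (Fin.suc j) e =
    ≡.cong Fin.suc (roots-injective d (quot d g a) s (separable-quot d g a r sep) i j e)

module XᵏminusX (R : CRing) where
  open CommutativeRing R hiding (zero)
  open IntegerCoefficients R
  open Monic R
  open import Algebra.Properties.Semiring.Mult semiring using () renaming (_×_ to _⋆_)
  open import Algebra.Properties.Semiring.Exp semiring using (_^_)
  open import Relation.Binary.Reasoning.Setoid setoid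

  -- The lower-order part -X; the leading X^k is implicit in `eval`, so these coefficients describe
  -- X^k - X from degree 2 on.
  coefficients : ℕ → Carrier
  coefficients zero          = 0#
  coefficients (suc zero)    = - 1#
  coefficients (suc (suc _)) = 0#

  eval-0 : ∀ d x → eval d (λ _ → 0#) x ≈ x ^ d
  eval-0 zero    x = refl
  eval-0 (suc d) x = trans (+-identityˡ _) (*-congˡ (eval-0 d x))

  x*deriv-0 : ∀ d x → x * deriv d (λ _ → 0#) x ≈ d ⋆ (x ^ d)
  x*deriv-0 zero    x = zeroʳ x
  x*deriv-0 (suc d) x = begin
    x * (eval d (λ _ → 0#) x + x * deriv d (λ _ → 0#) x)   ≈⟨ *-congˡ (+-cong (eval-0 d x) (x*deriv-0 d x)) ⟩
    x * (x ^ d + d ⋆ (x ^ d))                              ≈⟨ distribˡ x _ _ ⟩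
    x ^ suc d + x * (d ⋆ (x ^ d))                          ≈⟨ +-congˡ (×-comm-* d x _) ⟩
    x ^ suc d + d ⋆ (x ^ suc d)                            ∎
    where
    open import Algebra.Properties.Semiring.Mult semiring using (×-comm-*)

  eval-coefficients : ∀ d x → eval (suc (suc d)) coefficients x ≈ x ^ suc (suc d) - x
  eval-coefficients d x = trans (+-congˡ (*-congˡ (+-congˡ (*-congˡ (eval-0 d x)))))
    (solve 2 (λ x e → con (+ 0) :+ x :* (:- con (+ 1) :+ x :* e) := x :* (x :* e) :- x) refl x (x ^ d))

  deriv-coefficients : ∀ d x → deriv (suc (suc d)) coefficients x ≈ suc (suc d) ⋆ (x ^ suc d) - 1#
  deriv-coefficients d x = begin
    (- 1# + x * eval d (λ _ → 0#) x) + x * deriv (suc d) (λ _ → 0#) x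
      ≈⟨ +-cong (+-congˡ (*-congˡ (eval-0 d x))) (x*deriv-0 (suc d) x) ⟩
    (- 1# + x * x ^ d) + suc d ⋆ (x ^ suc d)
      ≈⟨ solve 2 (λ e s → (:- con (+ 1) :+ e) :+ s := e :+ s :- con (+ 1)) refl (x * x ^ d) _ ⟩
    suc (suc d) ⋆ (x ^ suc d) - 1# ∎

-- The field lives on the colour set itself, with propositional equality, so that permutations of
-- colours are functions on the field. `x^k≡x` is recorded because the construction supplies it as
-- the defining equation; Fermat's identity then follows without counting units.
record FieldOn (k : ℕ) : Set where
  infixl 6 _+_
  infixl 7 _*_
  infix 8 -_
  field
    _+_ _*_ : Fin k → Fin k → Fin k
    -_      : Fin k → Fin k
    0# 1#   : Fin k
    isCommutativeRing : IsCommutativeRing _≡_ _+_ _*_ -_ 0# 1#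
    inverse : ∀ x → x ≢ 0# → ∃ λ y → y * x ≡ 1#
    1≢0     : 1# ≢ 0#

  ring : CRing
  ring = record { isCommutativeRing = isCommutativeRing }

  field
    x^k≡x : ∀ x → Exp._^_ (CommutativeRing.semiring ring) x k ≡ x

module _ {p} (S : FiniteRing p) (k : ℕ) where
  open FiniteRing S
  open Exp semiring

  FixedPoint : Carrier → Set
  FixedPoint x = x ^ k ≈ x

  PowerAdditive : Set
  PowerAdditive = ∀ x y → (x + y) ^ k ≈ x ^ k + y ^ k

-- Additivity of the k-th power makes its fixed points a subfield. `elem` enumerates them without
-- repetition by `Fin k`, and the ring laws are pulled back along this injection.
module FixedField {p} (S : FiniteRing p) (zeroOrUnit : ∀ x → ZeroOrUnit S x) (k : ℕ)
  (0^k : FixedPoint S k (FiniteRing.0# S))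
  (^k-+ : PowerAdditive S k)
  (elem : Fin k → FiniteRing.Carrier S) (elem-fixed : ∀ i → FixedPoint S k (elem i))
  (elem-injective : ∀ {i j} → FiniteRing._≈_ S (elem i) (elem j) → i ≡ j)
  (complete : ∀ x → FixedPoint S k x → ∃ λ i → FiniteRing._≈_ S (elem i) x)
  where
  open FiniteRing S
  open Exp semiring
  open IntegerCoefficients ring
  open import Algebra.Properties.CommutativeSemiring.Exp commutativeSemiring using (^-distrib-*)

  locate : ∀ x → x ^ k ≈ x → Fin k
  locate x e = proj₁ (complete x e)

  elem-locate : ∀ x e → elem (locate x e) ≈ x
  elem-locate x e = proj₂ (complete x e)

  1^_ : ∀ n → 1# ^ n ≈ 1#
  1^ zero  = refl
  1^ suc n = trans (*-identityˡ _) (1^ n)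

  -- Additivity gives x^k + (-x)^k = 0^k = 0, which avoids a case distinction on the parity of k.
  neg-fixed : ∀ x → x ^ k ≈ x → (- x) ^ k ≈ - x
  neg-fixed x e = trans (solve 2 (λ a b → b := (a :+ b) :+ :- a) refl (x ^ k) ((- x) ^ k))
    (trans (+-cong (trans (sym (^k-+ x (- x))) (trans (^-congˡ k (-‿inverseʳ x)) 0^k)) (-‿cong e))
      (+-identityˡ _))

  infixl 6 _⊕_
  infixl 7 _⊗_
  _⊕_ _⊗_ : Fin k → Fin k → Fin k
  i ⊕ j = locate (elem i + elem j) (trans (^k-+ _ _) (+-cong (elem-fixed i) (elem-fixed j)))
  i ⊗ j = locate (elem i * elem j) (trans (^-distrib-* _ _ k) (*-cong (elem-fixed i) (elem-fixed j)))

  ⊖_ : Fin k → Fin k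
  ⊖ i = locate (- elem i) (neg-fixed _ (elem-fixed i))

  𝟘 𝟙 : Fin k
  𝟘 = locate 0# 0^k
  𝟙 = locate 1# (1^ k)

  rawField : RawRing _ _
  rawField = record { Carrier = Fin k ; _≈_ = _≡_ ; _+_ = _⊕_ ; _*_ = _⊗_ ; -_ = ⊖_ ; 0# = 𝟘 ; 1# = 𝟙 }

  open RingMorphisms rawField rawRing using (IsRingMonomorphism)

  elem-monomorphism : IsRingMonomorphism elem
  elem-monomorphism = record
    { isRingHomomorphism = record
      { isSemiringHomomorphism = record
        { isNearSemiringHomomorphism = record
          { +-isMonoidHomomorphism = record
            { isMagmaHomomorphism = record
              { isRelHomomorphism = record { cong = reflexive ∘ ≡.cong elem }
              ; homo = λ _ _ → elem-locate _ _ }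
            ; ε-homo = elem-locate _ _ }
          ; *-homo = λ _ _ → elem-locate _ _ }
        ; 1#-homo = elem-locate _ _ }
      ; -‿homo = λ _ → elem-locate _ _ }
    ; injective = elem-injective }

  fixedFieldRing : CRing
  fixedFieldRing = record
    { isCommutativeRing = RingMonomorphism.isCommutativeRing elem-monomorphism isCommutativeRing }

  open import Algebra.Properties.Semiring.Exp (CommutativeRing.semiring fixedFieldRing) using () renaming (_^_ to _^ᶠ_)

  elem-^ : ∀ x n → elem (x ^ᶠ n) ≈ elem x ^ n
  elem-^ x zero    = elem-locate _ _
  elem-^ x (suc n) = trans (elem-locate _ _) (*-congˡ (elem-^ x n))

  field′ : FieldOn k
  field′ = record
    { isCommutativeRing = CommutativeRing.isCommutativeRing fixedFieldRing
    ; inverse = inverse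
    ; 1≢0 = λ e → nontrivial (trans (sym (elem-locate 1# (1^ k)))
        (trans (reflexive (≡.cong elem e)) (elem-locate 0# 0^k)))
    ; x^k≡x = λ x → elem-injective (trans (elem-^ x k) (elem-fixed x)) }
    where
    inverse : ∀ x → x ≢ 𝟘 → ∃ λ y → y ⊗ x ≡ 𝟙
    inverse x x≢0 with zeroOrUnit (elem x)
    ... | inj₁ z       = ⊥-elim (x≢0 (elem-injective (trans z (sym (elem-locate _ _)))))
    ... | inj₂ (y , q) = locate y y-fixed , elem-injective (trans (elem-locate _ _)
          (trans (*-congʳ (elem-locate y y-fixed)) (trans q (sym (elem-locate _ _)))))
      where
      -- Since x is fixed, y^k is an inverse of x as well as y; uniqueness of inverses then makes y
      -- fixed.
      y^k*x : y ^ k * elem x ≈ 1#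
      y^k*x = trans (*-congˡ (sym (elem-fixed x))) (trans (sym (^-distrib-* y (elem x) k))
                (trans (^-congˡ k q) (1^ k)))
      y-fixed : y ^ k ≈ y
      y-fixed = trans (sym (*-identityʳ _)) (trans (*-congˡ (sym (trans (*-comm _ _) q)))
        (trans (sym (*-assoc _ _ _)) (trans (*-congʳ y^k*x) (*-identityˡ y))))

module RootField {p} (pr : Prime p) (S : FiniteRing p) (zeroOrUnit : ∀ x → ZeroOrUnit S x)
  (r : ℕ) (d : ℕ) (k≡p^r : suc (suc d) ≡ p ℕ.^ r)
  (split : Monic.Split (FiniteRing.ring S) (suc (suc d)) (XᵏminusX.coefficients (FiniteRing.ring S)))
  where
  open FiniteRing S hiding (zero)
  open Roots S zeroOrUnit
  open XᵏminusX ring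
  open Frobenius ring pr char
  open Exp semiring using (_^_)

  private
    k = suc (suc d)

  p∣k : p ℕ∣.∣ k
  p∣k = ≡.subst (p ℕ∣.∣_) (≡.sym k≡p^r) (p∣ r (≡.subst (1 <_) k≡p^r (s≤s (s≤s z≤n))))
    where
    p∣ : ∀ r → 1 < p ℕ.^ r → p ℕ∣.∣ p ℕ.^ r
    p∣ zero    (s≤s ())
    p∣ (suc r) _ = ℕ∣.m∣m*n (p ℕ.^ r)

  -- As p ∣ k, the derivative of X^k − X is the constant −1.
  separable : Separable k coefficients
  separable x _ e = nontrivial (trans (sym (-‿involutive 1#)) (trans (-‿cong -1≈0) -0#≈0#))
    where
    open import Algebra.Properties.Ring (CommutativeRing.ring ring) using (-‿involutive; -0#≈0#)
    -1≈0 : - 1# ≈ 0#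
    -1≈0 = trans (sym (+-identityˡ _)) (trans (+-congʳ (sym (multiple-0 p∣k (x ^ suc d))))
      (trans (sym (deriv-coefficients d x)) e))

  fixed⇒root : ∀ x → x ^ k ≈ x → Monic.eval ring k coefficients x ≈ 0#
  fixed⇒root x e = trans (eval-coefficients d x) (trans (+-congʳ e) (-‿inverseʳ x))

  rootField : FieldOn k
  rootField = FixedField.field′ S zeroOrUnit k (zeroˡ _)
    (λ x y → ≡.subst (λ k → (x + y) ^ k ≈ x ^ k + y ^ k) (≡.sym k≡p^r) (frobenius-power r x y))
    (roots k coefficients split)
    (λ i → x-y≈0⇒x≈y (trans (sym (eval-coefficients d _)) (roots-root k coefficients split i)))
    (roots-injective k coefficients split separable _ _)
    (λ x e → roots-complete k coefficients split x (fixed⇒root x e))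

module _ {R S : CRing} (φ : Hom R S) where
  open Hom φ
  open CommutativeRing S hiding (zero)

  hom-coefficients : ∀ i → fun (XᵏminusX.coefficients R i) ≈ XᵏminusX.coefficients S i
  hom-coefficients zero          = hom-0
  hom-coefficients (suc zero)    = trans (hom-neg _) (-‿cong hom-1)
  hom-coefficients (suc (suc _)) = hom-0

SplittingField : ∀ {p} → FiniteRing p → ℕ → Set₁
SplittingField {p} R k = Σ (FiniteRing p) λ S → (∀ x → ZeroOrUnit S x) ×
  Monic.Split (FiniteRing.ring S) k (XᵏminusX.coefficients (FiniteRing.ring S))

-- Roots are adjoined before non-units are killed: homomorphisms preserve splittings, so X^k - X
-- still splits in the residue field.
splittingField : ∀ {p} (R : FiniteRing p) k → SplittingField R k
splittingField R k =
  let R′ , φ , split = splitting k R (XᵏminusX.coefficients (FiniteRing.ring R))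
      S , ψ , zeroOrUnit = residueField R′
  in S , zeroOrUnit , Monic.split-cong (FiniteRing.ring S) k (hom-coefficients (ψ ∘ʰ φ))
       (Hom.hom-split ψ k (Hom.fun φ ∘ XᵏminusX.coefficients (FiniteRing.ring R)) split)

finiteField : ∀ {p} → Prime p → ∀ r → 1 < p ℕ.^ r → FieldOn (p ℕ.^ r)
finiteField {p} pr r 1<k = go (p ℕ.^ r) ≡.refl 1<k (splittingField (primeRing p 1<p) _)
  where
  1<p : 1 < p
  1<p = ℕ.nonTrivial⇒n>1 p {{prime⇒nonTrivial pr}}
  -- `p ^ r` does not reduce to a successor, so it is generalised to a variable that can be matched
  -- as `suc (suc d)`.
  go : ∀ k → k ≡ p ℕ.^ r → 1 < k → SplittingField (primeRing p 1<p) k → FieldOn k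
  go (suc zero)    _ (s≤s ())
  go (suc (suc d)) e _ (S , zeroOrUnit , split) = RootField.rootField pr S zeroOrUnit r d e split

-- Counting nonzero values of polynomial functions

module _ {A : Set} where

  length-filter-≤ : ∀ {P Q : A → Set} (P? : Decidable P) (Q? : Decidable Q) → (∀ x → P x → Q x) →
    ∀ l → length (filter P? l) ≤ length (filter Q? l)
  length-filter-≤ P? Q? P⇒Q []      = z≤n
  length-filter-≤ P? Q? P⇒Q (x ∷ l) with P? x | Q? x
  ... | yes p | yes q = s≤s (length-filter-≤ P? Q? P⇒Q l)
  ... | yes p | no ¬q = ⊥-elim (¬q (P⇒Q x p))
  ... | no ¬p | yes q = ℕ.m≤n⇒m≤1+n (length-filter-≤ P? Q? P⇒Q l)
  ... | no ¬p | no ¬q = length-filter-≤ P? Q? P⇒Q l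

  length-filter-cong : ∀ {P Q : A → Set} (P? : Decidable P) (Q? : Decidable Q) →
    (∀ x → P x → Q x) → (∀ x → Q x → P x) → ∀ l → length (filter P? l) ≡ length (filter Q? l)
  length-filter-cong P? Q? P⇒Q Q⇒P l =
    ℕ.≤-antisym (length-filter-≤ P? Q? P⇒Q l) (length-filter-≤ Q? P? Q⇒P l)

  length-filter-map : ∀ {B : Set} {P : A → Set} (P? : Decidable P) (f : B → A) →
    ∀ l → length (filter P? (map f l)) ≡ length (filter (P? ∘ f) l)
  length-filter-map P? f []      = ≡.refl
  length-filter-map P? f (x ∷ l) with P? (f x)
  ... | yes _ = ≡.cong suc (length-filter-map P? f l)
  ... | no _  = length-filter-map P? f l

  length-filter-concatMap : ∀ {B : Set} {P : A → Set} (P? : Decidable P) (f : B → List A) →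
    ∀ l → length (filter P? (concatMap f l)) ≡ sum (map (λ b → length (filter P? (f b))) l)
  length-filter-concatMap P? f []      = ≡.refl
  length-filter-concatMap P? f (x ∷ l)
    rewrite List.filter-++ P? (f x) (concatMap f l)
          | List.length-++ (filter P? (f x)) {filter P? (concatMap f l)} =
    ≡.cong (length (filter P? (f x)) ℕ.+_) (length-filter-concatMap P? f l)

  filter-split : ∀ {P : A → Set} (P? : Decidable P) l →
    length (filter P? l) ℕ.+ length (filter (¬? ∘ P?) l) ≡ length l
  filter-split P? []      = ≡.refl
  filter-split P? (x ∷ l) with P? x
  ... | yes _ = ≡.cong suc (filter-split P? l)
  ... | no _  = ≡.trans (ℕ.+-suc _ _) (≡.cong suc (filter-split P? l))

  filter-nonempty : ∀ {P : A → Set} (P? : Decidable P) l → 1 ≤ length (filter P? l) → ∃ P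
  filter-nonempty P? (x ∷ l) h with P? x
  ... | yes p = x , p
  ... | no _  = filter-nonempty P? l h

  sum-filter-≤ : ∀ {P : A → Set} (P? : Decidable P) (h : A → ℕ) l →
    sum (map h (filter P? l)) ≤ sum (map h l)
  sum-filter-≤ P? h []      = z≤n
  sum-filter-≤ P? h (x ∷ l) with P? x
  ... | yes _ = ℕ.+-monoʳ-≤ (h x) (sum-filter-≤ P? h l)
  ... | no _  = ℕ.≤-trans (sum-filter-≤ P? h l) (ℕ.m≤n+m _ (h x))

  ∈⇒≤sum : ∀ (h : A → ℕ) {x l} → x ∈ l → h x ≤ sum (map h l)
  ∈⇒≤sum h (here ≡.refl)     = ℕ.m≤m+n _ _
  ∈⇒≤sum h (there {y} x∈l) = ℕ.≤-trans (∈⇒≤sum h x∈l) (ℕ.m≤n+m _ (h y))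

  below-average : ∀ (h : A → ℕ) x l → ∃ λ y → y ∈ x ∷ l × length (x ∷ l) ℕ.* h y ≤ sum (map h (x ∷ l))
  below-average h x []       = x , here ≡.refl , ℕ.≤-refl
  below-average h x (x′ ∷ l) with below-average h x′ l
  ... | y , y∈ , le with ℕ.≤-total (h x) (h y)
  ...   | inj₁ x≤y = x , here ≡.refl ,
            ℕ.+-monoʳ-≤ (h x) (ℕ.≤-trans (ℕ.*-monoʳ-≤ (length (x′ ∷ l)) x≤y) le)
  ...   | inj₂ y≤x = y , there y∈ , ℕ.+-mono-≤ y≤x le

module _ {k : ℕ} where

  count : ∀ {n} {P : (Fin n → Fin k) → Set} → Decidable P → ℕ
  count {n} P? = length (filter P? (allMaps n k))

  -- Maps listed by `allMaps` agree with the intended ones only pointwise, so the predicates that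
  -- are counted must respect pointwise equality.
  Extensional : ∀ {n} → ((Fin n → Fin k) → Set) → Set
  Extensional P = ∀ {κ κ′} → κ ≗ κ′ → P κ → P κ′

  count-suc : ∀ {n} {P : (Fin (suc n) → Fin k) → Set} (P? : Decidable P) → Extensional P →
    count P? ≡ sum (map (λ c → count (λ κ → P? (c VecF.∷ κ))) (allFin k))
  count-suc {n} P? ext = ≡.trans (length-filter-concatMap P? _ (allFin k))
    -- The implicit `h` of `reindex` is solved to the anonymous pattern-matching function inside
    -- `allMaps`, which cannot be named here.
    (≡.cong sum (List.map-cong (λ c → reindex c (λ _ → λ { Fin.zero → ≡.refl ; (Fin.suc _) → ≡.refl })) (allFin k)))
    where
    reindex : ∀ c {h : (Fin n → Fin k) → (Fin (suc n) → Fin k)} → (∀ κ → h κ ≗ (c VecF.∷ κ)) →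
      length (filter P? (map h (allMaps n k))) ≡ count (λ κ → P? (c VecF.∷ κ))
    reindex c {h} e = ≡.trans (length-filter-map P? h (allMaps n k))
      (length-filter-cong (P? ∘ h) (λ κ → P? (c VecF.∷ κ)) (λ κ → ext (e κ)) (λ κ → ext (≡.sym ∘ e κ)) (allMaps n k))

  count-positive : ∀ {n} {P : (Fin n → Fin k) → Set} (P? : Decidable P) → Extensional P →
    ∀ κ → P κ → 1 ≤ count P?
  count-positive {zero} {P} P? ext κ p = singleton (ext (λ ()) p)
    where
    singleton : ∀ {κ′} → P κ′ → 1 ≤ length (filter P? (κ′ ∷ []))
    singleton {κ′} p′ with P? κ′
    ... | yes _ = s≤s z≤n
    ... | no ¬p = ⊥-elim (¬p p′)
  count-positive {suc n} P? ext κ p = ≡.subst (1 ≤_) (≡.sym (count-suc P? ext)) (ℕ.≤-trans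
    (count-positive (λ κ′ → P? (κ Fin.zero VecF.∷ κ′))
      (λ e → ext λ { Fin.zero → ≡.refl ; (Fin.suc i) → e i }) (κ ∘ Fin.suc)
      (ext (λ { Fin.zero → ≡.refl ; (Fin.suc _) → ≡.refl }) p))
    (∈⇒≤sum (λ c → count (λ κ′ → P? (c VecF.∷ κ′))) (Mem.∈-allFin (κ Fin.zero))))

-- (1 + 1/k)^s ≤ s + 1 for s ≤ k.
power-step : ∀ s k → s ≤ k → suc k ℕ.^ s ≤ suc s ℕ.* k ℕ.^ s
power-step zero    k _   = ℕ.≤-refl
power-step (suc s) k s<k = begin
  suc k ℕ.* suc k ℕ.^ s              ≤⟨ ℕ.*-monoʳ-≤ (suc k) (power-step s k (ℕ.<⇒≤ s<k)) ⟩
  suc k ℕ.* (suc s ℕ.* k ℕ.^ s)      ≡⟨ ℕ.*-assoc (suc k) (suc s) (k ℕ.^ s) ⟨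
  suc k ℕ.* suc s ℕ.* k ℕ.^ s        ≤⟨ ℕ.*-monoˡ-≤ (k ℕ.^ s) bound ⟩
  suc (suc s) ℕ.* k ℕ.* k ℕ.^ s      ≡⟨ ℕ.*-assoc (suc (suc s)) k (k ℕ.^ s) ⟩
  suc (suc s) ℕ.* (k ℕ.* k ℕ.^ s)    ∎
  where
  open ℕ.≤-Reasoning
  bound : suc k ℕ.* suc s ≤ suc (suc s) ℕ.* k
  bound = ℕ.+-mono-≤ s<k (ℕ.≤-reflexive (ℕ.*-comm k (suc s)))

-- For k = u + 1 + j this is u + 1 ≥ k^(u/(k - 1)): the logarithm lies above its chord from 1 to k.
-- It is what replaces a side length by a power of k. Raising j by one multiplies the right by u + 1
-- and, by `power-step`, the left by at most that.
power-swap : ∀ u j → (suc u ℕ.+ j) ℕ.^ u ≤ suc u ℕ.^ (u ℕ.+ j)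
power-swap u zero rewrite ℕ.+-identityʳ u = ℕ.≤-refl
power-swap u (suc j) rewrite ℕ.+-suc u j =
  ℕ.≤-trans (power-step u (suc u ℕ.+ j) (ℕ.≤-trans (ℕ.n≤1+n u) (ℕ.m≤m+n (suc u) j)))
            (ℕ.*-monoʳ-≤ (suc u) (power-swap u j))

^-*-distrib : ∀ a b n → (a ℕ.* b) ℕ.^ n ≡ a ℕ.^ n ℕ.* b ℕ.^ n
^-*-distrib a b zero    = ≡.refl
^-*-distrib a b (suc n) = ≡.trans (≡.cong ((a ℕ.* b) ℕ.*_) (^-*-distrib a b n))
  (ℕ.[m*n]*[o*p]≡[m*o]*[n*p] a b (a ℕ.^ n) (b ℕ.^ n))

-- The arithmetic of one induction step of Alon-Füredi: t values of the new variable are excluded at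
-- the price of one degree each, and u + 1 values carry at least b nonzero points each. Everything
-- is raised to the power k - 1 to keep the exponents integral.
combine-bounds : ∀ {k} u t n D′ D {b N} → k ≡ suc u ℕ.+ t → D ≡ D′ ℕ.+ t → suc u ℕ.* b ≤ N →
  k ℕ.^ (n ℕ.* (k ∸ 1)) ≤ k ℕ.^ D′ ℕ.* b ℕ.^ (k ∸ 1) →
  k ℕ.^ (suc n ℕ.* (k ∸ 1)) ≤ k ℕ.^ D ℕ.* N ℕ.^ (k ∸ 1)
combine-bounds u t n D′ D {b} {N} ≡.refl ≡.refl ub≤N ih = begin
  k ℕ.^ (m ℕ.+ n ℕ.* m)                             ≡⟨ ℕ.^-distribˡ-+-* k m (n ℕ.* m) ⟩
  k ℕ.^ m ℕ.* k ℕ.^ (n ℕ.* m)                       ≤⟨ ℕ.*-mono-≤ k^m≤ ih ⟩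
  (k ℕ.^ t ℕ.* suc u ℕ.^ m) ℕ.* (k ℕ.^ D′ ℕ.* b ℕ.^ m)
    ≡⟨ ℕ.[m*n]*[o*p]≡[m*o]*[n*p] (k ℕ.^ t) (suc u ℕ.^ m) (k ℕ.^ D′) (b ℕ.^ m) ⟩
  (k ℕ.^ t ℕ.* k ℕ.^ D′) ℕ.* (suc u ℕ.^ m ℕ.* b ℕ.^ m)
    ≡⟨ ≡.cong₂ ℕ._*_ (≡.trans (ℕ.*-comm (k ℕ.^ t) _) (≡.sym (ℕ.^-distribˡ-+-* k D′ t)))
                     (≡.sym (^-*-distrib (suc u) b m)) ⟩
  k ℕ.^ (D′ ℕ.+ t) ℕ.* (suc u ℕ.* b) ℕ.^ m          ≤⟨ ℕ.*-monoʳ-≤ (k ℕ.^ (D′ ℕ.+ t)) (ℕ.^-monoˡ-≤ m ub≤N) ⟩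
  k ℕ.^ (D′ ℕ.+ t) ℕ.* N ℕ.^ m                      ∎
  where
  open ℕ.≤-Reasoning
  k m : ℕ
  k = suc u ℕ.+ t
  m = u ℕ.+ t
  k^m≤ : k ℕ.^ m ≤ k ℕ.^ t ℕ.* suc u ℕ.^ m
  k^m≤ = begin
    k ℕ.^ (u ℕ.+ t)             ≡⟨ ℕ.^-distribˡ-+-* k u t ⟩
    k ℕ.^ u ℕ.* k ℕ.^ t         ≡⟨ ℕ.*-comm (k ℕ.^ u) _ ⟩
    k ℕ.^ t ℕ.* k ℕ.^ u         ≤⟨ ℕ.*-monoʳ-≤ (k ℕ.^ t) (power-swap u t) ⟩
    k ℕ.^ t ℕ.* suc u ℕ.^ m     ∎

module Degree {k : ℕ} (F : FieldOn k) where
  open FieldOn F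
  open CommutativeRing ring using (+-congʳ; *-congˡ; +-identityˡ; zeroˡ; zeroʳ; _-_)
  open IntegerCoefficients ring
  open ≡.≡-Reasoning

  Point : ℕ → Set
  Point n = Fin n → Fin k

  -- Total degree strictly below D; in particular Deg 0 holds only of the zero function.
  data Deg {n : ℕ} : ℕ → (Point n → Fin k) → Set where
    zero   : ∀ {D} → Deg D (λ _ → 0#)
    const  : ∀ {D} c → Deg (suc D) (λ _ → c)
    add    : ∀ {D f g} → Deg D f → Deg D g → Deg D (λ x → f x + g x)
    mulvar : ∀ {D f} i → Deg D f → Deg (suc D) (λ x → x i * f x)
    resp   : ∀ {D f g} → (∀ x → f x ≡ g x) → Deg D f → Deg D g

  deg-0 : ∀ {n} {f : Point n → Fin k} → Deg 0 f → ∀ x → f x ≡ 0#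
  deg-0 zero       x = ≡.refl
  deg-0 (add p q)  x = ≡.trans (≡.cong₂ _+_ (deg-0 p x) (deg-0 q x)) (+-identityˡ 0#)
  deg-0 (resp e p) x = ≡.trans (≡.sym (e x)) (deg-0 p x)

  deg-ext : ∀ {n D} {f : Point n → Fin k} → Deg D f → ∀ {x y} → x ≗ y → f x ≡ f y
  deg-ext zero         e = ≡.refl
  deg-ext (const c)    e = ≡.refl
  deg-ext (add p q)    e = ≡.cong₂ _+_ (deg-ext p e) (deg-ext q e)
  deg-ext (mulvar i p) e = ≡.cong₂ _*_ (e i) (deg-ext p e)
  deg-ext (resp h p)   e = ≡.trans (≡.sym (h _)) (≡.trans (deg-ext p e) (h _))

  deg-≤ : ∀ {n D E} {f : Point n → Fin k} → D ≤ E → Deg D f → Deg E f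
  deg-≤ l       zero         = zero
  deg-≤ (s≤s l) (const c)    = const c
  deg-≤ l       (add p q)    = add (deg-≤ l p) (deg-≤ l q)
  deg-≤ (s≤s l) (mulvar i p) = mulvar i (deg-≤ l p)
  deg-≤ l       (resp e p)   = resp e (deg-≤ l p)

  scale : ∀ {n D} {f : Point n → Fin k} c → Deg D f → Deg D (λ x → c * f x)
  scale c zero         = resp (λ _ → ≡.sym (zeroʳ c)) zero
  scale c (const a)    = const (c * a)
  scale c (add p q)    = resp (λ x → solve 3 (λ c a b → c :* a :+ c :* b := c :* (a :+ b)) ≡.refl c _ _)
                           (add (scale c p) (scale c q))
  scale c (mulvar {f = f} i p) = resp (λ x → solve 3 (λ c a b → a :* (c :* b) := c :* (a :* b)) ≡.refl c (x i) (f x))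
                           (mulvar i (scale c p))
  scale c (resp e p)   = resp (λ x → ≡.cong (c *_) (e x)) (scale c p)

  mul : ∀ {n D E} {f g : Point n → Fin k} → Deg (suc D) f → Deg (suc E) g → Deg (suc (D ℕ.+ E)) (λ x → f x * g x)
  mul {g = g} zero q = resp (λ x → ≡.sym (zeroˡ (g x))) zero
  mul {D = D} {E} (const c) q = deg-≤ (s≤s (ℕ.m≤n+m E D)) (scale c q)
  mul {g = g} (add p p′) q = resp (λ x → ≡.sym (CommutativeRing.distribʳ ring (g x) _ _)) (add (mul p q) (mul p′ q))
  mul {D = zero} {g = g} (mulvar i p) q =
    resp (λ x → ≡.sym (≡.trans (≡.cong (_* g x) (≡.trans (≡.cong (x i *_) (deg-0 p x)) (zeroʳ _))) (zeroˡ (g x)))) zero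
  mul {D = suc D} (mulvar i p) q = resp (λ x → ≡.sym (CommutativeRing.*-assoc ring (x i) _ _)) (mulvar i (mul p q))
  mul {g = g} (resp e p) q = resp (λ x → ≡.cong (_* g x) (e x)) (mul p q)

  variable-deg : ∀ {n} (i : Fin n) → Deg 2 (λ x → x i)
  variable-deg i = resp (λ x → CommutativeRing.*-identityʳ ring (x i)) (mulvar i (const 1#))

  restrict : ∀ {n D} {f : Point (suc n) → Fin k} a → Deg D f → Deg D (λ y → f (a VecF.∷ y))
  restrict a zero                 = zero
  restrict a (const c)            = const c
  restrict a (add p q)            = add (restrict a p) (restrict a q)
  restrict a (mulvar Fin.zero p)  = deg-≤ (ℕ.n≤1+n _) (scale a (restrict a p))
  restrict a (mulvar (Fin.suc i) p) = mulvar i (restrict a p)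
  restrict a (resp e p)           = resp (λ y → e _) (restrict a p)

  factor : ∀ {n D} {f : Point (suc n) → Fin k} a → Deg (suc D) f → ∃ λ q → Deg D q ×
    (∀ x y → f (x VecF.∷ y) ≡ f (a VecF.∷ y) + (x - a) * q (x VecF.∷ y))
  factor a zero = _ , zero , λ x y →
    solve 2 (λ x a → con (+ 0) := con (+ 0) :+ (x :- a) :* con (+ 0)) ≡.refl x a
  factor a (const c) = _ , zero , λ x y →
    solve 3 (λ c x a → c := c :+ (x :- a) :* con (+ 0)) ≡.refl c x a
  factor a (add {f = f} {g} p p′) =
    let q , d , e = factor a p ; q′ , d′ , e′ = factor a p′ in
    _ , add d d′ , λ x y → ≡.trans (≡.cong₂ _+_ (e x y) (e′ x y))
      (solve 6 (λ f g x a q q′ → (f :+ (x :- a) :* q) :+ (g :+ (x :- a) :* q′) := (f :+ g) :+ (x :- a) :* (q :+ q′))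
        ≡.refl (f (a VecF.∷ y)) (g (a VecF.∷ y)) x a (q (x VecF.∷ y)) (q′ (x VecF.∷ y)))
  factor {D = zero} a (mulvar {f = f} i p) = _ , zero , λ x y → begin
    (x VecF.∷ y) i * f (x VecF.∷ y)  ≡⟨ vanish x y ⟩
    0#                               ≡⟨ +-identityˡ 0# ⟨
    0# + 0#                          ≡⟨ ≡.cong₂ _+_ (vanish a y) (zeroʳ (x - a)) ⟨
    (a VecF.∷ y) i * f (a VecF.∷ y) + (x - a) * 0# ∎
    where
    vanish : ∀ x y → (x VecF.∷ y) i * f (x VecF.∷ y) ≡ 0#
    vanish x y = ≡.trans (*-congˡ (deg-0 p _)) (zeroʳ _)
  factor {D = suc D} a (mulvar {f = f} Fin.zero p) =
    let q , d , e = factor a p in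
    -- From x f(x) - a f(a) = (x - a) f(x) + a (f(x) - f(a)), with f(x) - f(a) = (x - a) q(x).
    (λ x → f x + a * q x) , add p (deg-≤ (ℕ.n≤1+n D) (scale a d)) , λ x y →
      ≡.trans (solve 4 (λ x a f q → x :* f := a :* (f :- (x :- a) :* q) :+ (x :- a) :* (f :+ a :* q)) ≡.refl
                 x a (f (x VecF.∷ y)) (q (x VecF.∷ y)))
        (+-congʳ (*-congˡ (≡.trans (+-congʳ (e x y))
          (solve 2 (λ f s → f :+ s :- s := f) ≡.refl (f (a VecF.∷ y)) _))))
  factor {D = suc D} a (mulvar {f = f} (Fin.suc i) p) =
    let q , d , e = factor a p in
    _ , mulvar (Fin.suc i) d , λ x y → ≡.trans (≡.cong (y i *_) (e x y))
      (solve 5 (λ v f x a q → v :* (f :+ (x :- a) :* q) := v :* f :+ (x :- a) :* (v :* q)) ≡.refl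
        (y i) (f (a VecF.∷ y)) x a (q (x VecF.∷ y)))
  factor a (resp e p) =
    let q , d , h = factor a p in
    q , d , λ x y → ≡.trans (≡.sym (e _)) (≡.trans (h x y) (+-congʳ (e _)))

  *-nonzero : ∀ {x y} → x ≢ 0# → y ≢ 0# → x * y ≢ 0#
  *-nonzero {x} {y} x≢0 y≢0 xy≡0 =
    let u , u*x≡1 = inverse x x≢0 in
    y≢0 (begin
      y            ≡⟨ CommutativeRing.*-identityˡ ring y ⟨
      1# * y       ≡⟨ ≡.cong (_* y) u*x≡1 ⟨
      u * x * y    ≡⟨ CommutativeRing.*-assoc ring u x y ⟩
      u * (x * y)  ≡⟨ ≡.cong (u *_) xy≡0 ⟩
      u * 0#       ≡⟨ zeroʳ u ⟩
      0#           ∎)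

  -≡0⇒≡ : ∀ {x y} → x - y ≡ 0# → x ≡ y
  -≡0⇒≡ {x} {y} e = ≡.trans (solve 2 (λ x y → x := (x :- y) :+ y) ≡.refl x y)
    (≡.trans (≡.cong (_+ y) e) (+-identityˡ y))

  -- Each slice on which f vanishes allows division by a linear factor in the first variable, at a
  -- gain of one degree. On the remaining slices that factor is nonzero, so the quotient has the
  -- same zeros there. Vanishing is required, and preserved, only at the points `y κ`.
  peel : ∀ {n} (a : Fin k → Fin k) → (∀ {b c} → a b ≡ a c → b ≡ c) → {K : Set} (y : K → Point n) →
    ∀ B → Unique B → ∀ D (f : Point (suc n) → Fin k) → Deg D f →
    (∀ b → b ∈ B → ∀ κ → f (a b VecF.∷ y κ) ≡ 0#) →
    ∃ λ q → Deg (D ∸ length B) q × (∀ c → c ∉ B → ∀ κ →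
      (f (a c VecF.∷ y κ) ≢ 0# → q (a c VecF.∷ y κ) ≢ 0#) × (q (a c VecF.∷ y κ) ≢ 0# → f (a c VecF.∷ y κ) ≢ 0#))
  peel a inj y []      uniq D f p h = f , p , λ _ _ _ → id , id
  peel a inj y (b ∷ B) uniq zero f p h = f , p , λ _ _ _ → id , id
  peel a inj y (b ∷ B) (b∉B ∷ uniq) (suc D) f p h =
    let q , q-deg , f≡ = factor (a b) p
        factored : ∀ c κ → f (a c VecF.∷ y κ) ≡ (a c - a b) * q (a c VecF.∷ y κ)
        factored c κ = ≡.trans (f≡ (a c) (y κ)) (≡.trans (+-congʳ (h b (here ≡.refl) κ)) (+-identityˡ _))
        distinct : ∀ {c} → c ≢ b → a c - a b ≢ 0#
        distinct c≢b e = c≢b (inj (-≡0⇒≡ e))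
        q-vanish : ∀ c → c ∈ B → ∀ κ → q (a c VecF.∷ y κ) ≡ 0#
        q-vanish c c∈B κ = zero-of (q (a c VecF.∷ y κ) Fin.≟ 0#) λ q≢0 →
          *-nonzero (distinct (λ c≡b → All.lookup b∉B c∈B (≡.sym c≡b))) q≢0
            (≡.trans (≡.sym (factored c κ)) (h c (there c∈B) κ))
        q′ , deg′ , iff = peel a inj y B uniq D q q-deg q-vanish
    in q′ , deg′ , λ c c∉ κ →
      (λ f≢0 → proj₁ (iff c (c∉ ∘ there) κ) λ q≡0 → f≢0 (≡.trans (factored c κ) (≡.trans (*-congˡ q≡0) (zeroʳ _)))) ,
      (λ q′≢0 f≡0 → *-nonzero (distinct (c∉ ∘ here)) (proj₂ (iff c (c∉ ∘ there) κ) q′≢0)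
        (≡.trans (≡.sym (factored c κ)) f≡0))
    where
    zero-of : ∀ {x} → Dec (x ≡ 0#) → ¬ x ≢ 0# → x ≡ 0#
    zero-of (yes e) _ = e
    zero-of (no ne) h = ⊥-elim (h ne)

  infix 30 _⟪_⟫
  -- The point of the field space that belongs to a colouring κ after the renaming `e` at each
  -- vertex. Counting is done over κ, so no count has to be transported along the renaming.
  _⟪_⟫ : ∀ {n} → (Fin n → Fin k → Fin k) → (Fin n → Fin k) → Point n
  (e ⟪ κ ⟫) i = e i (κ i)

  nonzero? : ∀ {n} (e : Fin n → Fin k → Fin k) (f : Point n → Fin k) → Decidable (λ κ → f (e ⟪ κ ⟫) ≢ 0#)
  nonzero? e f κ = ¬? (f (e ⟪ κ ⟫) Fin.≟ 0#)

  nonzero-ext : ∀ {n D} (e : Fin n → Fin k → Fin k) {f : Point n → Fin k} → Deg D f →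
    Extensional (λ κ → f (e ⟪ κ ⟫) ≢ 0#)
  nonzero-ext e p h f≢0 f≡0 = f≢0 (≡.trans (deg-ext p (λ i → ≡.cong (e i) (h i))) f≡0)

  -- Alon–Füredi, in the weakened form where the extremal product of side lengths is replaced by a power of k.
  alonFüredi : ∀ n (e : Fin n → Fin k → Fin k) → (∀ i {b c} → e i b ≡ e i c → b ≡ c) →
    ∀ D (f : Point n → Fin k) → Deg (suc D) f → ∀ κ → f (e ⟪ κ ⟫) ≢ 0# →
    k ℕ.^ (n ℕ.* (k ∸ 1)) ≤ k ℕ.^ D ℕ.* count (nonzero? e f) ℕ.^ (k ∸ 1)
  alonFüredi zero e inj D f p κ f≢0 =
    ℕ.*-mono-≤ (k^≥1 D) (≡.subst (_≤ count (nonzero? e f) ℕ.^ (k ∸ 1)) (ℕ.^-zeroˡ (k ∸ 1))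
      (ℕ.^-monoˡ-≤ (k ∸ 1) (count-positive (nonzero? e f) (nonzero-ext e p) κ f≢0)))
    where
    k^≥1 : ∀ D → 1 ≤ k ℕ.^ D
    k^≥1 D = ℕ.m^n>0 k {{ℕ.>-nonZero (ℕ.≤-<-trans z≤n (Fin.toℕ<n 0#))}} D
  alonFüredi (suc n) e inj D f p κ f≢0 = step (proj₁ (peeled)) (proj₁ (proj₂ peeled)) (proj₂ (proj₂ peeled)) good ≡.refl
    where
    slice : Fin k → Point n → Fin k
    slice c y = f (e Fin.zero c VecF.∷ y)
    e′ = e ∘ Fin.suc
    N : Fin k → ℕ
    N c = count (nonzero? e′ (slice c))
    bad good : List (Fin k)
    bad  = filter (λ c → N c ℕ.≟ 0) (allFin k)
    good = filter (λ c → ¬? (N c ℕ.≟ 0)) (allFin k)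
    slice-deg : ∀ c → Deg (suc D) (slice c)
    slice-deg c = restrict (e Fin.zero c) p
    vanishes : ∀ b → b ∈ bad → ∀ κ → slice b (e′ ⟪ κ ⟫) ≡ 0#
    vanishes b b∈ κ with slice b (e′ ⟪ κ ⟫) Fin.≟ 0#
    ... | yes z = z
    ... | no nz = ⊥-elim (ℕ.<⇒≢ (count-positive (nonzero? e′ (slice b)) (nonzero-ext e′ (slice-deg b)) κ nz)
                    (≡.sym (proj₂ (Mem.∈-filter⁻ (λ c → N c ℕ.≟ 0) {xs = allFin k} b∈))))
    peeled = peel (e Fin.zero) (inj Fin.zero) (e′ ⟪_⟫) bad
      (Unique.filter⁺ (λ c → N c ℕ.≟ 0) (Unique.allFin⁺ k)) (suc D) f p vanishes
    cons-⟪⟫ : ∀ c κ i → (e Fin.zero c VecF.∷ e′ ⟪ κ ⟫) i ≡ (e ⟪ c VecF.∷ κ ⟫) i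
    cons-⟪⟫ c κ Fin.zero    = ≡.refl
    cons-⟪⟫ c κ (Fin.suc i) = ≡.refl
    total : count (nonzero? e f) ≡ sum (map N (allFin k))
    total = ≡.trans (count-suc (nonzero? e f) (nonzero-ext e p))
      (≡.cong sum (List.map-cong (λ c → length-filter-cong _ _
        (λ κ h z → h (≡.trans (≡.sym (deg-ext p (cons-⟪⟫ c κ))) z))
        (λ κ h z → h (≡.trans (deg-ext p (cons-⟪⟫ c κ)) z)) (allMaps n k)) (allFin k)))
    sizes : length bad ℕ.+ length good ≡ k
    sizes = ≡.trans (filter-split (λ c → N c ℕ.≟ 0) (allFin k)) (List.length-tabulate id)
    good-∈ : κ Fin.zero ∈ good
    good-∈ = Mem.∈-filter⁺ (λ c → ¬? (N c ℕ.≟ 0)) (Mem.∈-allFin (κ Fin.zero)) λ z → ℕ.<⇒≢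
      (count-positive (nonzero? e′ (slice (κ Fin.zero))) (nonzero-ext e′ (slice-deg _)) (κ ∘ Fin.suc)
        (λ h → f≢0 (≡.trans (deg-ext p (λ { Fin.zero → ≡.refl ; (Fin.suc _) → ≡.refl })) h))) (≡.sym z)

    step : ∀ q → Deg (suc D ∸ length bad) q → (∀ c → c ∉ bad → ∀ κ →
        (slice c (e′ ⟪ κ ⟫) ≢ 0# → q (e Fin.zero c VecF.∷ e′ ⟪ κ ⟫) ≢ 0#) ×
        (q (e Fin.zero c VecF.∷ e′ ⟪ κ ⟫) ≢ 0# → slice c (e′ ⟪ κ ⟫) ≢ 0#)) →
      ∀ gs → gs ≡ good →
      k ℕ.^ (suc n ℕ.* (k ∸ 1)) ≤ k ℕ.^ D ℕ.* count (nonzero? e f) ℕ.^ (k ∸ 1)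
    step q q-deg iff [] eq with () ← ≡.subst (κ Fin.zero ∈_) (≡.sym eq) good-∈
    -- Among the good first coordinates, one whose slice has at most the average number of nonzero
    -- points; the induction hypothesis for its slice then bounds the whole count from below.
    step q q-deg iff (g ∷ gs) eq with below-average N g gs
    ... | c , c∈ , average = bound (suc D ∸ length bad) ≡.refl q-deg
      where
      u = length gs
      t = length bad
      N≢0 : N c ≢ 0
      N≢0 = proj₂ (Mem.∈-filter⁻ (λ c → ¬? (N c ℕ.≟ 0)) {xs = allFin k} (≡.subst (c ∈_) eq c∈))
      c∉bad : c ∉ bad
      c∉bad c∈bad = N≢0 (proj₂ (Mem.∈-filter⁻ (λ c → N c ℕ.≟ 0) {xs = allFin k} c∈bad))
      witness = filter-nonempty (nonzero? e′ (slice c)) (allMaps n k) (ℕ.n≢0⇒n>0 N≢0)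
      k≡ : k ≡ suc u ℕ.+ t
      k≡ = ≡.trans (≡.sym sizes) (≡.trans (ℕ.+-comm t _) (≡.cong (λ l → length l ℕ.+ t) (≡.sym eq)))
      u*N≤ : suc u ℕ.* N c ≤ count (nonzero? e f)
      u*N≤ = ℕ.≤-trans average (ℕ.≤-trans
        (≡.subst (λ l → sum (map N l) ≤ sum (map N (allFin k))) (≡.sym eq) (sum-filter-≤ _ N (allFin k)))
        (ℕ.≤-reflexive (≡.sym total)))
      bound : ∀ E → E ≡ suc D ∸ t → Deg E q →
        k ℕ.^ (suc n ℕ.* (k ∸ 1)) ≤ k ℕ.^ D ℕ.* count (nonzero? e f) ℕ.^ (k ∸ 1)
      -- More bad values than the degree allows would leave the zero function, yet `q` is nonzero at
      -- the witness.
      bound zero     eqE q-deg = ⊥-elim (proj₁ (iff c c∉bad (proj₁ witness)) (proj₂ witness) (deg-0 q-deg _))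
      bound (suc D′) eqE q-deg = combine-bounds u t n D′ D k≡ D≡
        (ℕ.≤-trans (ℕ.*-monoʳ-≤ (suc u) (length-filter-≤ (nonzero? e′ q′) (nonzero? e′ (slice c))
          (λ κ → proj₂ (iff c c∉bad κ)) (allMaps n k))) u*N≤)
        (alonFüredi n e′ (inj ∘ Fin.suc) D′ q′ (restrict _ q-deg) (proj₁ witness)
          (proj₁ (iff c c∉bad (proj₁ witness)) (proj₂ witness)))
        where
        q′ : Point n → Fin k
        q′ y = q (e Fin.zero c VecF.∷ y)
        D≡ : D ≡ D′ ℕ.+ t
        D≡ = ℕ.suc-injective (≡.sym (≡.trans (≡.cong (λ m → m ℕ.+ t) eqE)
          (ℕ.m∸n+n≡m {suc D} {t} (ℕ.<⇒≤ (ℕ.m∸n≢0⇒n<m (λ z → case-suc (≡.trans eqE z)))))))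
          where
          case-suc : suc D′ ≢ 0
          case-suc ()

-- Permutations as polynomials and as unions of lines

injective⇒surjective : ∀ {k} (f : Fin k → Fin k) → (∀ {x y} → f x ≡ f y → x ≡ y) → ∀ y → ∃ λ x → f x ≡ y
injective⇒surjective {suc k} f inj y with Fin.any? (λ x → f x Fin.≟ y)
... | yes found = found
... | no none   = ⊥-elim (ℕ.<-irrefl ≡.refl (Fin.injective⇒≤ {f = λ x → punchOut (λ e → none (x , ≡.sym e))}
                    (λ {x} {x′} e → inj (Fin.punchOut-injective (λ e → none (x , ≡.sym e))
                          (λ e → none (x′ , ≡.sym e)) e))))

permutation-injective : ∀ {k} (π : Permutation k k) {x y} → π ⟨$⟩ʳ x ≡ π ⟨$⟩ʳ y → x ≡ y
permutation-injective π e = ≡.trans (≡.sym (Perm.inverseˡ π)) (≡.trans (≡.cong (π ⟨$⟩ˡ_) e) (Perm.inverseˡ π))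

injective⇒permutation : ∀ {k} (f : Fin k → Fin k) → (∀ {x y} → f x ≡ f y → x ≡ y) → Permutation k k
injective⇒permutation f inj = Perm.permutation f (proj₁ ∘ sur) (proj₂ ∘ sur) (λ x → inj (proj₂ (sur (f x))))
  where sur = injective⇒surjective f inj

module _ where
  open MonoidSum ℕ.+-0-commutativeMonoid using (sum-permute; ∑-distrib-+; sum-cong-≗) renaming (sum to ∑)

  -- Every element lies either below or above its partner, and `ι` exchanges the two classes, so
  -- both have size `c`.
  involution⇒even : ∀ {k} (ι : Fin k → Fin k) → (∀ x → ι (ι x) ≡ x) → (∀ x → ι x ≢ x) → 2 ℕ∣.∣ k
  involution⇒even {k} ι invol free = ℕ∣.divides c (begin
    k                                                ≡⟨ ones k ⟩
    ∑ {k} (λ _ → 1)                                ≡⟨ sum-cong-≗ trichotomy ⟩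
    ∑ (λ x → ind x (ι x) ℕ.+ ind (ι x) x)          ≡⟨ ∑-distrib-+ (λ x → ind x (ι x)) (λ x → ind (ι x) x) ⟩
    c ℕ.+ ∑ (λ x → ind (ι x) x)                    ≡⟨ ≡.cong (c ℕ.+_)
          (≡.trans (sum-cong-≗ λ x → ≡.cong (ind (ι x)) (≡.sym (invol x)))
                                                          (≡.sym (sum-permute (λ x → ind x (ι x)) ι-perm))) ⟩
    c ℕ.+ c                                          ≡⟨ ≡.cong (c ℕ.+_) (ℕ.+-identityʳ c) ⟨
    2 ℕ.* c                                          ≡⟨ ℕ.*-comm 2 c ⟩
    c ℕ.* 2                                          ∎)
    where
    open ≡.≡-Reasoning
    ind : Fin k → Fin k → ℕ
    ind x y with x Fin.<? y
    ... | yes _ = 1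
    ... | no _  = 0
    c = ∑ (λ x → ind x (ι x))
    ι-perm = Perm.permutation ι ι invol invol
    ones : ∀ k → k ≡ ∑ {k} (λ _ → 1)
    ones zero    = ≡.refl
    ones (suc k) = ≡.cong suc (ones k)
    trichotomy : ∀ x → 1 ≡ ind x (ι x) ℕ.+ ind (ι x) x
    trichotomy x with x Fin.<? ι x | ι x Fin.<? x
    ... | yes p | yes q = ⊥-elim (ℕ.<-asym p q)
    ... | yes p | no _  = ≡.refl
    ... | no _  | yes q = ≡.refl
    ... | no ¬p | no ¬q = ⊥-elim (free x (Fin.toℕ-injective (ℕ.≤-antisym (ℕ.≮⇒≥ ¬p) (ℕ.≮⇒≥ ¬q))))

module Interpolation {m : ℕ} (F : FieldOn (suc m)) (2≤m : 2 ≤ m) where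
  private
    k : ℕ
    k = suc m
  open FieldOn F
  open Degree F
  open CommutativeRing ring using (_-_; +-identityˡ; +-identityʳ; zeroˡ; zeroʳ; *-congˡ; *-congʳ; +-congˡ;
        +-congʳ; -‿inverseʳ; *-assoc; *-identityˡ; semiring)
  open IntegerCoefficients ring
  open import Algebra.Properties.Semiring.Exp semiring using (_^_)
  open import Algebra.Properties.Semiring.Sum semiring using
        (sum-cong-≗; *-distribˡ-sum; *-distribʳ-sum; sum-permute; ∑-distrib-+; sum-replicate-zero) renaming (sum to ∑)
  open ≡.≡-Reasoning

  sum-single : ∀ {n} (t : Fin n → Fin k) z → (∀ a → a ≢ z → t a ≡ 0#) → ∑ t ≡ t z
  sum-single {suc n} t Fin.zero h = ≡.trans (+-congˡ
        (≡.trans (sum-cong-≗ (λ a → h (Fin.suc a) λ ())) (sum-replicate-zero n)))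
    (+-identityʳ _)
  sum-single t (Fin.suc z) h = ≡.trans (≡.cong₂ _+_ (h Fin.zero λ ()) (sum-single (t ∘ Fin.suc) z
    (λ a a≢z → h (Fin.suc a) (a≢z ∘ Fin.suc-injective)))) (+-identityˡ _)

  fermat : ∀ {x} → x ≢ 0# → x ^ m ≡ 1#
  fermat {x} x≢0 = let u , u*x≡1 = inverse x x≢0 in begin
    x ^ m            ≡⟨ *-identityˡ _ ⟨
    1# * x ^ m       ≡⟨ *-congʳ u*x≡1 ⟨
    u * x * x ^ m    ≡⟨ *-assoc u x _ ⟩
    u * x ^ k        ≡⟨ *-congˡ (x^k≡x x) ⟩
    u * x            ≡⟨ u*x≡1 ⟩
    1#               ∎

  0^m≡0 : 0# ^ m ≡ 0#
  0^m≡0 = go m (ℕ.≤-trans (s≤s z≤n) 2≤m)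
    where
    go : ∀ m → 1 ≤ m → 0# ^ m ≡ 0#
    go (suc m) _ = zeroˡ _

  third-element : ∃ λ c → c ≢ 0# × c ≢ 1#
  third-element with Fin.any? (λ c → ¬? (c Fin.≟ 0#) ×-dec ¬? (c Fin.≟ 1#))
  ... | yes found = found
  ... | no none   = ⊥-elim (ℕ.<⇒≱ (s≤s 2≤m) (Fin.injective⇒≤ {f = f} f-inj))
    where
    f : Fin k → Fin 2
    f c with c Fin.≟ 0#
    ... | yes _ = Fin.zero
    ... | no _  = Fin.suc Fin.zero
    is-1 : ∀ c → c ≢ 0# → c ≡ 1#
    is-1 c c≢0 with c Fin.≟ 1#
    ... | yes e = e
    ... | no ne = ⊥-elim (none (c , c≢0 , ne))
    f-inj : ∀ {x y} → f x ≡ f y → x ≡ y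
    f-inj {x} {y} e with x Fin.≟ 0# | y Fin.≟ 0#
    ... | yes p | yes q = ≡.trans p (≡.sym q)
    ... | no p  | no q  = ≡.trans (is-1 x p) (≡.sym (is-1 y q))
    f-inj () | yes _ | no _
    f-inj () | no _  | yes _

  *-injective : ∀ {c} → c ≢ 0# → ∀ {x y} → c * x ≡ c * y → x ≡ y
  *-injective {c} c≢0 {x} {y} e with x - y Fin.≟ 0#
  ... | yes z = -≡0⇒≡ z
  ... | no nz = ⊥-elim (*-nonzero c≢0 nz (≡.trans (solve 3 (λ c x y → c :* (x :- y) := c :* x :- c :* y) ≡.refl c x y)
                  (≡.trans (+-congʳ e) (-‿inverseʳ _))))

  -- Multiplication by an element c other than 0 and 1 permutes the field, so the sum S satisfies c
  -- S = S. The existence of c is where k > 2 enters.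
  sum-elements : ∑ (λ a → a) ≡ 0#
  sum-elements with third-element
  ... | c , c≢0 , c≢1 with ∑ (λ a → a) Fin.≟ 0#
  ...   | yes z = z
  ...   | no nz = ⊥-elim (*-nonzero (c≢1 ∘ -≡0⇒≡) nz (begin
      (c - 1#) * S   ≡⟨ solve 2 (λ c s → (c :- con (+ 1)) :* s := c :* s :- s) ≡.refl c S ⟩
      c * S - S      ≡⟨ +-congʳ (*-distribˡ-sum c (λ a → a)) ⟩
      ∑ (c *_) - S ≡⟨ +-congʳ (sum-permute (λ a → a) (injective⇒permutation (c *_) (*-injective c≢0))) ⟨
      S - S          ≡⟨ -‿inverseʳ S ⟩
      0#             ∎))
    where S = ∑ (λ a → a)

  -- By Fermat, 1 - (z - a)^(k - 1) is the indicator of z = a.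
  lagrange : ∀ (π : Fin k → Fin k) z → π z ≡ ∑ (λ a → π a * (1# - (z - a) ^ m))
  lagrange π z = ≡.sym (≡.trans (sum-single _ z off) (begin
    π z * (1# - (z - z) ^ m)   ≡⟨ *-congˡ (+-congˡ (≡.cong -_ (≡.trans (≡.cong (_^ m) (-‿inverseʳ z)) 0^m≡0))) ⟩
    π z * (1# - 0#)            ≡⟨ solve 1 (λ p → p :* (con (+ 1) :- con (+ 0)) := p) ≡.refl (π z) ⟩
    π z                        ∎))
    where
    off : ∀ a → a ≢ z → π a * (1# - (z - a) ^ m) ≡ 0#
    off a a≢z = ≡.trans (*-congˡ (≡.trans (+-congˡ (≡.cong -_ (fermat λ e → a≢z (≡.sym (-≡0⇒≡ e)))))
          (-‿inverseʳ 1#))) (zeroʳ _)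

  sum-deg : ∀ {n D j} {t : Fin j → Point n → Fin k} → (∀ a → Deg D (t a)) → Deg D (λ x → ∑ (λ a → t a x))
  sum-deg {j = zero}  p = zero
  sum-deg {j = suc j} p = add (p Fin.zero) (sum-deg (p ∘ Fin.suc))

  power-deg : ∀ {n} (i : Fin n) j → Deg (suc j) (λ x → x i ^ j)
  power-deg i zero    = const 1#
  power-deg i (suc j) = mulvar i (power-deg i j)

  power-difference : ∀ {n} (i : Fin n) a j → Deg j (λ x → (x i - a) ^ j - x i ^ j)
  power-difference i a zero    = resp (λ x → ≡.sym (-‿inverseʳ 1#)) zero
  power-difference i a (suc j) = resp
    (λ x → solve 4 (λ x a s t → x :* (s :- t) :+ (:- a :* (s :- t) :+ :- a :* t) := (x :- a) :* s :- x :* t) ≡.refl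
             (x i) a ((x i - a) ^ j) (x i ^ j))
    (add (mulvar i (power-difference i a j))
      (add (scale (- a) (deg-≤ (ℕ.n≤1+n j) (power-difference i a j))) (scale (- a) (power-deg i j))))

  -- The coefficient of X^(k−1) in the Lagrange interpolant is −Σ π(a) = −Σ a = 0.
  permutation-deg : ∀ {n} (π : Permutation k k) (i : Fin n) → Deg m (λ x → π ⟨$⟩ʳ x i)
  permutation-deg π i = resp eq (sum-deg {t = t} λ a → scale (π ⟨$⟩ʳ a)
      (add (deg-≤ (ℕ.≤-trans (s≤s z≤n) 2≤m) (const 1#))
           (resp (λ x → solve 1 (λ y → :- con (+ 1) :* y := :- y) ≡.refl _) (scale (- 1#) (power-difference i a m)))))
    where
    t : Fin k → Point _ → Fin k
    -- Removing the leading term from each (X - a)^m changes the total only by X^m Σ π(a), which is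
    -- zero.
    t a x = (π ⟨$⟩ʳ a) * (1# - ((x i - a) ^ m - x i ^ m))
    sum-π : ∑ (π ⟨$⟩ʳ_) ≡ 0#
    sum-π = ≡.trans (≡.sym (sum-permute (λ a → a) π)) sum-elements
    eq : ∀ x → ∑ (λ a → t a x) ≡ π ⟨$⟩ʳ x i
    eq x = begin
      ∑ (λ a → t a x)
        ≡⟨ sum-cong-≗ (λ a → solve 3 (λ p s y → p :* (con (+ 1) :- (s :- y)) := p :* (con (+ 1) :- s) :+ p :* y)
             ≡.refl (π ⟨$⟩ʳ a) ((x i - a) ^ m) (x i ^ m)) ⟩
      ∑ (λ a → (π ⟨$⟩ʳ a) * (1# - (x i - a) ^ m) + (π ⟨$⟩ʳ a) * x i ^ m)
        ≡⟨ ∑-distrib-+ (λ a → (π ⟨$⟩ʳ a) * (1# - (x i - a) ^ m)) (λ a → (π ⟨$⟩ʳ a) * x i ^ m) ⟩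
      ∑ (λ a → (π ⟨$⟩ʳ a) * (1# - (x i - a) ^ m)) + ∑ (λ a → (π ⟨$⟩ʳ a) * x i ^ m)
        ≡⟨ ≡.cong₂ _+_ (≡.sym (lagrange (π ⟨$⟩ʳ_) (x i)))
             (≡.trans (≡.sym (*-distribʳ-sum (x i ^ m) (π ⟨$⟩ʳ_))) (≡.trans (*-congʳ sum-π) (zeroˡ _))) ⟩
      (π ⟨$⟩ʳ x i) + 0#
        ≡⟨ +-identityʳ _ ⟩
      π ⟨$⟩ʳ x i ∎

module Lines {k : ℕ} (F : FieldOn k) (π : Permutation k k) where
  open FieldOn F
  open Degree F
  open CommutativeRing ring using (_-_; zeroˡ; *-congˡ; *-congʳ; +-congʳ; -‿inverseʳ; *-comm; *-assoc;
        *-identityˡ; *-identityʳ)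
  open IntegerCoefficients ring
  open ≡.≡-Reasoning

  private
    f : Fin k → Fin k
    f = π ⟨$⟩ʳ_

  -- A nonzero slope makes the line the graph of a permutation, so that it can label an edge of the
  -- auxiliary multigraph. Secants of the graph of `π` qualify because `π` is injective.
  record Line : Set where
    field
      slope intercept : Fin k
      slope≢0 : slope ≢ 0#
  open Line

  _on_ : Fin k → Line → Set
  x on ℓ = f x ≡ slope ℓ * x + intercept ℓ

  -≢0 : ∀ {x y} → x ≢ y → x - y ≢ 0#
  -≢0 x≢y = x≢y ∘ -≡0⇒≡

  lineThrough : ∀ x α → α ≢ 0# → Line
  lineThrough x α α≢0 = record { slope = α ; intercept = f x - α * x ; slope≢0 = α≢0 }

  on-lineThrough : ∀ x α α≢0 y → f y - f x ≡ α * (y - x) → y on lineThrough x α α≢0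
  on-lineThrough x α α≢0 y e = begin
    f y                         ≡⟨ solve 2 (λ s t → s := (s :- t) :+ t) ≡.refl (f y) (f x) ⟩
    (f y - f x) + f x           ≡⟨ +-congʳ e ⟩
    α * (y - x) + f x           ≡⟨ solve 4 (λ a y x s → a :* (y :- x) :+ s := a :* y :+
          (s :- a :* x)) ≡.refl α y x (f x) ⟩
    α * y + (f x - α * x)       ∎

  self-on : ∀ x α α≢0 → x on lineThrough x α α≢0
  self-on x α α≢0 = on-lineThrough x α α≢0 x
    (solve 3 (λ s a x → s :- s := a :* (x :- x)) ≡.refl (f x) α x)

  secant : ∀ {x y} → x ≢ y → ∃ λ α → α ≢ 0# × f y - f x ≡ α * (y - x)
  secant {x} {y} x≢y = let u , u*d≡1 = inverse (y - x) (-≢0 (x≢y ∘ ≡.sym)) in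
    (f y - f x) * u ,
    *-nonzero (-≢0 (x≢y ∘ ≡.sym ∘ permutation-injective π))
      (λ u≡0 → 1≢0 (≡.trans (≡.sym u*d≡1) (≡.trans (*-congʳ u≡0) (zeroˡ _)))) ,
    ≡.trans (≡.sym (*-identityʳ _)) (≡.trans (*-congˡ (≡.sym u*d≡1)) (≡.sym (*-assoc _ u _)))

  through : ∀ x y → ∃ λ ℓ → x on ℓ × y on ℓ
  through x y with x Fin.≟ y
  ... | yes ≡.refl = lineThrough x 1# 1≢0 , self-on x 1# 1≢0 , self-on x 1# 1≢0
  ... | no x≢y = let α , α≢0 , e = secant x≢y in
    lineThrough x α α≢0 , self-on x α α≢0 , on-lineThrough x α α≢0 y e

  Cover : ℕ → List (Fin k) → Set
  Cover q l = ∃ λ (L : Fin q → Line) → ∀ {x} → x ∈ l → ∃ λ j → x on L j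

  extend : ∀ {q l l′} ℓ → (∀ {x} → x ∈ l′ → x on ℓ ⊎ x ∈ l) → Cover q l → Cover (suc q) l′
  extend ℓ h (L , c) = ℓ VecF.∷ L , λ x∈ → case (h x∈)
    where
    case : ∀ {x} → x on ℓ ⊎ x ∈ _ → ∃ λ j → x on (ℓ VecF.∷ L) j
    case (inj₁ on) = Fin.zero , on
    case (inj₂ x∈) = let j , on = c x∈ in Fin.suc j , on

  cover-pairs : ∀ q l → length l ≤ q ℕ.* 2 → Cover q l
  cover-pairs zero    []          _ = (λ ()) , λ ()
  -- Once the points run out, arbitrary lines fill up the required number.
  cover-pairs (suc q) []          _ = extend (lineThrough 0# 1# 1≢0) (λ ()) (cover-pairs q [] z≤n)
  cover-pairs (suc q) (x ∷ [])    _ = extend (lineThrough x 1# 1≢0)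
    (λ { (here ≡.refl) → inj₁ (self-on x 1# 1≢0) ; (there ()) }) (cover-pairs q [] z≤n)
  cover-pairs (suc q) (x ∷ y ∷ l) (s≤s (s≤s len)) = let ℓ , x-on , y-on = through x y in
    extend ℓ (λ { (here ≡.refl) → inj₁ x-on ; (there (here ≡.refl)) → inj₁ y-on ; (there (there z∈)) → inj₂ z∈ })
      (cover-pairs q l len)

  -- Equality of the slopes of the secants from x to y and from x to z, cross-multiplied so that it
  -- is decidable without inverses.
  Collinear : Fin k → Fin k → Fin k → Set
  Collinear x y z = x ≢ y × x ≢ z × y ≢ z × (f y - f x) * (z - x) ≡ (f z - f x) * (y - x)

  collinear? : Dec (∃ λ x → ∃₂ (Collinear x))
  collinear? = Fin.any? λ x → Fin.any? λ y → Fin.any? λ z →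
    ¬? (x Fin.≟ y) ×-dec ¬? (x Fin.≟ z) ×-dec ¬? (y Fin.≟ z) ×-dec ((f y - f x) * (z - x) Fin.≟ (f z - f x) * (y - x))

  cancel : ∀ {a b c} → c ≢ 0# → a * c ≡ b * c → a ≡ b
  cancel {a} {b} {c} c≢0 e with a - b Fin.≟ 0#
  ... | yes z = -≡0⇒≡ z
  ... | no nz = ⊥-elim (*-nonzero nz c≢0 (≡.trans (solve 3 (λ a b c → (a :- b) :* c := a :* c :- b :* c) ≡.refl a b c)
                  (≡.trans (+-congʳ e) (-‿inverseʳ _))))

  collinear⇒line : ∀ {x y z} → Collinear x y z → ∃ λ ℓ → x on ℓ × y on ℓ × z on ℓ
  collinear⇒line {x} {y} {z} (x≢y , x≢z , y≢z , e) = let α , α≢0 , s = secant x≢y in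
    lineThrough x α α≢0 , self-on x α α≢0 , on-lineThrough x α α≢0 y s ,
    on-lineThrough x α α≢0 z (cancel (-≢0 (x≢y ∘ ≡.sym)) (begin
      (f z - f x) * (y - x)    ≡⟨ e ⟨
      (f y - f x) * (z - x)    ≡⟨ *-congʳ s ⟩
      α * (y - x) * (z - x)    ≡⟨ solve 3 (λ a b c → a :* b :* c := a :* c :* b) ≡.refl α (y - x) (z - x) ⟩
      α * (z - x) * (y - x)    ∎))

  -- If no three points of the graph are collinear then, for each x, the k − 1 secants through x have all
  -- the k − 1 nonzero slopes; the partner of x on its secant of slope 1 gives a fixed-point-free involution.
  noCollinear⇒even : ¬ (∃ λ x → ∃₂ (Collinear x)) → 2 ℕ∣.∣ k
  noCollinear⇒even none = involution⇒even ι ι-involutive ι-free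
    where
    slopeAt : ∀ x y → Dec (x ≡ y) → Fin k
    -- No secant has slope 0, so this value on the diagonal completes the slopes at x to an
    -- injective self-map of `Fin k`, which is then onto and attains slope 1.
    slopeAt x y (yes _)   = 0#
    slopeAt x y (no x≢y)  = proj₁ (secant x≢y)

    slopeAt-injective : ∀ x y z (dy : Dec (x ≡ y)) (dz : Dec (x ≡ z)) → slopeAt x y dy ≡ slopeAt x z dz → y ≡ z
    slopeAt-injective x y z (yes p) (yes q) e = ≡.trans (≡.sym p) q
    slopeAt-injective x y z (yes p) (no q)  e = ⊥-elim (proj₁ (proj₂ (secant q)) (≡.sym e))
    slopeAt-injective x y z (no p)  (yes q) e = ⊥-elim (proj₁ (proj₂ (secant p)) e)
    slopeAt-injective x y z (no p)  (no q)  e with y Fin.≟ z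
    ... | yes y≡z = y≡z
    ... | no y≢z = let α , _ , s = secant p ; β , _ , t = secant q in
      ⊥-elim (none (x , y , z , p , q , y≢z , (begin
        (f y - f x) * (z - x)   ≡⟨ *-congʳ s ⟩
        α * (y - x) * (z - x)   ≡⟨ *-congʳ (*-congʳ e) ⟩
        β * (y - x) * (z - x)   ≡⟨ solve 3 (λ a b c → a :* b :* c := a :* c :* b) ≡.refl β (y - x) (z - x) ⟩
        β * (z - x) * (y - x)   ≡⟨ *-congʳ t ⟨
        (f z - f x) * (y - x)   ∎)))

    partner : ∀ x → ∃ λ y → x ≢ y × f y - f x ≡ y - x
    partner x with injective⇒surjective (λ y → slopeAt x y (x Fin.≟ y))
                     (λ {y} {z} → slopeAt-injective x y z (x Fin.≟ y) (x Fin.≟ z)) 1#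
    ... | y , e with x Fin.≟ y
    ...   | yes _  = ⊥-elim (1≢0 (≡.sym e))
    ...   | no x≢y = y , x≢y , ≡.trans (proj₂ (proj₂ (secant x≢y))) (≡.trans (*-congʳ e) (*-identityˡ _))

    ι : Fin k → Fin k
    ι x = proj₁ (partner x)

    ι-free : ∀ x → ι x ≢ x
    ι-free x e = proj₁ (proj₂ (partner x)) (≡.sym e)

    ι-involutive : ∀ x → ι (ι x) ≡ x
    ι-involutive x with ι (ι x) Fin.≟ x
    ... | yes e = e
    -- If the partner z of y = `ι x` differed from x, two secants of slope 1 meeting at y would put
    -- x, y, z on one line.
    ... | no ne = ⊥-elim (none (x , y , z , proj₁ (proj₂ (partner x)) , ne ∘ ≡.sym , proj₁ (proj₂ (partner y)) , (begin
        (f y - f x) * (z - x)   ≡⟨ *-congʳ s ⟩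
        (y - x) * (z - x)       ≡⟨ *-comm _ _ ⟩
        (z - x) * (y - x)       ≡⟨ *-congʳ (solve 3 (λ x y z → z :- x := (z :- y) :+ (y :- x)) ≡.refl x y z) ⟩
        ((z - y) + (y - x)) * (y - x)             ≡⟨ *-congʳ (≡.cong₂ _+_ t s) ⟨
        ((f z - f y) + (f y - f x)) * (y - x)     ≡⟨ *-congʳ
              (solve 3 (λ x y z → (z :- y) :+ (y :- x) := z :- x) ≡.refl (f x) (f y) (f z)) ⟩
        (f z - f x) * (y - x)   ∎)))
      where
      y = ι x
      z = ι y
      s = proj₂ (proj₂ (partner x))
      t = proj₂ (proj₂ (partner y))

  cover : ∀ q → (k ≡ q ℕ.* 2 ⊎ k ≡ suc (q ℕ.* 2)) → ∃ λ (L : Fin q → Line) → ∀ x → ∃ λ j → x on L j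
  cover q parity = let L , c = cover-all q parity in L , λ x → c (Mem.∈-allFin x)
    where
    size : length (allFin k) ≡ k
    size = List.length-tabulate id

    without : Fin k → List (Fin k) → List (Fin k)
    without x = filter (λ y → ¬? (y Fin.≟ x))

    without-< : ∀ {x l} → x ∈ l → length (without x l) < length l
    without-< {x} {l} x∈ = List.filter-notAll (λ y → ¬? (y Fin.≟ x)) l (lose x∈ λ h → h ≡.refl)

    in-without : ∀ {x y l} → y ≢ x → y ∈ l → y ∈ without x l
    in-without {x} y≢x y∈ = Mem.∈-filter⁺ (λ y → ¬? (y Fin.≟ x)) y∈ y≢x

    cover-all : ∀ q → (k ≡ q ℕ.* 2 ⊎ k ≡ suc (q ℕ.* 2)) → Cover q (allFin k)
    cover-all q (inj₁ even) = cover-pairs q (allFin k) (ℕ.≤-reflexive (≡.trans size even))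
    cover-all q (inj₂ odd) with collinear?
    ... | no none = ⊥-elim (absurd (ℕ∣.∣⇒≤ (ℕ∣.∣m+n∣m⇒∣n {2} {q ℕ.* 2} {1}
            (≡.subst (2 ℕ∣.∣_) (≡.trans odd (ℕ.+-comm 1 (q ℕ.* 2))) (noCollinear⇒even none)) (ℕ∣.n∣m*n q))))
      where
      absurd : ¬ 2 ≤ 1
      absurd (s≤s ())
    cover-all zero    (inj₂ odd) | yes (x , y , _ , x≢y , _) = ⊥-elim (x≢y (subsingleton odd x y))
      where
      subsingleton : ∀ {k} → k ≡ 1 → (x y : Fin k) → x ≡ y
      subsingleton ≡.refl Fin.zero Fin.zero = ≡.refl
    cover-all (suc q) (inj₂ odd) | yes (x , y , z , xyz@(x≢y , x≢z , y≢z , _)) =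
      let ℓ , x-on , y-on , z-on = collinear⇒line xyz in
      extend {l = rest} ℓ (λ {w} _ → split ℓ x-on y-on z-on w) (cover-pairs q rest small)
      where
      rest = without z (without y (without x (allFin k)))
      split : ∀ ℓ → x on ℓ → y on ℓ → z on ℓ → ∀ w → w on ℓ ⊎ w ∈ rest
      split ℓ x-on y-on z-on w with w Fin.≟ x | w Fin.≟ y | w Fin.≟ z
      ... | yes ≡.refl | _ | _ = inj₁ x-on
      ... | no _ | yes ≡.refl | _ = inj₁ y-on
      ... | no _ | no _ | yes ≡.refl = inj₁ z-on
      ... | no p | no q | no r = inj₂ (in-without r (in-without q (in-without p (Mem.∈-allFin w))))
      small : length rest ≤ q ℕ.* 2
      -- Of the 2(q + 1) + 1 points three lie on the first line, leaving 2q for the remaining q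
      -- lines.
      small = ℕ.s≤s⁻¹ (ℕ.s≤s⁻¹ (ℕ.s≤s⁻¹ (begin′
        suc (suc (suc (length rest)))            ≤⟨ s≤s
              (s≤s (without-< (in-without (y≢z ∘ ≡.sym) (in-without (x≢z ∘ ≡.sym) (Mem.∈-allFin z))))) ⟩
        suc (suc (length (without y (without x (allFin k))))) ≤⟨ s≤s
              (without-< (in-without (x≢y ∘ ≡.sym) (Mem.∈-allFin y))) ⟩
        suc (length (without x (allFin k)))      ≤⟨ without-< (Mem.∈-allFin x) ⟩
        length (allFin k)                        ≤⟨ ℕ.≤-reflexive (≡.trans size odd) ⟩
        suc (suc q ℕ.* 2)                        ∎′)))
        where
        open ℕ.≤-Reasoning renaming (begin_ to begin′_; _∎ to _∎′)

open import Data.Bool using (Bool; true; false; if_then_else_; _∧_) renaming (T to IsTrue)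
import Data.Bool.Properties as Bool
open import Data.List using (lookup)
import Data.List.Membership.DecPropositional as DecMem
import Data.List.Relation.Unary.All.Properties as All
open import Data.List.Relation.Unary.Any using (index)
open import Data.List.Relation.Unary.Any.Properties using (lookup-index)
open import Data.Nat using (_+_; _*_; _^_)
open import Data.Nat.DivMod using (_/_; _%_; m≡m%n+[m/n]*n; m%n<n)
open import Data.Nat.Solver using (module +-*-Solver)
open import Defs
open import Relation.Binary using (tri<; tri≈; tri>)

-- Spanning trees and labelings

module _ {A : Set} where

  sum-map-+ : ∀ (f g : A → ℕ) l → sum (map (λ x → f x ℕ.+ g x) l) ≡ sum (map f l) ℕ.+ sum (map g l)
  sum-map-+ f g []      = ≡.refl
  sum-map-+ f g (x ∷ l) rewrite sum-map-+ f g l = ℕ-interchange (f x) (g x) (sum (map f l)) (sum (map g l))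
    where
    open import Algebra.Properties.CommutativeSemigroup ℕ.+-commutativeSemigroup using () renaming
          (interchange to ℕ-interchange)

  sum-map-* : ∀ c (f : A → ℕ) l → sum (map (λ x → c ℕ.* f x) l) ≡ c ℕ.* sum (map f l)
  sum-map-* c f []      = ≡.sym (ℕ.*-zeroʳ c)
  sum-map-* c f (x ∷ l) rewrite sum-map-* c f l = ≡.sym (ℕ.*-distribˡ-+ c (f x) _)

module _ {n : ℕ} where

  pairs : List (Fin n × Fin n)
  pairs = concatMap (λ u → map (u ,_) (allFin n)) (allFin n)

  ∈-pairs : ∀ u v → (u , v) ∈ pairs
  ∈-pairs u v = Mem.∈-concatMap⁺ (λ u → map (u ,_) (allFin n))
    (lose (Mem.∈-allFin u) (Mem.∈-map⁺ (u ,_) (Mem.∈-allFin v)))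

  _<?ᵇ_ : Fin n → Fin n → Bool
  u <?ᵇ v = toℕ u ℕ.<ᵇ toℕ v

  increasing : (Fin n → Fin n → ℕ) → Fin n × Fin n → ℕ
  increasing h (u , v) = if u <?ᵇ v then h u v else 0

  edgeSum : (Fin n → Fin n → ℕ) → ℕ
  edgeSum h = sum (map (increasing h) pairs)

  edgeCount≡edgeSum : ∀ G → edgeCount G ≡ edgeSum (mult G)
  edgeCount≡edgeSum G = ≡.cong sum (≡.sym (≡.trans
    (List.map-concatMap (increasing (mult G)) (λ u → map (u ,_) (allFin n)) (allFin n))
    (List.concatMap-cong (λ u → ≡.sym (List.map-∘ (allFin n))) (allFin n))))

  edgeSum-cong : ∀ {f g} → (∀ u v → f u v ≡ g u v) → edgeSum f ≡ edgeSum g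
  edgeSum-cong e = ≡.cong sum (List.map-cong (λ (u , v) → ≡.cong (if u <?ᵇ v then_else 0) (e u v)) pairs)

  edgeSum-+ : ∀ f g → edgeSum (λ u v → f u v ℕ.+ g u v) ≡ edgeSum f ℕ.+ edgeSum g
  edgeSum-+ f g = ≡.trans (≡.cong sum (List.map-cong pointwise pairs)) (sum-map-+ (increasing f) (increasing g) pairs)
    where
    pointwise : ∀ p → increasing (λ u v → f u v ℕ.+ g u v) p ≡ increasing f p ℕ.+ increasing g p
    pointwise (u , v) with u <?ᵇ v
    ... | true  = ≡.refl
    ... | false = ≡.refl

  edgeSum-* : ∀ c f → edgeSum (λ u v → c ℕ.* f u v) ≡ c ℕ.* edgeSum f
  edgeSum-* c f = ≡.trans (≡.cong sum (List.map-cong pointwise pairs)) (sum-map-* c (increasing f) pairs)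
    where
    pointwise : ∀ p → increasing (λ u v → c ℕ.* f u v) p ≡ c ℕ.* increasing f p
    pointwise (u , v) with u <?ᵇ v
    ... | true  = ≡.refl
    ... | false = ≡.sym (ℕ.*-zeroʳ c)

  edgeSum-≥ : ∀ h {u v} → toℕ u < toℕ v → h u v ≤ edgeSum h
  edgeSum-≥ h {u} {v} u<v = ℕ.≤-trans (ℕ.≤-reflexive (≡.sym (lem (u <?ᵇ v) (ℕ.<⇒<ᵇ u<v))))
    (∈⇒≤sum (increasing h) (∈-pairs u v))
    where
    lem : ∀ b → IsTrue b → (if b then h u v else 0) ≡ h u v
    lem true _ = ≡.refl

  δ : Fin n → Fin n → ℕ
  δ a u with a Fin.≟ u
  ... | yes _ = 1
  ... | no _  = 0

  δ-refl : ∀ a → δ a a ≡ 1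
  δ-refl a with a Fin.≟ a
  ... | yes _ = ≡.refl
  ... | no ne = ⊥-elim (ne ≡.refl)

  edgeIndicator : Fin n → Fin n → Fin n → Fin n → ℕ
  edgeIndicator a b u v = δ a u ℕ.* δ b v ℕ.+ δ b u ℕ.* δ a v

  edgeIndicator-sym : ∀ a b u v → edgeIndicator a b u v ≡ edgeIndicator a b v u
  edgeIndicator-sym a b u v = ≡.trans (ℕ.+-comm (δ a u ℕ.* δ b v) _)
    (≡.cong₂ ℕ._+_ (ℕ.*-comm (δ b u) _) (ℕ.*-comm (δ a u) _))

  edgeIndicator-refl : ∀ a b → 1 ≤ edgeIndicator a b a b
  edgeIndicator-refl a b rewrite δ-refl a | δ-refl b = s≤s z≤n

  edgeIndicator-cases : ∀ a b u v → a ≢ b →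
    edgeIndicator a b u v ≡ 0 ⊎
    (edgeIndicator a b u v ≡ 1 × ((u ≡ a × v ≡ b) ⊎ (u ≡ b × v ≡ a)))
  edgeIndicator-cases a b u v a≢b with a Fin.≟ u | b Fin.≟ v | b Fin.≟ u | a Fin.≟ v
  ... | yes p | _     | yes q | _     = ⊥-elim (a≢b (≡.trans p (≡.sym q)))
  ... | _     | yes p | _     | yes q = ⊥-elim (a≢b (≡.trans q (≡.sym p)))
  ... | yes p | yes q | no _  | no _  = inj₂ (≡.refl , inj₁ (≡.sym p , ≡.sym q))
  ... | yes p | no _  | no _  | yes _ = inj₁ ≡.refl
  ... | yes p | no _  | no _  | no _  = inj₁ ≡.refl
  ... | no _  | yes _ | yes _ | no _  = inj₁ ≡.refl
  ... | no _  | yes _ | no _  | no _  = inj₁ ≡.refl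
  ... | no _  | no _  | yes p | yes q = inj₂ (≡.refl , inj₂ (≡.sym p , ≡.sym q))
  ... | no _  | no _  | yes p | no _  = inj₁ ≡.refl
  ... | no _  | no _  | no _  | yes _ = inj₁ ≡.refl
  ... | no _  | no _  | no _  | no _  = inj₁ ≡.refl

  edgeSum-edgeIndicator : ∀ {a b} → a ≢ b → 1 ≤ edgeSum (edgeIndicator a b)
  edgeSum-edgeIndicator {a} {b} a≢b with ℕ.<-cmp (toℕ a) (toℕ b)
  ... | tri< a<b _ _ = ℕ.≤-trans (edgeIndicator-refl a b) (edgeSum-≥ (edgeIndicator a b) a<b)
  ... | tri≈ _ a≡b _ = ⊥-elim (a≢b (Fin.toℕ-injective a≡b))
  ... | tri> _ _ b<a = ℕ.≤-trans (edgeIndicator-refl a b) (ℕ.≤-trans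
          (ℕ.≤-reflexive (edgeIndicator-sym a b a b)) (edgeSum-≥ (edgeIndicator a b) b<a))

-- A subtree of T grown one vertex at a time: its vertices and its edges (old vertex , new vertex).
data Subtree {n} (T : Multigraph n) : List (Fin n) → List (Fin n × Fin n) → Set where
  root : ∀ r → Subtree T (r ∷ []) []
  grow : ∀ {vs es a b} → Subtree T vs es → a ∈ vs → b ∉ vs → Adj T a b →
    Subtree T (b ∷ vs) ((a , b) ∷ es)

data Path {n} (T : Multigraph n) : Fin n → Fin n → List (Fin n) → Set where
  [_]  : ∀ u → Path T u u (u ∷ [])
  _∷⟨_⟩_ : ∀ {u w v l} → Adj T u w → u ∉ l → Path T w v l → Path T u v (u ∷ l)

module _ {n} {T : Multigraph n} where

  adj-sym : ∀ {u v} → Adj T u v → Adj T v u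
  adj-sym {u} {v} = ≡.subst (1 ≤_) (symm T u v)

  adj-irrefl : ∀ {u v} → Adj T u v → u ≢ v
  adj-irrefl {u} adj ≡.refl with () ← ≡.subst (1 ≤_) (loopless T u) adj

  absorb : ∀ {vs es a v} → Subtree T vs es → a ∈ vs → Walk T a v →
    ∃₂ λ vs′ es′ → Subtree T vs′ es′ × (∀ {w} → w ∈ vs → w ∈ vs′) × v ∈ vs′
  absorb t a∈ here = _ , _ , t , id , a∈
  absorb {vs} t a∈ (step {v = b} adj walk) with DecMem._∈?_ Fin._≟_ b vs
  ... | yes b∈ = absorb t b∈ walk
  ... | no b∉  = let vs′ , es′ , t′ , ⊆ , v∈ = absorb (grow t a∈ b∉ adj) (here ≡.refl) walk in
                 vs′ , es′ , t′ , ⊆ ∘ there , v∈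

  spanning : Connected T → Fin n → ∃₂ λ vs es → Subtree T vs es × ∀ v → v ∈ vs
  spanning connected r = let vs , es , t , _ , h = go (allFin n) in vs , es , t , λ v → h (Mem.∈-allFin v)
    where
    go : ∀ l → ∃₂ λ vs es → Subtree T vs es × r ∈ vs × ∀ {v} → v ∈ l → v ∈ vs
    go []      = _ , _ , root r , here ≡.refl , λ ()
    go (v ∷ l) = let vs , es , t , r∈ , h = go l ; vs′ , es′ , t′ , ⊆ , v∈ = absorb t r∈ (connected r v) in
      vs′ , es′ , t′ , ⊆ r∈ , λ { (here ≡.refl) → v∈ ; (there w∈) → ⊆ (h w∈) }

  edges : List (Fin n × Fin n) → Fin n → Fin n → ℕ
  edges []             u v = 0
  edges ((a , b) ∷ es) u v = edgeIndicator a b u v ℕ.+ edges es u v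

  edges-outside : ∀ {vs es u v} → Subtree T vs es → u ∉ vs ⊎ v ∉ vs → edges es u v ≡ 0
  edges-outside (root r) _ = ≡.refl
  edges-outside {u = u} {v} (grow {a = a} {b} t a∈ b∉ adj) out
    with edgeIndicator-cases a b u v (adj-irrefl adj)
  ... | inj₁ z rewrite z = edges-outside t (out′ out)
    where
    out′ : u ∉ b ∷ _ ⊎ v ∉ b ∷ _ → u ∉ _ ⊎ v ∉ _
    out′ (inj₁ x) = inj₁ (x ∘ there)
    out′ (inj₂ x) = inj₂ (x ∘ there)
  edges-outside (grow t a∈ b∉ adj) (inj₁ u∉) | inj₂ (_ , inj₁ (≡.refl , ≡.refl)) = ⊥-elim (u∉ (there a∈))
  edges-outside (grow t a∈ b∉ adj) (inj₁ u∉) | inj₂ (_ , inj₂ (≡.refl , ≡.refl)) = ⊥-elim (u∉ (here ≡.refl))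
  edges-outside (grow t a∈ b∉ adj) (inj₂ v∉) | inj₂ (_ , inj₁ (≡.refl , ≡.refl)) = ⊥-elim (v∉ (here ≡.refl))
  edges-outside (grow t a∈ b∉ adj) (inj₂ v∉) | inj₂ (_ , inj₂ (≡.refl , ≡.refl)) = ⊥-elim (v∉ (there a∈))

  endpoints-old : ∀ {vs es b u v} → Subtree T vs es → b ∉ vs → 1 ≤ edges es u v → u ≢ b × v ≢ b
  endpoints-old {u = u} {v} t b∉ e =
    (λ { ≡.refl → ℕ.<⇒≢ e (≡.sym (edges-outside {u = u} {v} t (inj₁ b∉))) }) ,
    (λ { ≡.refl → ℕ.<⇒≢ e (≡.sym (edges-outside {u = u} {v} t (inj₂ b∉))) })

  -- Each new edge has an endpoint outside the subtree grown so far, so no edge is recorded twice.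
  edges-cases : ∀ {vs es} → Subtree T vs es → ∀ u v → edges es u v ≡ 0 ⊎ (edges es u v ≡ 1 × Adj T u v)
  edges-cases (root r) u v = inj₁ ≡.refl
  edges-cases (grow {a = a} {b} t a∈ b∉ adj) u v with edgeIndicator-cases a b u v (adj-irrefl adj)
  ... | inj₁ z rewrite z = edges-cases t u v
  ... | inj₂ (o , inj₁ (≡.refl , ≡.refl)) rewrite o | edges-outside {u = u} {v} t (inj₂ b∉) = inj₂ (≡.refl , adj)
  ... | inj₂ (o , inj₂ (≡.refl , ≡.refl)) rewrite o | edges-outside {u = u} {v} t (inj₁ b∉) = inj₂ (≡.refl , adj-sym adj)

  edges⇒adj : ∀ {vs es} → Subtree T vs es → ∀ {u v} → 1 ≤ edges es u v → Adj T u v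
  edges⇒adj tree {u} {v} h with edges-cases tree u v
  ... | inj₁ z         = ⊥-elim (ℕ.<⇒≢ h (≡.sym z))
  ... | inj₂ (_ , adj) = adj

  edgeSum-edges : ∀ {vs es} → Subtree T vs es → length vs ≤ suc (edgeSum (edges es))
  edgeSum-edges (root r) = s≤s z≤n
  edgeSum-edges (grow {es = es} {a} {b} t a∈ b∉ adj) rewrite edgeSum-+ (edgeIndicator a b) (edges es) =
    s≤s (ℕ.≤-trans (edgeSum-edges t) (ℕ.+-monoˡ-≤ (edgeSum (edges es)) (edgeSum-edgeIndicator (adj-irrefl adj))))

  snoc : ∀ {u v b l} → Path T u v l → Adj T v b → b ∉ l → Path T u b (l ++ b ∷ [])
  snoc [ u ] adj b∉ = adj ∷⟨ (λ { (here e) → b∉ (here (≡.sym e)) }) ⟩ [ _ ]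
  snoc (_∷⟨_⟩_ {u} {l = l} e u∉ p) adj b∉ = e ∷⟨ u∉′ ⟩ snoc p adj (b∉ ∘ there)
    where
    u∉′ : u ∉ l ++ _ ∷ []
    u∉′ u∈ with Mem.∈-++⁻ l u∈
    ... | inj₁ u∈l        = u∉ u∈l
    ... | inj₂ (here e′)  = b∉ (here (≡.sym e′))

  path : ∀ {vs es u v} → Subtree T vs es → u ∈ vs → v ∈ vs → ∃ λ l → Path T u v l × All (_∈ vs) l
  path (root r) (here ≡.refl) (here ≡.refl) = _ , [ r ] , here ≡.refl ∷ []
  path (grow t a∈ b∉ adj) (here ≡.refl) (here ≡.refl) = _ , [ _ ] , here ≡.refl ∷ []
  path (grow t a∈ b∉ adj) (here ≡.refl) (there v∈) = let l , p , l⊆ = path t a∈ v∈ in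
    _ , adj-sym adj ∷⟨ b∉ ∘ All.lookup l⊆ ⟩ p , here ≡.refl ∷ All.map there l⊆
  path (grow t a∈ b∉ adj) (there u∈) (here ≡.refl) = let l , p , l⊆ = path t u∈ a∈ in
    _ , snoc p adj (b∉ ∘ All.lookup l⊆) , All.++⁺ (All.map there l⊆) (here ≡.refl ∷ [])
  path (grow t a∈ b∉ adj) (there u∈) (there v∈) = let l , p , l⊆ = path t u∈ v∈ in l , p , All.map there l⊆

  path-lookup-injective : ∀ {u v l} → Path T u v l → ∀ i j → lookup l i ≡ lookup l j → i ≡ j
  path-lookup-injective [ u ] Fin.zero Fin.zero e = ≡.refl
  path-lookup-injective (_ ∷⟨ u∉ ⟩ p) Fin.zero    Fin.zero    e = ≡.refl
  path-lookup-injective (_ ∷⟨ u∉ ⟩ p) Fin.zero    (Fin.suc j) e = ⊥-elim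
        (u∉ (≡.subst (_∈ _) (≡.sym e) (Mem.∈-lookup j)))
  path-lookup-injective (_ ∷⟨ u∉ ⟩ p) (Fin.suc i) Fin.zero    e = ⊥-elim (u∉ (≡.subst (_∈ _) e (Mem.∈-lookup i)))
  path-lookup-injective (_ ∷⟨ u∉ ⟩ p) (Fin.suc i) (Fin.suc j) e = ≡.cong Fin.suc (path-lookup-injective p i j e)

  path-adjacent : ∀ {u v x l} → Path T u v (x ∷ l) → ∀ i → Adj T (lookup (x ∷ l) (inject₁ i))
        (lookup (x ∷ l) (Fin.suc i))
  path-adjacent (adj ∷⟨ _ ⟩ [ _ ])               Fin.zero    = adj
  path-adjacent (adj ∷⟨ _ ⟩ (_ ∷⟨ _ ⟩ _))        Fin.zero    = adj
  path-adjacent (_ ∷⟨ _ ⟩ p@(_ ∷⟨ _ ⟩ _))        (Fin.suc i) = path-adjacent p i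

  path-last : ∀ {u v x l} → Path T u v (x ∷ l) → lookup (x ∷ l) (fromℕ (length l)) ≡ v
  path-last [ _ ]                       = ≡.refl
  path-last (_ ∷⟨ _ ⟩ [ _ ])            = ≡.refl
  path-last (_ ∷⟨ _ ⟩ p@(_ ∷⟨ _ ⟩ _))   = path-last p

  path-cycle : ∀ {u v x y z l} → Path T u v (x ∷ y ∷ z ∷ l) → Adj T v u → HasCycle T
  path-cycle {x = x} {y} {z} {l} p adj = length l , lookup (x ∷ y ∷ z ∷ l) , path-lookup-injective p _ _ ,
    path-adjacent p , ≡.subst₂ (Adj T) (≡.sym (path-last p)) (path-head p) adj
    where
    path-head : ∀ {u v x l} → Path T u v (x ∷ l) → u ≡ x
    path-head [ _ ]        = ≡.refl
    path-head (_ ∷⟨ _ ⟩ _) = ≡.refl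

  -- A second neighbour v of the new vertex b inside the subtree would close a cycle: b, then the
  -- path from a to v, which has at least two vertices. The lemma guarantees in (i) that an edge
  -- treated as off-tree is one that G′ really multiplies.
  edges-complete : ∀ {vs es} → ¬ HasCycle T → Subtree T vs es →
    ∀ {u v} → u ∈ vs → v ∈ vs → Adj T u v → 1 ≤ edges es u v
  edges-complete acyclic (root r) (here ≡.refl) (here ≡.refl) adj = ⊥-elim (adj-irrefl adj ≡.refl)
  edges-complete acyclic (grow t a∈ b∉ _) (here ≡.refl) (here ≡.refl) adj = ⊥-elim (adj-irrefl adj ≡.refl)
  edges-complete {es = _ ∷ es} acyclic (grow {a = a} t a∈ b∉ ab) {u} {v} (here ≡.refl) (there v∈) adj =
        new t a∈ b∉ ab v∈ adj
    where
    new : ∀ {vs es a b v} → Subtree T vs es → a ∈ vs → b ∉ vs → Adj T a b → v ∈ vs → Adj T b v →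
      1 ≤ edges ((a , b) ∷ es) b v
    new {es = es} {a} {b} {v} t a∈ b∉ ab v∈ bv with v Fin.≟ a
    ... | yes ≡.refl = ℕ.≤-trans (≡.subst (1 ≤_) (edgeIndicator-sym v b v b) (edgeIndicator-refl v b)) (ℕ.m≤m+n _ _)
    ... | no v≢a with path t a∈ v∈
    ...   | _ , [ _ ] , _ = ⊥-elim (v≢a ≡.refl)
    ...   | _ , p@(_ ∷⟨ _ ⟩ [ _ ]) , l⊆ =
              ⊥-elim (acyclic (path-cycle (adj-sym ab ∷⟨ b∉ ∘ All.lookup l⊆ ⟩ p) (adj-sym bv)))
    ...   | _ , p@(_ ∷⟨ _ ⟩ (_ ∷⟨ _ ⟩ _)) , l⊆ =
              ⊥-elim (acyclic (path-cycle (adj-sym ab ∷⟨ b∉ ∘ All.lookup l⊆ ⟩ p) (adj-sym bv)))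
  edges-complete acyclic tree@(grow {es = es} {a} {b} t a∈ b∉ ab) {u} {v} (there u∈) (here ≡.refl) adj =
    ≡.subst (1 ≤_) (edges-sym ((a , b) ∷ es) v u) (edges-complete acyclic tree (here ≡.refl) (there u∈) (adj-sym adj))
    where
    edges-sym : ∀ es u v → edges es u v ≡ edges es v u
    edges-sym []             u v = ≡.refl
    edges-sym ((a , b) ∷ es) u v = ≡.cong₂ ℕ._+_ (edgeIndicator-sym a b u v) (edges-sym es u v)
  edges-complete acyclic (grow {a = a} {b} t a∈ b∉ ab) {u} {v} (there u∈) (there v∈) adj =
    ℕ.≤-trans (edges-complete acyclic t u∈ v∈ adj) (ℕ.m≤n+m _ (edgeIndicator a b u v))

length-≥ : ∀ {n} {vs : List (Fin n)} → (∀ v → v ∈ vs) → n ≤ length vs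
length-≥ {vs = vs} all = Fin.injective⇒≤ {f = λ v → index (all v)} λ {u} {v} e →
    ≡.trans (lookup-index (all u)) (≡.trans (≡.cong (lookup vs) e) (≡.sym (lookup-index (all v))))

module _ {n k} {G : Multigraph n} (L : Labeling G k) where

  private
    first : ∀ m → (Fin m → Permutation k k) → Permutation k k
    first zero    σ = Perm.id
    first (suc m) σ = σ Fin.zero

    first-unique : ∀ m (σ : Fin m → Permutation k k) → m ≤ 1 → ∀ i → σ i ≡ first m σ
    first-unique (suc zero) σ _ Fin.zero = ≡.refl
    first-unique (suc (suc m)) σ (s≤s ()) _

    arc : Fin n → Fin n → Permutation k k
    arc u v = first (mult G u v) (σ L u v)

  -- Forgets the orientation: the permutation is always read from u to v, inverted when the arc runs
  -- from v to u. In a simple graph the first coordinate of an arc is its only one.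
  constraint : Fin n → Fin n → Permutation k k
  constraint u v = if orient L u v then arc u v else Perm.flip (arc v u)

  constraint-flip : ∀ {u v} → Adj G u v → ∀ c → constraint v u ⟨$⟩ʳ (constraint u v ⟨$⟩ʳ c) ≡ c
  constraint-flip {u} {v} adj c with orientE L u v adj
  ... | inj₁ (o , o′) rewrite o | o′ = Perm.inverseˡ (arc u v)
  ... | inj₂ (o , o′) rewrite o | o′ = Perm.inverseʳ (arc v u)

  Satisfies : (Fin n → Fin k) → Set
  Satisfies κ = ∀ u v → toℕ u < toℕ v → Adj G u v → constraint u v ⟨$⟩ʳ κ u ≢ κ v

  private
    orient⇒adj : ∀ u v → IsTrue (orient L u v) → Adj G u v
    orient⇒adj u v o with mult G u v in eq
    ... | zero  = ⊥-elim (≡.subst IsTrue (orientN L u v eq) o)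
    ... | suc _ = s≤s z≤n

  satisfies⇒proper : IsSimple G → ∀ κ → Satisfies κ → Proper L κ
  satisfies⇒proper simple κ sat u v o i e
    rewrite first-unique (mult G u v) (σ L u v) (simple u v) i
    with ℕ.<-cmp (toℕ u) (toℕ v) | orientE L u v (orient⇒adj u v o)
  ... | _ | inj₂ (o′ , _) = ≡.subst IsTrue o′ o
  ... | tri≈ _ u≡v _ | _ = adj-irrefl {T = G} (orient⇒adj u v o) (Fin.toℕ-injective u≡v)
  ... | tri< u<v _ _ | inj₁ (t , _) = sat u v u<v (orient⇒adj u v o) e′
    where
    e′ : constraint u v ⟨$⟩ʳ κ u ≡ κ v
    e′ rewrite t = e
  ... | tri> _ _ v<u | inj₁ (_ , f) = sat v u v<u (adj-sym {T = G} (orient⇒adj u v o)) e′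
    where
    e′ : constraint v u ⟨$⟩ʳ κ v ≡ κ u
    e′ rewrite f = ≡.trans (≡.cong (arc u v ⟨$⟩ˡ_) (≡.sym e)) (Perm.inverseˡ (arc u v))

  private
    arc-proper : ∀ κ → Proper L κ → ∀ u v → IsTrue (orient L u v) → Adj G u v → arc u v ⟨$⟩ʳ κ u ≢ κ v
    arc-proper κ proper u v o adj with mult G u v | σ L u v | proper u v o
    arc-proper κ proper u v o (s≤s _) | suc m | s | h = h Fin.zero

  proper⇒satisfies : ∀ κ → Proper L κ → Satisfies κ
  proper⇒satisfies κ proper u v _ adj e with orientE L u v adj
  ... | inj₁ (t , _) rewrite t = arc-proper κ proper u v (≡.subst IsTrue (≡.sym t) _) adj e
  ... | inj₂ (f , t) rewrite f = arc-proper κ proper v u (≡.subst IsTrue (≡.sym t) _) (adj-sym {T = G} adj)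
          (≡.trans (≡.cong (arc v u ⟨$⟩ʳ_) (≡.sym e)) (Perm.inverseʳ (arc v u)))

  module _ {T : Multigraph n} (T⊆G : ∀ {u v} → Adj T u v → Adj G u v) where

    -- Renaming the colours vertex by vertex along the tree turns the constraints on its edges into identities.
    gauge : ∀ {vs es} → Subtree T vs es → Fin n → Permutation k k
    gauge (root r) w = Perm.id
    gauge (grow {a = a} {b} t _ _ _) w with w Fin.≟ b
    ... | yes _ = Perm.flip (constraint a b) Perm.∘ₚ gauge t a
    ... | no _  = gauge t w

    Gauged : (Fin n → Permutation k k) → Fin n → Fin n → Set
    Gauged φ u v = ∀ c → φ v ⟨$⟩ʳ (constraint u v ⟨$⟩ʳ c) ≡ φ u ⟨$⟩ʳ c

    gauge-old : ∀ {vs es a b} (t : Subtree T vs es) (a∈ : a ∈ vs) (b∉ : b ∉ vs) (adj : Adj T a b) →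
      ∀ {w} → w ≢ b → gauge (grow t a∈ b∉ adj) w ≡ gauge t w
    gauge-old {b = b} t a∈ b∉ adj {w} w≢b with w Fin.≟ b
    ... | yes e = ⊥-elim (w≢b e)
    ... | no _  = ≡.refl

    gauge-new : ∀ {vs es a b} (t : Subtree T vs es) (a∈ : a ∈ vs) (b∉ : b ∉ vs) (adj : Adj T a b) →
      gauge (grow t a∈ b∉ adj) b ≡ Perm.flip (constraint a b) Perm.∘ₚ gauge t a
    gauge-new {b = b} t a∈ b∉ adj with b Fin.≟ b
    ... | yes _ = ≡.refl
    ... | no ne = ⊥-elim (ne ≡.refl)

    gauged : ∀ {vs es} (t : Subtree T vs es) → ∀ u v → 1 ≤ edges {T = T} es u v → Gauged (gauge t) u v
    gauged (root r) u v ()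
    gauged tree@(grow {vs} {a = a} {b} t a∈ b∉ adj) u v e c
      with edgeIndicator-cases a b u v (adj-irrefl {T = T} adj)
    ... | inj₂ (_ , inj₁ (≡.refl , ≡.refl)) rewrite gauge-new t a∈ b∉ adj | gauge-old t a∈ b∉ adj (adj-irrefl {T = T} adj) =
          ≡.cong (gauge t a ⟨$⟩ʳ_) (Perm.inverseˡ (constraint a b))
    ... | inj₂ (_ , inj₂ (≡.refl , ≡.refl)) rewrite gauge-new t a∈ b∉ adj | gauge-old t a∈ b∉ adj (adj-irrefl {T = T} adj) =
          ≡.cong (gauge t a ⟨$⟩ʳ_) (≡.trans (≡.sym (Perm.inverseˡ (constraint a b)))
            (≡.cong (constraint a b ⟨$⟩ˡ_) (constraint-flip (adj-sym {T = G} (T⊆G adj)) c)))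
    ... | inj₁ z rewrite z | gauge-old t a∈ b∉ adj (proj₁ (endpoints-old {T = T} t b∉ e))
                           | gauge-old t a∈ b∉ adj (proj₂ (endpoints-old {T = T} t b∉ e)) = gauged t u v e c

-- Monotonicity of DP-colourability in the number of colours

module _ {k : ℕ} (π : Permutation (suc k) (suc k)) where
  private
    below : ∀ {k} (x y : Fin (suc k)) → x ≢ y → Fin k
    below (Fin.suc j) _           _  = j
    below Fin.zero    (Fin.suc j) _  = j
    below Fin.zero    Fin.zero    ne = ⊥-elim (ne ≡.refl)

    below-injective : ∀ {k} (x x′ y : Fin (suc k)) p p′ → below x y p ≡ below x′ y p′ → x ≡ x′
    below-injective (Fin.suc j) (Fin.suc j′) y           p p′ e = ≡.cong Fin.suc e
    below-injective Fin.zero    Fin.zero     y           p p′ e = ≡.refl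
    below-injective (Fin.suc j) Fin.zero     (Fin.suc _) p p′ e = ⊥-elim (p (≡.cong Fin.suc e))
    below-injective Fin.zero    (Fin.suc j)  (Fin.suc _) p p′ e = ⊥-elim (p′ (≡.cong Fin.suc (≡.sym e)))
    below-injective (Fin.suc _) Fin.zero     Fin.zero    p p′ e = ⊥-elim (p′ ≡.refl)
    below-injective Fin.zero    (Fin.suc _)  Fin.zero    p p′ e = ⊥-elim (p ≡.refl)

    suc≢zero : ∀ {i : Fin k} → Fin.suc i ≢ Fin.zero
    suc≢zero ()

    restricted : Fin k → Fin k
    restricted i = below (π ⟨$⟩ʳ Fin.suc i) (π ⟨$⟩ʳ Fin.zero) (suc≢zero ∘ permutation-injective π)

  -- The cycle through colour zero is shortcut past it.
  dropZero : Permutation k k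
  dropZero = injective⇒permutation restricted λ e →
    Fin.suc-injective (permutation-injective π (below-injective _ _ (π ⟨$⟩ʳ Fin.zero) _ _ e))

  dropZero-suc : ∀ {i j} → π ⟨$⟩ʳ Fin.suc i ≡ Fin.suc j → dropZero ⟨$⟩ʳ i ≡ j
  dropZero-suc {i} e = lemma (π ⟨$⟩ʳ Fin.suc i) (π ⟨$⟩ʳ Fin.zero) _ e
    where
    lemma : ∀ {k} (x y : Fin (suc k)) ne {j} → x ≡ Fin.suc j → below x y ne ≡ j
    lemma (Fin.suc _) y ne ≡.refl = ≡.refl

DPColorable-suc : ∀ {n k} {G : Multigraph n} → DPColorable G k → DPColorable G (suc k)
DPColorable-suc colorable L =
  let κ , proper = colorable (record
        { orient = orient L ; orientE = orientE L ; orientN = orientN L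
        ; σ = λ u v i → dropZero (σ L u v i) })
  in Fin.suc ∘ κ , λ u v o i e → proper u v o i (dropZero-suc (σ L u v i) e)

χDP≤⇒DPColorable : ∀ {n k} {G : Multigraph n} → χDP≤ G k → DPColorable G k
χDP≤⇒DPColorable {G = G} (j , j≤k , colorable) = go (ℕ.≤⇒≤′ j≤k)
  where
  go : ∀ {k} → j ℕ.≤′ k → DPColorable G k
  go ℕ.≤′-refl       = colorable
  go (ℕ.≤′-step j≤k) = DPColorable-suc {G = G} (go j≤k)

-- The two bounds

module EdgePolynomials {k : ℕ} (F : FieldOn k) where
  open FieldOn F renaming (_+_ to _+ᶠ_; _*_ to _*ᶠ_)
  open Degree F
  open CommutativeRing ring using (_-_; zeroˡ; zeroʳ; *-congˡ; *-congʳ; -‿inverseʳ)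
  open IntegerCoefficients ring

  minus-deg : ∀ {n D} {f g : Point n → Fin k} → Deg D f → Deg D g → Deg D (λ x → f x - g x)
  minus-deg p q = add p (resp (λ x → solve 1 (λ y → :- con (+ 1) :* y := :- y) ≡.refl _) (scale (- 1#) q))

  listProduct : ∀ {A : Set} {n} → (A → Point n → Fin k) → List A → Point n → Fin k
  listProduct f []      x = 1#
  listProduct f (a ∷ l) x = f a x *ᶠ listProduct f l x

  listProduct-deg : ∀ {A : Set} {n} {f : A → Point n → Fin k} {d : A → ℕ} → (∀ a → Deg (suc (d a)) (f a)) →
    ∀ l → Deg (suc (sum (map d l))) (listProduct f l)
  listProduct-deg p []      = const 1#
  listProduct-deg p (a ∷ l) = mul (p a) (listProduct-deg p l)

  listProduct-nonzero : ∀ {A : Set} {n} {f : A → Point n → Fin k} {x} → ∀ l → (∀ {a} → a ∈ l → f a x ≢ 0#) →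
    listProduct f l x ≢ 0#
  listProduct-nonzero []      h = 1≢0
  listProduct-nonzero (a ∷ l) h = *-nonzero (h (here ≡.refl)) (listProduct-nonzero l (h ∘ there))

  listProduct-factor : ∀ {A : Set} {n} {f : A → Point n → Fin k} {x} → ∀ {l a} → a ∈ l →
    listProduct f l x ≢ 0# → f a x ≢ 0#
  listProduct-factor (here ≡.refl) h z = h (≡.trans (*-congʳ z) (zeroˡ _))
  listProduct-factor (there a∈)    h z = listProduct-factor a∈ (λ z′ → h (≡.trans (*-congˡ z′) (zeroʳ _))) z

  -- The three alternatives are a non-edge, an edge off the tree and a tree edge, according to the
  -- multiplicities in G and in the grown tree.
  choose : ∀ {A : Set} → ℕ → ℕ → A → A → A → A
  choose zero    _       a b c = a
  choose (suc _) zero    a b c = b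
  choose (suc _) (suc _) a b c = c

  choose-elim : ∀ {A : Set} (P : A → Set) m h {a b c} → (m ≡ 0 → P a) → (1 ≤ m → h ≡ 0 → P b) →
    (1 ≤ m → 1 ≤ h → P c) → P (choose m h a b c)
  choose-elim P zero    h       pa pb pc = pa ≡.refl
  choose-elim P (suc m) zero    pa pb pc = pb (s≤s z≤n) ≡.refl
  choose-elim P (suc m) (suc h) pa pb pc = pc (s≤s z≤n) (s≤s z≤n)

  module Bound {n} {G T : Multigraph (suc n)} (simple : IsSimple G) (L : Labeling G k)
    (T⊆G : ∀ {u v} → Adj T u v → Adj G u v)
    {vs es} (tree : Subtree T vs es) (spans : ∀ v → v ∈ vs) where

    φ : Fin (suc n) → Permutation k k
    φ = gauge L {T} T⊆G tree

    e : Fin (suc n) → Fin k → Fin k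
    e v c = φ v ⟨$⟩ʳ c

    e-injective : ∀ v {b c} → e v b ≡ e v c → b ≡ c
    e-injective v = permutation-injective (φ v)

    H : Fin (suc n) → Fin (suc n) → ℕ
    H = edges {T = T} es

    module _ (d : ℕ) (g : Fin (suc n) → Fin (suc n) → Point (suc n) → Fin k)
      (g-deg : ∀ u v → Deg (suc (suc d)) (g u v))
      (g-sound : ∀ u v κ → g u v (e ⟪ κ ⟫) ≢ 0# → constraint L u v ⟨$⟩ʳ κ u ≢ κ v) where

      edgeFactor : Fin (suc n) → Fin (suc n) → Point (suc n) → Fin k
      edgeFactor u v = choose (mult G u v) (H u v) (λ _ → 1#) (g u v) (λ x → x v - x u)

      edgeDegree : Fin (suc n) → Fin (suc n) → ℕ
      edgeDegree u v = choose (mult G u v) (H u v) 0 (suc d) 1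

      edgeFactor-deg : ∀ u v → Deg (suc (edgeDegree u v)) (edgeFactor u v)
      edgeFactor-deg u v with mult G u v | H u v
      ... | zero  | _     = const 1#
      ... | suc _ | zero  = g-deg u v
      ... | suc _ | suc _ = minus-deg (variable-deg v) (variable-deg u)

      pairFactor : Fin (suc n) × Fin (suc n) → Point (suc n) → Fin k
      pairFactor (u , v) = if u <?ᵇ v then edgeFactor u v else λ _ → 1#

      pairFactor-deg : ∀ p → Deg (suc (increasing edgeDegree p)) (pairFactor p)
      pairFactor-deg (u , v) with u <?ᵇ v
      ... | true  = edgeFactor-deg u v
      ... | false = const 1#

      polynomial : Point (suc n) → Fin k
      polynomial = listProduct pairFactor pairs

      edgeFactor-sound : ∀ u v κ → Adj G u v → edgeFactor u v (e ⟪ κ ⟫) ≢ 0# → constraint L u v ⟨$⟩ʳ κ u ≢ κ v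
      edgeFactor-sound u v κ adj = choose-elim (λ f → f (e ⟪ κ ⟫) ≢ 0# → constraint L u v ⟨$⟩ʳ κ u ≢ κ v)
            (mult G u v) (H u v)
        {λ _ → 1#} {g u v} {λ x → x v - x u}
        (λ z → ⊥-elim (ℕ.<⇒≢ adj (≡.sym z)))
        (λ _ _ → g-sound u v κ)
        (λ _ H≥1 h eq → h (≡.trans (≡.cong (_- e u (κ u)) (≡.trans (≡.cong (e v) (≡.sym eq))
          (gauged L {T} T⊆G tree u v H≥1 (κ u)))) (-‿inverseʳ _)))

      polynomial-sound : ∀ κ → polynomial (e ⟪ κ ⟫) ≢ 0# → Proper L κ
      polynomial-sound κ nz = satisfies⇒proper L simple κ λ u v u<v adj →
        edgeFactor-sound u v κ adj (≡.subst (λ (f : Point (suc n) → Fin k) → f (e ⟪ κ ⟫) ≢ 0#)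
          (ordered {x = edgeFactor u v} {λ _ → 1#} (u <?ᵇ v) (ℕ.<⇒<ᵇ u<v))
          (listProduct-factor {f = pairFactor} {e ⟪ κ ⟫} (∈-pairs u v) nz))
        where
        ordered : ∀ {A : Set} {x y : A} b → IsTrue b → (if b then x else y) ≡ x
        ordered true _ = ≡.refl

      -- An off-tree edge costs degree d + 1 and a tree edge 1, so each tree edge saves d. Summation
      -- needs no subtraction in this form.
      degree-identity : ∀ u v → edgeDegree u v + d * H u v ≡ suc d * mult G u v
      degree-identity u v with mult G u v | simple u v | edges-cases {T = T} tree u v | T⊆G {u} {v}
      ... | suc (suc _) | s≤s () | _ | _
      ... | zero        | _ | inj₂ (_ , adj) | ⊆ with () ← ⊆ adj
      ... | zero        | _ | inj₁ H≡0 | _ rewrite H≡0 = ≡.refl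
      ... | suc zero    | _ | inj₁ H≡0 | _ rewrite H≡0 | ℕ.*-zeroʳ d | ℕ.*-identityʳ d = ℕ.+-identityʳ _
      ... | suc zero    | _ | inj₂ (H≡1 , _) | _ rewrite H≡1 = ≡.refl

      degree-bound : edgeSum edgeDegree + d * n ≤ suc d * edgeCount G
      degree-bound = begin
        edgeSum edgeDegree + d * n                      ≤⟨ ℕ.+-monoʳ-≤ (edgeSum edgeDegree) (ℕ.*-monoʳ-≤ d n≤) ⟩
        edgeSum edgeDegree + d * edgeSum H              ≡⟨ ≡.cong (λ h → edgeSum edgeDegree + h) (edgeSum-* d H) ⟨
        edgeSum edgeDegree + edgeSum (λ u v → d * H u v) ≡⟨ edgeSum-+ edgeDegree _ ⟨
        edgeSum (λ u v → edgeDegree u v + d * H u v)    ≡⟨ edgeSum-cong degree-identity ⟩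
        edgeSum (λ u v → suc d * mult G u v)            ≡⟨ edgeSum-* (suc d) (mult G) ⟩
        suc d * edgeSum (mult G)                        ≡⟨ ≡.cong (suc d *_) (edgeCount≡edgeSum G) ⟨
        suc d * edgeCount G                             ∎
        where
        open ℕ.≤-Reasoning
        n≤ : n ≤ edgeSum H
        n≤ = ℕ.s≤s⁻¹ (ℕ.≤-trans (length-≥ spans) (edgeSum-edges {T = T} tree))

      -- `κ` supplies the one nonzero value for Alon-Füredi. Off the tree the condition is that `g`
      -- be nonzero rather than that `κ` be proper, since a product of lines may vanish at a proper
      -- colouring.
      count-bound : ∀ κ → (∀ u v → toℕ u < toℕ v → Adj G u v → H u v ≡ 0 → g u v (e ⟪ κ ⟫) ≢ 0#) →
        (∀ u v → toℕ u < toℕ v → Adj T u v → constraint L u v ⟨$⟩ʳ κ u ≢ κ v) →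
        k ^ (suc n * (k ∸ 1)) ≤ k ^ edgeSum edgeDegree * numColorings L ^ (k ∸ 1)
      count-bound κ g-nonzero tree-ok = ℕ.≤-trans
        (alonFüredi (suc n) e e-injective _ polynomial (listProduct-deg pairFactor-deg pairs) κ
          (listProduct-nonzero pairs λ {(u , v)} _ → pair-nonzero u v))
        (ℕ.*-monoʳ-≤ (k ^ edgeSum edgeDegree) (ℕ.^-monoˡ-≤ (k ∸ 1)
          (length-filter-≤ (nonzero? e polynomial) (proper? L) polynomial-sound (allMaps (suc n) k))))
        where
        edge-nonzero : ∀ u v → toℕ u < toℕ v → edgeFactor u v (e ⟪ κ ⟫) ≢ 0#
        edge-nonzero u v u<v = choose-elim (λ f → f (e ⟪ κ ⟫) ≢ 0#) (mult G u v)
              (H u v) {λ _ → 1#} {g u v} {λ x → x v - x u}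
          (λ _ → 1≢0)
          (g-nonzero u v u<v)
          (λ _ H≥1 z → tree-ok u v u<v (edges⇒adj {T = T} tree H≥1)
            (e-injective v (≡.trans (gauged L {T} T⊆G tree u v H≥1 (κ u)) (≡.sym (-≡0⇒≡ z)))))
        pair-nonzero : ∀ u v → pairFactor (u , v) (e ⟪ κ ⟫) ≢ 0#
        pair-nonzero u v with u <?ᵇ v in eq
        ... | false = 1≢0
        ... | true  = edge-nonzero u v (ℕ.<ᵇ⇒< (toℕ u) (toℕ v) (≡.subst IsTrue (≡.sym eq) _))

    transported : Fin (suc n) → Fin (suc n) → Permutation k k
    transported u v = Perm.flip (φ u) Perm.∘ₚ constraint L u v Perm.∘ₚ φ v

    transported-at : ∀ u v c → transported u v ⟨$⟩ʳ e u c ≡ e v (constraint L u v ⟨$⟩ʳ c)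
    transported-at u v c = ≡.cong (λ c → e v (constraint L u v ⟨$⟩ʳ c)) (Perm.inverseˡ (φ u))

increasingLabeling : ∀ {n k} (G : Multigraph n) → (∀ u v → Fin (mult G u v) → Permutation k k) → Labeling G k
increasingLabeling {n} G σ = record { orient = o ; orientE = oE ; orientN = oN ; σ = σ }
  where
  o : Fin n → Fin n → Bool
  o u v = (u <?ᵇ v) ∧ (0 ℕ.<ᵇ mult G u v)
  true-of : ∀ {b} → IsTrue b → b ≡ true
  true-of {true} _ = ≡.refl
  o-true : ∀ u v → toℕ u < toℕ v → 1 ≤ mult G u v → o u v ≡ true
  o-true u v u<v adj rewrite true-of (ℕ.<⇒<ᵇ u<v) = true-of (ℕ.<⇒<ᵇ adj)
  o-false : ∀ u v → toℕ v < toℕ u → o u v ≡ false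
  o-false u v v<u with u <?ᵇ v in eq
  ... | false = ≡.refl
  ... | true  = ⊥-elim (ℕ.<-asym v<u (ℕ.<ᵇ⇒< (toℕ u) (toℕ v) (≡.subst IsTrue (≡.sym eq) _)))
  oE : ∀ u v → 1 ≤ mult G u v → (o u v ≡ true × o v u ≡ false) ⊎ (o u v ≡ false × o v u ≡ true)
  oE u v adj with ℕ.<-cmp (toℕ u) (toℕ v)
  ... | tri< u<v _ _ = inj₁ (o-true u v u<v adj , o-false v u u<v)
  ... | tri≈ _ u≡v _ = ⊥-elim (adj-irrefl {T = G} adj (Fin.toℕ-injective u≡v))
  ... | tri> _ _ v<u = inj₂ (o-false u v v<u , o-true v u v<u (adj-sym {T = G} adj))
  oN : ∀ u v → mult G u v ≡ 0 → o u v ≡ false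
  oN u v z rewrite z = Bool.∧-zeroʳ _

increasingLabeling-proper : ∀ {n k} (G : Multigraph n) (σ : ∀ u v → Fin (mult G u v) → Permutation k k) κ →
  Proper (increasingLabeling G σ) κ → ∀ u v → toℕ u < toℕ v → ∀ i → σ u v i ⟨$⟩ʳ κ u ≢ κ v
increasingLabeling-proper G σ κ proper u v u<v i = proper u v
  (both (ℕ.<⇒<ᵇ u<v) (ℕ.<⇒<ᵇ (ℕ.≤-<-trans z≤n (Fin.toℕ<n i)))) i
  where
  both : ∀ {a b} → IsTrue a → IsTrue b → IsTrue (a ∧ b)
  both {true} {true} _ _ = _

module PartTwo {j : ℕ} (F : FieldOn (suc (suc (suc j)))) where
  private
    k = suc (suc (suc j))
  open FieldOn F using (ring; 0#)
  open CommutativeRing ring using (_-_; -‿inverseʳ)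
  open Degree F
  open EdgePolynomials F
  open Interpolation F (s≤s (s≤s z≤n)) using (permutation-deg)

  module _ {n} {G T : Multigraph (suc n)} (simple : IsSimple G) (L : Labeling G k)
    (T⊆G : ∀ {u v} → Adj T u v → Adj G u v)
    {vs es} (tree : Subtree T vs es) (spans : ∀ v → v ∈ vs) where
    open Bound simple L T⊆G tree spans

    private
      g : Fin (suc n) → Fin (suc n) → Point (suc n) → Fin k
      g u v x = x v - (transported u v ⟨$⟩ʳ x u)

      -- Here k = j + 3, so this says degree at most k - 2.
      g-deg : ∀ u v → Deg (suc (suc j)) (g u v)
      g-deg u v = minus-deg (deg-≤ (s≤s (s≤s z≤n)) (variable-deg v)) (permutation-deg (transported u v) u)

      g-sound : ∀ u v κ → g u v (e ⟪ κ ⟫) ≢ 0# → constraint L u v ⟨$⟩ʳ κ u ≢ κ v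
      g-sound u v κ nz eq = nz (≡.trans
        (≡.cong (λ c → e v (κ v) - c) (≡.trans (transported-at u v (κ u)) (≡.cong (e v) eq))) (-‿inverseʳ _))

      g-complete : ∀ u v κ → constraint L u v ⟨$⟩ʳ κ u ≢ κ v → g u v (e ⟪ κ ⟫) ≢ 0#
      g-complete u v κ ok z = ok (e-injective v (≡.sym (≡.trans (-≡0⇒≡ z) (transported-at u v (κ u)))))

    bound : ∀ κ → Proper L κ →
      ∃ λ D → D + j * n ≤ suc j * edgeCount G × k ^ (suc n * (k ∸ 1)) ≤ k ^ D * numColorings L ^ (k ∸ 1)
    bound κ proper = _ , degree-bound j g g-deg g-sound , count-bound j g g-deg g-sound κ
        (λ u v u<v adj _ → g-complete u v κ (sat u v u<v adj))
        (λ u v u<v adj → sat u v u<v (T⊆G adj))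
      where sat = proper⇒satisfies L κ proper

module _ {n q : ℕ} {G T : Multigraph n} {u v : Fin n} where

  multiplyOff-off : mult T u v ≡ 0 → mult (multiplyOff q G T) u v ≡ q * mult G u v
  multiplyOff-off z rewrite z = ≡.refl

  multiplyOff-on : Adj T u v → mult (multiplyOff q G T) u v ≡ mult G u v
  multiplyOff-on adj with mult T u v | adj
  ... | suc _ | _ = ≡.refl

module _ {A : Set} where

  ifZero : ℕ → A → A → A
  ifZero zero    a b = a
  ifZero (suc _) a b = b

  ifZero-zero : ∀ {m a b} → m ≡ 0 → ifZero m a b ≡ a
  ifZero-zero ≡.refl = ≡.refl

  ifZero-positive : ∀ {m a b} → 1 ≤ m → ifZero m a b ≡ b
  ifZero-positive (s≤s _) = ≡.refl

-- Here `q` is ⌊k/2⌋ - 1: there are `suc q` lines per off-tree edge, and `q` is the degree saved by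
-- each tree edge.
module PartOne {k : ℕ} (F : FieldOn k) (q : ℕ) (parity : k ≡ suc q * 2 ⊎ k ≡ suc (suc q * 2)) where
  open FieldOn F renaming (_+_ to _+ᶠ_; _*_ to _*ᶠ_)
  open CommutativeRing ring using (_-_; -‿inverseʳ)
  open IntegerCoefficients ring
  open Degree F
  open EdgePolynomials F

  module _ {n} {G T : Multigraph (suc n)} (simple : IsSimple G) (L : Labeling G k)
    (T⊆G : ∀ {u v} → Adj T u v → Adj G u v)
    {vs es} (tree : Subtree T vs es) (spans : ∀ v → v ∈ vs) (acyclic : ¬ HasCycle T) where
    open Bound simple L T⊆G tree spans

    private
      G′ : Multigraph (suc n)
      G′ = multiplyOff (suc q) G T

      module LinesOf u v = Lines F (transported u v)

      line : ∀ u v → Fin (suc q) → LinesOf.Line u v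
      line u v = proj₁ (LinesOf.cover u v (suc q) parity)

      line-at : ∀ u v → Fin (suc q) → Fin k → Fin k
      line-at u v i z = LinesOf.Line.slope (line u v i) *ᶠ z +ᶠ LinesOf.Line.intercept (line u v i)

      line-at-injective : ∀ u v i {y z} → line-at u v i y ≡ line-at u v i z → y ≡ z
      line-at-injective u v i {y} {z} h = LinesOf.cancel u v (LinesOf.Line.slope≢0 (line u v i))
        (≡.trans (solve 3 (λ a b y → y :* a := a :* y :+ b :- b) ≡.refl a b y)
          (≡.trans (≡.cong (_- b) h) (solve 3 (λ a b y → a :* y :+ b :- b := y :* a) ≡.refl a b z)))
        where
        a = LinesOf.Line.slope (line u v i)
        b = LinesOf.Line.intercept (line u v i)

      linePermutation : ∀ u v → Fin (suc q) → Permutation k k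
      linePermutation u v i = injective⇒permutation (λ c → φ v ⟨$⟩ˡ line-at u v i (e u c)) λ {b} {c} h →
        e-injective u (line-at-injective u v i (≡.trans (≡.sym (Perm.inverseʳ (φ v)))
          (≡.trans (≡.cong (e v) h) (Perm.inverseʳ (φ v)))))

      g : Fin (suc n) → Fin (suc n) → Point (suc n) → Fin k
      g u v = listProduct (λ i x → x v - line-at u v i (x u)) (List.allFin (suc q))

      g-deg : ∀ u v → Deg (suc (suc q)) (g u v)
      g-deg u v = ≡.subst (λ D → Deg (suc D) (g u v)) (ones (suc q))
        (listProduct-deg {d = λ _ → 1} (λ i → minus-deg (variable-deg v)
          (add (scale _ (variable-deg u)) (const _))) (List.allFin (suc q)))
        where
        ones : ∀ q → sum (map (λ _ → 1) (List.allFin q)) ≡ q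
        ones q = ≡.trans (go (List.allFin q)) (List.length-tabulate id)
          where
          go : ∀ {A : Set} (l : List A) → sum (map (λ _ → 1) l) ≡ length l
          go []      = ≡.refl
          go (_ ∷ l) = ≡.cong suc (go l)

      g-sound : ∀ u v κ → g u v (e ⟪ κ ⟫) ≢ 0# → constraint L u v ⟨$⟩ʳ κ u ≢ κ v
      g-sound u v κ nz eq = let i , on = proj₂ (LinesOf.cover u v (suc q) parity) (e u (κ u)) in
        listProduct-factor (Mem.∈-allFin i) nz (≡.trans
          (≡.cong (λ c → e v (κ v) - c) (≡.trans (≡.sym on)
                (≡.trans (transported-at u v (κ u)) (≡.cong (e v) eq)))) (-‿inverseʳ _))

      g-complete : ∀ u v κ → (∀ i → linePermutation u v i ⟨$⟩ʳ κ u ≢ κ v) → g u v (e ⟪ κ ⟫) ≢ 0#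
      g-complete u v κ ok = listProduct-nonzero (List.allFin (suc q)) λ {i} _ z → ok i
        (≡.trans (≡.cong (φ v ⟨$⟩ˡ_) (≡.sym (-≡0⇒≡ z))) (Perm.inverseˡ (φ v)))

      -- The multiplicity in `G′` is not definitionally `suc q`, so a copy of an edge selects its
      -- line by number; the default zero is never reached from the copies that are inspected.
      fin : ℕ → Fin (suc q)
      fin i with i ℕ.<? suc q
      ... | yes i<q = fromℕ< i<q
      ... | no _    = Fin.zero

      fin-toℕ : ∀ i → fin (toℕ i) ≡ i
      fin-toℕ i with toℕ i ℕ.<? suc q
      ... | yes i<q = Fin.fromℕ<-toℕ i i<q
      ... | no ≮    = ⊥-elim (≮ (Fin.toℕ<n i))

      σ′ : ∀ u v → Fin (mult G′ u v) → Permutation k k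
      σ′ u v i = ifZero (mult T u v) (linePermutation u v (fin (toℕ i))) (constraint L u v)

    auxiliaryLabeling : Labeling G′ k
    auxiliaryLabeling = increasingLabeling G′ σ′

    private
      module _ (κ : Fin (suc n) → Fin k) (proper : Proper auxiliaryLabeling κ) where

        lines-ok : ∀ u v → toℕ u < toℕ v → Adj G u v → mult T u v ≡ 0 → ∀ i → linePermutation u v i ⟨$⟩ʳ κ u ≢ κ v
        lines-ok u v u<v adj T≡0 i eq = increasingLabeling-proper G′ σ′ κ proper u v u<v (fromℕ< i<)
            (≡.trans (≡.cong (_⟨$⟩ʳ κ u) σ′≡) eq)
          where
          i< : toℕ i < mult G′ u v
          i< = ≡.subst (toℕ i <_) (≡.sym (multiplyOff-off {q = suc q} {G} {T} T≡0))
                 (ℕ.≤-trans (Fin.toℕ<n i) (ℕ.m≤m*n (suc q) (mult G u v) {{ℕ.>-nonZero adj}}))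
          σ′≡ : σ′ u v (fromℕ< i<) ≡ linePermutation u v i
          σ′≡ = ≡.trans (ifZero-zero T≡0) (≡.cong (linePermutation u v)
                  (≡.trans (≡.cong fin (Fin.toℕ-fromℕ< i<)) (fin-toℕ i)))

        tree-ok : ∀ u v → toℕ u < toℕ v → Adj T u v → constraint L u v ⟨$⟩ʳ κ u ≢ κ v
        tree-ok u v u<v adj eq = increasingLabeling-proper G′ σ′ κ proper u v u<v (fromℕ< 0<)
            (≡.trans (≡.cong (_⟨$⟩ʳ κ u) (ifZero-positive adj)) eq)
          where
          0< : 0 < mult G′ u v
          0< = ≡.subst (0 <_) (≡.sym (multiplyOff-on {q = suc q} {G} {T} adj)) (T⊆G adj)

        off-tree : ∀ u v → H u v ≡ 0 → mult T u v ≡ 0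
        off-tree u v H≡0 = zero-of (mult T u v) λ adj →
          ℕ.<⇒≢ (edges-complete {T = T} acyclic tree (spans u) (spans v) adj) (≡.sym H≡0)
          where
          zero-of : ∀ m → ¬ 1 ≤ m → m ≡ 0
          zero-of zero    _ = ≡.refl
          zero-of (suc m) h = ⊥-elim (h (s≤s z≤n))

    bound : ∀ κ → Proper auxiliaryLabeling κ →
      ∃ λ D → D + q * n ≤ suc q * edgeCount G × k ^ (suc n * (k ∸ 1)) ≤ k ^ D * numColorings L ^ (k ∸ 1)
    bound κ proper = _ , degree-bound q g g-deg g-sound , count-bound q g g-deg g-sound κ
      (λ u v u<v adj H≡0 → g-complete u v κ (lines-ok κ proper u v u<v adj (off-tree κ proper u v H≡0)))
      (tree-ok κ proper)

-- Exponent arithmetic and assembly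

cancel-power : ∀ k {E D m B} → 1 ≤ k → E + D ≤ m → k ^ m ≤ k ^ D * B → k ^ E ≤ B
cancel-power k {E} {D} {m} {B} 1≤k E+D≤m h = ℕ.*-cancelˡ-≤ (k ^ D) {{ℕ.m^n≢0 k D}} (begin
  k ^ D * k ^ E   ≡⟨ ℕ.^-distribˡ-+-* k D E ⟨
  k ^ (D + E)     ≤⟨ ℕ.^-monoʳ-≤ k (ℕ.≤-trans (ℕ.≤-reflexive (ℕ.+-comm D E)) E+D≤m) ⟩
  k ^ m           ≤⟨ h ⟩
  k ^ D * B       ∎)
  where
  open ℕ.≤-Reasoning
  instance k≢0 = ℕ.>-nonZero 1≤k

-- `X ∸ Y` is the numerator of the exponent, and `Y ≤ X` makes it a genuine difference. Adding q(n +
-- 1) + 1 to both sides completes D to the left side of the degree bound, after which Y cancels.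
exponent-one : ∀ q j n M D → let X = suc n * (suc q + suc j) + 1 ; Y = suc q * M + suc q in
  Y ≤ X → D + q * n ≤ suc q * M → (X ∸ Y) + D ≤ suc n * suc (suc j)
exponent-one q j n M D Y≤X h = ℕ.+-cancelʳ-≤ (q * suc n + 1) _ _ (begin
  (E + D) + (q * suc n + 1)           ≡⟨ solve 4 (λ E D q n → (E :+ D) :+ (q :* (con 1 :+ n) :+ con 1)
                                           := E :+ ((D :+ q :* n) :+ (con 1 :+ q))) ≡.refl E D q n ⟩
  E + ((D + q * n) + suc q)           ≤⟨ ℕ.+-monoʳ-≤ E (ℕ.+-monoˡ-≤ (suc q) h) ⟩
  E + (suc q * M + suc q)             ≡⟨ ℕ.m∸n+n≡m Y≤X ⟩
  suc n * (suc q + suc j) + 1         ≡⟨ solve 3 (λ n q j → (con 1 :+ n) :* ((con 1 :+ q) :+ (con 1 :+ j)) :+ con 1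
                                           := (con 1 :+ n) :* (con 2 :+ j) :+ (q :* (con 1 :+ n) :+ con 1)) ≡.refl n q j ⟩
  suc n * suc (suc j) + (q * suc n + 1) ∎)
  where
  open ℕ.≤-Reasoning
  open +-*-Solver
  E = (suc n * (suc q + suc j) + 1) ∸ (suc q * M + suc q)

exponent-two : ∀ j n M D → let X = 2 * suc n * suc j ; Y = suc j * M + j in
  Y ≤ X → D + j * n ≤ suc j * M → (X ∸ Y) + D ≤ suc n * suc (suc j)
exponent-two j n M D Y≤X h = ℕ.+-cancelʳ-≤ (j * suc n) _ _ (begin
  (E + D) + j * suc n                 ≡⟨ solve 4 (λ E D j n → (E :+ D) :+ j :* (con 1 :+ n)
                                           := E :+ ((D :+ j :* n) :+ j)) ≡.refl E D j n ⟩
  E + ((D + j * n) + j)               ≤⟨ ℕ.+-monoʳ-≤ E (ℕ.+-monoˡ-≤ j h) ⟩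
  E + (suc j * M + j)                 ≡⟨ ℕ.m∸n+n≡m Y≤X ⟩
  2 * suc n * suc j                   ≡⟨ solve 2 (λ n j → con 2 :* (con 1 :+ n) :* (con 1 :+ j)
                                           := (con 1 :+ n) :* (con 2 :+ j) :+ j :* (con 1 :+ n)) ≡.refl n j ⟩
  suc n * suc (suc j) + j * suc n     ∎)
  where
  open ℕ.≤-Reasoning
  open +-*-Solver
  E = 2 * suc n * suc j ∸ (suc j * M + j)

half-parity : ∀ k → k ≡ k / 2 * 2 ⊎ k ≡ suc (k / 2 * 2)
half-parity k with k % 2 | m≡m%n+[m/n]*n k 2 | m%n<n k 2
... | 0 | eq | _ = inj₁ eq
... | 1 | eq | _ = inj₂ eq
... | suc (suc _) | _ | s≤s (s≤s ())

1≤numColorings-empty : ∀ {k} {G : Multigraph 0} (L : Labeling G k) → 1 ≤ numColorings L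
1≤numColorings-empty L = count-positive (proper? L) (λ _ _ ()) (λ ()) (λ ())

tree⊆graph : ∀ {n} {G T : Multigraph n} → IsSpanningTree G T → ∀ {u v} → Adj T u v → Adj G u v
tree⊆graph (_ , T≤G) {u} {v} adj = ℕ.≤-trans adj (T≤G u v)

partOne : ∀ {k} → FieldOn k → 2 < k → ∀ q → (k ≡ q * 2 ⊎ k ≡ suc (q * 2)) →
  ∀ {n} (G T : Multigraph n) → IsSimple G → IsSpanningTree G T → DPColorable (multiplyOff q G T) k →
  q * edgeCount G + q ≤ n * (q + (k ∸ 2)) + 1 → (L : Labeling G k) →
  k ^ (n * (q + (k ∸ 2)) + 1 ∸ (q * edgeCount G + q)) ≤ numColorings L ^ (k ∸ 1)
partOne F 2<k zero (inj₁ ≡.refl) with () ← 2<k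
partOne F 2<k zero (inj₂ ≡.refl) with s≤s () ← 2<k
partOne {suc zero} F (s≤s ()) (suc _)
partOne {suc (suc zero)} F (s≤s (s≤s ())) (suc _)
-- Without vertices the truncated exponent is 0, and the empty colouring makes the count positive.
partOne {k} F 2<k (suc q) parity {zero} G T _ _ _ _ L
  rewrite ℕ.m≤n⇒m∸n≡0 {1} {suc q * edgeCount G + suc q} (ℕ.≤-trans (s≤s z≤n) (ℕ.m≤n+m (suc q) (suc q * edgeCount G))) =
  ℕ.m^n>0 (numColorings L) {{ℕ.>-nonZero (1≤numColorings-empty L)}} (k ∸ 1)
partOne {suc (suc (suc j))} F 2<k (suc q) parity {suc n} G T simple spanningTree@((_ , connected , acyclic) ,
      _) colorable Y≤X L =
  let vs , es , tree , spans = spanning connected Fin.zero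
      κ , proper = colorable (PartOne.auxiliaryLabeling F q parity simple L T⊆G tree spans acyclic)
      D , degree , count = PartOne.bound F q parity simple L T⊆G tree spans acyclic κ proper
  in cancel-power _ {D = D} (s≤s z≤n) (exponent-one q j n (edgeCount G) D Y≤X degree) count
  where
  T⊆G : ∀ {u v} → Adj T u v → Adj G u v
  T⊆G = tree⊆graph {G = G} {T} spanningTree

partTwo : ∀ {k} → FieldOn k → 2 < k →
  ∀ {n} (G T : Multigraph n) → IsSimple G → IsSpanningTree G T → DPColorable G k →
  (k ∸ 2) * edgeCount G + (k ∸ 3) ≤ 2 * n * (k ∸ 2) → (L : Labeling G k) →
  k ^ (2 * n * (k ∸ 2) ∸ ((k ∸ 2) * edgeCount G + (k ∸ 3))) ≤ numColorings L ^ (k ∸ 1)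
partTwo {k} F 2<k {zero} G T _ _ _ _ L
  rewrite ℕ.0∸n≡0 ((k ∸ 2) * edgeCount G + (k ∸ 3)) =
  ℕ.m^n>0 (numColorings L) {{ℕ.>-nonZero (1≤numColorings-empty L)}} (k ∸ 1)
partTwo {suc (suc (suc j))} F 2<k {suc n} G T simple spanningTree@((_ , connected , _) , _) colorable Y≤X L =
  let vs , es , tree , spans = spanning connected Fin.zero
      κ , proper = colorable L
      D , degree , count = PartTwo.bound F simple L (tree⊆graph {G = G} {T} spanningTree) tree spans κ proper
  in cancel-power _ {D = D} (s≤s z≤n) (exponent-two j n (edgeCount G) D Y≤X degree) count
partTwo {suc (suc zero)} F (s≤s (s≤s ()))
partTwo {suc zero} F (s≤s ())

theorem1p2 : ∀ (p r k : ℕ) → Prime p → k ≡ p ^ r → 2 < k →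
    ∀ (n m : ℕ) (G T : Multigraph n) → IsSimple G → Connected G →
    IsSpanningTree G T → edgeCount G ≡ m →
    (χDP≤ (multiplyOff (k / 2) G T) k →
    (k / 2) * m + k / 2 ≤ n * (k / 2 + (k ∸ 2)) + 1 →
    ∀ (P : ℕ) → IsPDP G k P →
    k ^ (n * (k / 2 + (k ∸ 2)) + 1 ∸ ((k / 2) * m + k / 2)) ≤ P ^ (k ∸ 1))
    ×
    (χDP≤ G k →
    (k ∸ 2) * m + (k ∸ 3) ≤ 2 * n * (k ∸ 2) →
    ∀ (P : ℕ) → IsPDP G k P →
    k ^ (2 * n * (k ∸ 2) ∸ ((k ∸ 2) * m + (k ∸ 3))) ≤ P ^ (k ∸ 1))
theorem1p2 p r k p-prime ≡.refl 2<k n m G T simple _ spanningTree ≡.refl =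
  -- The minimum `P` is attained by some labeling `L`, and the bound holds for every labeling.
  (λ { χ h _ ((L , ≡.refl) , _) → partOne F 2<k (k / 2) (half-parity k) G T simple spanningTree
         (χDP≤⇒DPColorable {G = multiplyOff (k / 2) G T} χ) h L }) ,
  (λ { χ h _ ((L , ≡.refl) , _) → partTwo F 2<k G T simple spanningTree (χDP≤⇒DPColorable {G = G} χ) h L })
  where F = finiteField p-prime r (ℕ.<-trans (s≤s (s≤s z≤n)) 2<k)
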